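{- For every natural number $n$, $wsp(K_n)\leq n+1$, where $K_n$ is the complete graph on $n$ vertices and $wsp(K_n)$ is its weak separation number.
   Context: Let $G$ be a graph. A path system of $G$ is a set of paths in $G$. Given edges $e,f\in E(G)$ and a path system $\mathcal{P}$ of $G$, the edge $e$ is separated from $f$ by $\mathcal{P}$ if there exists a path $P\in\mathcal{P}$ such that $e\in P$ and $f\notin P$. A path system $\mathcal{P}$ weakly separates $G$ if for every pair of distinct edges of $G$ it separates one of them from the other. The weak separation number $wsp(G)$ is the minimum size of a path system of $G$ that weakly separates $G$. -}

module Defs where

open import Data.Fin using (Fin; _<_; _<?_; _≟_)
open import Data.Fin.Properties using (all?; <-cmp; <-asym; <-irrefl; injective⇒≤)
open import Data.List using (List; []; _∷_; length; lookup; map; reverse; filter; allFin; upTo; concatMap; cartesianProduct; cartesianProductWith)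
open import Data.List.Membership.Propositional using (_∈_; lose)
open import Data.List.Membership.Propositional.Properties
  using (∈-allFin; ∈-lookup; ∈-upTo⁺; ∈-map⁺; ∈-filter⁺; ∈-concatMap⁺; ∈-cartesianProduct⁺; ∈-cartesianProductWith⁺)
open import Data.List.Properties using (≡-dec)
open import Data.List.Relation.Binary.Infix.Heterogeneous using (Infix; here; there)
open import Data.List.Relation.Binary.Infix.Heterogeneous.Properties using (infix?)
open import Data.List.Relation.Binary.Prefix.Heterogeneous using ([]; _∷_)
open import Data.List.Relation.Unary.All using (All; []; _∷_)
import Data.List.Relation.Unary.All as All
import Data.List.Relation.Unary.All.Properties as Allₚ
open import Data.List.Relation.Unary.AllPairs using (AllPairs; []; _∷_; allPairs?)
import Data.List.Relation.Unary.AllPairs.Properties as AllPairsₚ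
open import Data.List.Relation.Unary.Any using (Any; here; any?; satisfied)
open import Data.List.Relation.Unary.Linked using (Linked; [-]; _∷_; linked?)
open import Data.List.Relation.Unary.Unique.Propositional using (Unique)
open import Data.List.Relation.Unary.Unique.Propositional.Properties using (allFin⁺; cartesianProduct⁺; filter⁺)
open import Data.Nat using (ℕ; zero; suc; _≤_; s≤s)
import Data.Nat as ℕ
import Data.Nat.Properties as ℕₚ
open import Data.Product using (∃; _×_; _,_; proj₁; proj₂)
open import Data.Sum using (_⊎_; inj₁; inj₂)
open import Function using (_∘_)
open import Relation.Binary.Definitions using (Decidable; Symmetric; Irreflexive; tri<; tri≈; tri>)
open import Relation.Binary.PropositionalEquality using (_≡_; _≢_; refl; sym; cong; ≢-sym)
open import Relation.Nullary using (¬_; Dec; yes; no; contradiction)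
open import Relation.Nullary.Decidable using (map′; _×-dec_; _⊎-dec_; _→-dec_; ¬?)
import Relation.Unary as U

record Graph (n : ℕ) : Set₁ where
  infix 4 _~_ _~?_
  field
    _~_    : Fin n → Fin n → Set
    _~?_   : Decidable _~_
    ~-sym  : Symmetric _~_
    irrefl : Irreflexive _≡_ _~_

complete : ∀ n → Graph n
complete n = record
  { _~_    = _≢_
  ; _~?_   = λ u v → ¬? (u ≟ v)
  ; ~-sym  = ≢-sym
  ; irrefl = λ u≡v u≢v → u≢v u≡v
  }

-- A path is a nonempty repetition-free sequence of vertices, consecutive ones
-- being adjacent.
record IsPath {n} (G : Graph n) (p : List (Fin n)) : Set where
  constructor mkPath
  open Graph G
  field
    nonEmpty : p ≢ []
    simple   : Unique p
    walk     : Linked _~_ p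

-- Paths are subgraphs, so a sequence and its reversal give the same path.
_≈ₚ_ : ∀ {n} → List (Fin n) → List (Fin n) → Set
p ≈ₚ q = p ≡ q ⊎ p ≡ reverse q

-- A finite set of paths of G, listed without repetition; the number of paths
-- in it is the length of the list.
record IsPathSystem {n} (G : Graph n) (ps : List (List (Fin n))) : Set where
  constructor mkSystem
  field
    paths    : All (IsPath G) ps
    distinct : AllPairs (λ p q → ¬ p ≈ₚ q) ps

-- Edges are undirected: both orientations of a pair of adjacent vertices occur
-- as elements of Edge, and _≈ₑ_ identifies them.
record Edge {n} (G : Graph n) : Set where
  constructor mkEdge
  open Graph G
  field
    end₁ end₂ : Fin n
    adjacent  : end₁ ~ end₂

open Edge

SamePair : ∀ {n} → Fin n → Fin n → Fin n → Fin n → Set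
SamePair u v x y = (u ≡ x × v ≡ y) ⊎ (u ≡ y × v ≡ x)

_≈ₑ_ : ∀ {n} {G : Graph n} → Edge G → Edge G → Set
e ≈ₑ f = SamePair (end₁ e) (end₂ e) (end₁ f) (end₂ f)

Traverses : ∀ {n} → List (Fin n) → Fin n → Fin n → Set
Traverses p u v = Infix _≡_ (u ∷ v ∷ []) p ⊎ Infix _≡_ (v ∷ u ∷ []) p

_∈ₑ_ : ∀ {n} {G : Graph n} → Edge G → List (Fin n) → Set
e ∈ₑ p = Traverses p (end₁ e) (end₂ e)

Separates : ∀ {n} {G : Graph n} → List (List (Fin n)) → Edge G → Edge G → Set
Separates ps e f = Any (λ p → e ∈ₑ p × ¬ f ∈ₑ p) ps

WeaklySeparates : ∀ {n} → Graph n → List (List (Fin n)) → Set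
WeaklySeparates G ps =
  (e f : Edge G) → ¬ e ≈ₑ f → Separates ps e f ⊎ Separates ps f e

HasWeaklySeparatingSystem : ∀ {n} → Graph n → ℕ → Set
HasWeaklySeparatingSystem G k =
  ∃ λ ps → IsPathSystem G ps × length ps ≡ k × WeaklySeparates G ps

IsLeast : (ℕ → Set) → ℕ → Set
IsLeast P k = P k × (∀ {j} → P j → k ≤ j)

-- Every inhabited decidable predicate on ℕ has a least element.

least : ∀ {P : ℕ → Set} → U.Decidable P → ∃ P → ∃ (IsLeast P)
least {P} P? (b , Pb) with search (suc b)
  where
  search : ∀ m → ∃ (IsLeast P) ⊎ (∀ {j} → P j → m ≤ j)
  search zero    = inj₂ λ _ → ℕ.z≤n
  search (suc m) with search m
  ... | inj₁ found = inj₁ found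
  ... | inj₂ below with P? m
  ...   | yes Pm = inj₁ (m , Pm , below)
  ...   | no ¬Pm = inj₂ λ {j} Pj → ℕₚ.≤∧≢⇒< (below Pj) λ { refl → ¬Pm Pj }
... | inj₁ found = found
... | inj₂ below = contradiction (below Pb) ℕₚ.1+n≰n

-- HasWeaklySeparatingSystem is decidable: path systems are among the lists of
-- given length over a finite list of candidate vertex sequences.

words : ∀ {A : Set} → List A → ℕ → List (List A)
words xs zero    = [] ∷ []
words xs (suc k) = cartesianProductWith _∷_ xs (words xs k)

∈-words : ∀ {A : Set} {xs ys : List A} → All (_∈ xs) ys → ys ∈ words xs (length ys)
∈-words []         = here refl
∈-words (y∈ ∷ ys∈) = ∈-cartesianProductWith⁺ _∷_ y∈ (∈-words ys∈)

lookup-injective : ∀ {A : Set} {xs : List A} → Unique xs → ∀ {i j} → lookup xs i ≡ lookup xs j → i ≡ j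
lookup-injective (_ ∷ _) {Fin.zero}  {Fin.zero}  _  = refl
lookup-injective (x∉ ∷ _) {Fin.zero}  {Fin.suc j} eq = contradiction eq (All.lookup x∉ (∈-lookup j))
lookup-injective (x∉ ∷ _) {Fin.suc i} {Fin.zero}  eq = contradiction (sym eq) (All.lookup x∉ (∈-lookup i))
lookup-injective (_ ∷ u) {Fin.suc i} {Fin.suc j} eq = cong Fin.suc (lookup-injective u eq)

unique⇒length≤ : ∀ {n} {p : List (Fin n)} → Unique p → length p ≤ n
unique⇒length≤ u = injective⇒≤ (lookup-injective u)

candidates : ∀ n → List (List (Fin n))
candidates n = concatMap (words (allFin n)) (upTo (suc n))

∈-candidates : ∀ {n} {p : List (Fin n)} → Unique p → p ∈ candidates n
∈-candidates {n} {p} u = ∈-concatMap⁺ (words (allFin n))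
  (lose (∈-upTo⁺ (s≤s (unique⇒length≤ u))) (∈-words (All.universal ∈-allFin p)))

module _ {n} (G : Graph n) where
  open Graph G

  isPath? : U.Decidable (IsPath G)
  isPath? p = map′ (λ (a , b , c) → mkPath a b c) (λ (mkPath a b c) → a , b , c)
    (¬? (≡-dec _≟_ p []) ×-dec allPairs? (λ u v → ¬? (u ≟ v)) p ×-dec linked? _~?_ p)

  _≈ₚ?_ : Decidable (_≈ₚ_ {n})
  p ≈ₚ? q = ≡-dec _≟_ p q ⊎-dec ≡-dec _≟_ p (reverse q)

  isPathSystem? : U.Decidable (IsPathSystem G)
  isPathSystem? ps = map′ (λ (a , b) → mkSystem a b) (λ (mkSystem a b) → a , b)
    (All.all? isPath? ps ×-dec allPairs? (λ p q → ¬? (p ≈ₚ? q)) ps)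

  traverses? : ∀ (p : List (Fin n)) u v → Dec (Traverses p u v)
  traverses? p u v = infix? _≟_ _ p ⊎-dec infix? _≟_ _ p

  separates? : ∀ ps (e f : Edge G) → Dec (Separates ps e f)
  separates? ps e f = any? (λ p → traverses? p _ _ ×-dec ¬? (traverses? p _ _)) ps

  allEdges? : ∀ {Q : Edge G → Set} → (∀ {u v} {a b : u ~ v} → Q (mkEdge u v a) → Q (mkEdge u v b)) →
              U.Decidable Q → Dec (∀ e → Q e)
  allEdges? {Q} resp Q? = map′ (λ h e → h (end₁ e) (end₂ e) (adjacent e)) (λ h u v a → h (mkEdge u v a))
    (all? λ u → all? λ v → pair? u v)
    where
    pair? : ∀ u v → Dec ((a : u ~ v) → Q (mkEdge u v a))
    pair? u v with u ~? v
    ... | no ¬a = yes λ a → contradiction a ¬a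
    ... | yes a = map′ (λ q b → resp q) (λ h → h a) (Q? (mkEdge u v a))

  weaklySeparates? : U.Decidable (WeaklySeparates G)
  weaklySeparates? ps = allEdges? (λ h → h) λ e → allEdges? (λ h → h) λ f →
    ¬? (same? (end₁ e) (end₂ e) (end₁ f) (end₂ f)) →-dec (separates? ps e f ⊎-dec separates? ps f e)
    where
    same? : ∀ (u v x y : Fin n) → Dec (SamePair u v x y)
    same? u v x y = (u ≟ x ×-dec v ≟ y) ⊎-dec (u ≟ y ×-dec v ≟ x)

  hasWeaklySeparatingSystem? : U.Decidable (HasWeaklySeparatingSystem G)
  hasWeaklySeparatingSystem? k = map′ satisfied
    (λ { (ps , sys , refl , ws) → lose (∈-words (All.map (∈-candidates ∘ IsPath.simple) (IsPathSystem.paths sys))) (sys , refl , ws) })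
    (any? (λ ps → isPathSystem? ps ×-dec length ps ℕ.≟ k ×-dec weaklySeparates? ps)
          (words (candidates n) k))

  -- The single-edge paths form a weakly separating system.

  IsArc : Fin n × Fin n → Set
  IsArc (u , v) = u < v × u ~ v

  arc? : U.Decidable IsArc
  arc? (u , v) = u <? v ×-dec u ~? v

  arcs : List (Fin n × Fin n)
  arcs = filter arc? (cartesianProduct (allFin n) (allFin n))

  arcPath : Fin n × Fin n → List (Fin n)
  arcPath (u , v) = u ∷ v ∷ []

  arcSystem : List (List (Fin n))
  arcSystem = map arcPath arcs

  arcPath-isPath : ∀ {a} → IsArc a → IsPath G (arcPath a)
  arcPath-isPath (u<v , u~v) = mkPath (λ ())
    (((λ u≡v → <-irrefl u≡v u<v) ∷ []) ∷ [] ∷ []) (u~v ∷ [-])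

  arcPath-distinct : ∀ {a b} → IsArc a → IsArc b → a ≢ b → ¬ arcPath a ≈ₚ arcPath b
  arcPath-distinct _         _         a≢b (inj₁ refl) = a≢b refl
  arcPath-distinct (u<v , _) (v<u , _) _   (inj₂ refl) = <-asym u<v v<u

  arcSystem-isPathSystem : IsPathSystem G arcSystem
  arcSystem-isPathSystem = mkSystem
    (Allₚ.map⁺ (All.map arcPath-isPath allArcs))
    (AllPairsₚ.map⁺ (go allArcs (filter⁺ arc? (cartesianProduct⁺ (allFin⁺ n) (allFin⁺ n)))))
    where
    allArcs : All IsArc arcs
    allArcs = Allₚ.all-filter arc? (cartesianProduct (allFin n) (allFin n))
    go : ∀ {as} → All IsArc as → Unique as → AllPairs (λ a b → ¬ arcPath a ≈ₚ arcPath b) as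
    go []       []       = []
    go (a ∷ as) (a∉ ∷ u) = All.zipWith (λ (b , a≢b) → arcPath-distinct a b a≢b) (as , a∉) ∷ go as u

  traverses-pair : ∀ {u v x y : Fin n} → Traverses (u ∷ v ∷ []) x y → SamePair u v x y
  traverses-pair (inj₁ (here (refl ∷ refl ∷ _))) = inj₁ (refl , refl)
  traverses-pair (inj₁ (there (here (_ ∷ ()))))
  traverses-pair (inj₁ (there (there (here ()))))
  traverses-pair (inj₂ (here (refl ∷ refl ∷ _))) = inj₂ (refl , refl)
  traverses-pair (inj₂ (there (here (_ ∷ ()))))
  traverses-pair (inj₂ (there (there (here ()))))

  arcSystem-separates : WeaklySeparates G arcSystem
  arcSystem-separates (mkEdge u v u~v) f e≉f with <-cmp u v
  ... | tri< u<v _ _ = inj₁ (lose (∈-map⁺ arcPath (∈-filter⁺ arc? (∈-cartesianProduct⁺ (∈-allFin u) (∈-allFin v)) (u<v , u~v)))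
                               (inj₁ (here (refl ∷ refl ∷ [])) , e≉f ∘ traverses-pair))
  ... | tri≈ _ u≡v _ = contradiction u~v (irrefl u≡v)
  ... | tri> _ _ v<u = inj₁ (lose (∈-map⁺ arcPath (∈-filter⁺ arc? (∈-cartesianProduct⁺ (∈-allFin v) (∈-allFin u)) (v<u , ~-sym u~v)))
                               (inj₂ (here (refl ∷ refl ∷ [])) , e≉f ∘ swap ∘ traverses-pair))
    where
    swap : ∀ {u v x y : Fin n} → SamePair v u x y → SamePair u v x y
    swap (inj₁ (p , q)) = inj₂ (q , p)
    swap (inj₂ (p , q)) = inj₁ (q , p)

  wsp-exists : ∃ (IsLeast (HasWeaklySeparatingSystem G))
  wsp-exists = least hasWeaklySeparatingSystem?
    (length arcSystem , arcSystem , arcSystem-isPathSystem , refl , arcSystem-separates)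

  wsp : ℕ
  wsp = proj₁ wsp-exists

  wsp-isLeast : IsLeast (HasWeaklySeparatingSystem G) wsp
  wsp-isLeast = proj₂ wsp-exists

{-# OPTIONS --safe #-}
-- If n paths on n vertices, one starting at each vertex, cover every edge and no
-- two edges lie on the same set of paths, then wsp (K n) ≤ n. Such systems are
-- composed: systems on ℤ/m, where m is coprime to 6, and on u ≤ m - 2 vertices
-- yield one on 4m + u vertices. The vertices are the lines of four slopes in the
-- plane over ℤ/m, together with u further vertices placed at distinct heights.
-- The differences of the slopes are units, so lines of different slopes meet in
-- exactly one point. The path of a line climbs along it, visiting the lines of
-- the other slopes and the further vertex at each height, and then follows a path
-- of the system on ℤ/m among its parallels. The path of a further vertex visits
-- all lines through all points of its height. The two paths on which an edge
-- between lines of different slopes lies belong to lines of the remaining two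
-- slopes, or to one line and one further vertex, and this determines the edge.
-- Each walk along a height is closed and has to be opened, which leaves one edge
-- on a single path; its index must be spare, that is, not used alone by an edge of
-- the system on ℤ/m. The composed system has three times as many spare indices.
-- This settles all n except 37 small values, for which systems found by computer
-- search are verified by evaluation.
module Submission where

open import Algebra.Bundles using (CommutativeRing)
open import Algebra.Solver.Ring.AlmostCommutativeRing using (AlmostCommutativeRing; fromCommutativeRing; _-Raw-AlmostCommutative⟶_)
open import Algebra.Structures using (IsCommutativeRing)
open import Data.Bool.Properties using (∨-comm; T-≡)
open import Data.Empty using (⊥; ⊥-elim)
open import Data.Fin.Properties using (toℕ-injective; toℕ-fromℕ<; toℕ<n; fromℕ<-toℕ; splitAt-↑ˡ; splitAt-↑ʳ; splitAt⁻¹-↑ˡ; splitAt⁻¹-↑ʳ; inject≤-injective)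
open import Data.List using (List; []; _∷_; _++_; concatMap; map; applyUpTo; drop; length; lookup; allFin; reverse)
open import Data.List.Membership.Propositional using (_∈_; _∉_; find; lose)
open import Data.List.Membership.Propositional.Properties using (∈-++⁺ˡ; ∈-++⁺ʳ; ∈-++⁻; ∈-concatMap⁻; ∈-map⁻; ∈-applyUpTo⁺; ∈-applyUpTo⁻; ∈-map⁺; ∈-lookup; ∈-allFin)
open import Data.List.Properties using (++-assoc; map-id-local; map-∘; length-map; length-++; length-tabulate; unfold-reverse; reverse-involutive)
open import Data.List.Relation.Binary.Infix.Heterogeneous using (Infix; here; there)
open import Data.List.Relation.Binary.Prefix.Heterogeneous using ([]; _∷_)
open import Data.List.Relation.Unary.All using (_∷_; All; [])
open import Data.List.Relation.Unary.All.Properties using (¬Any⇒All¬)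
open import Data.List.Relation.Unary.AllPairs using (_∷_; [])
open import Data.List.Relation.Unary.Any using (here; there; any?)
open import Data.List.Relation.Unary.Linked.Properties using (AllPairs⇒Linked)
open import Data.List.Relation.Unary.Unique.Propositional using (Unique)
open import Data.Maybe using (Maybe; just; nothing)
open import Data.Maybe.Properties using (just-injective)
open import Data.Product using (∃; _×_; _,_; proj₁; proj₂; ∃-syntax)
open import Data.Sum using (_⊎_; inj₁; inj₂; [_,_]′; swap)
open import Data.Unit using (tt)
open import Function.Bundles using (Equivalence)
open import Level using (0ℓ)
open import Relation.Binary.Definitions using (DecidableEquality; tri<; tri≈; tri>)
open import Relation.Binary.PropositionalEquality using (_≡_; _≢_; refl; sym; trans; subst; cong; cong₂; isEquivalence; subst₂)
open import Relation.Nullary using (¬_; yes; no; contradiction)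
import Data.Fin as Fin
import Data.Integer as ℤ
import Data.Integer.Properties as ℤₚ
import Data.List.Relation.Unary.All as All
import Data.List.Relation.Unary.All.Properties as Allₚ
import Data.List.Relation.Unary.AllPairs as AllPairs
import Data.List.Relation.Unary.AllPairs.Properties as AllPairsₚ
import Data.List.Relation.Unary.Unique.Propositional.Properties as Uniqueₚ
import Data.Nat.Properties as ℕₚ

-- The bound leaves almost no room: `n` paths have at most n(n - 1) edges, twice as many as the
-- complete graph, and each path can be the only one through at most one edge. So all but a few
-- edges lie on exactly two paths, different edges on different pairs, and the pairs of lines in a
-- plane supply such pairs. With the slopes in cyclic order a, b, c, d, an edge between neighbouring
-- slopes at a point belongs to the lines of the other two slopes there. A further vertex splices
-- itself into one of the two occurrences, and its own path takes that occurrence over. The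
-- diagonals ac and bd serve as steps from one height to the next. Two constraints fix the details.
-- The walk of a further vertex has to pass from point to point, so the edges bc join the line of
-- slope b at a point to the line of slope c at the next point: hence the shifts by one. And the
-- edge by which a path leaves its closed walk for its parallels must again be an edge at a point,
-- which is why paths are indexed by their first vertices. To this end slopes a and c exchange edges
-- at height 0, and slopes b and d at height 1.

module Systems where

  open import Data.Nat using (ℕ; zero; suc)

  -- Edges of paths, systems of paths, and walks composed of blocks

  data Step {V : Set} (u v : V) : List V → Set where
    here  : ∀ {p} → Step u v (u ∷ v ∷ p)
    there : ∀ {w p} → Step u v p → Step u v (w ∷ p)

  Joins : {V : Set} → List V → V → V → Set
  Joins p u v = Step u v p ⊎ Step v u p

  module _ {V : Set} where

    step-++ʳ : ∀ {u v : V} p {q} → Step u v q → Step u v (p ++ q)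
    step-++ʳ []      s = s
    step-++ʳ (_ ∷ p) s = there (step-++ʳ p s)

    step-++ˡ : ∀ {u v : V} {p} q → Step u v p → Step u v (p ++ q)
    step-++ˡ q here      = here
    step-++ˡ q (there s) = there (step-++ˡ q s)

    step-glue : ∀ {u v w : V} p {q} → Step u v (p ++ w ∷ []) → Step u v (p ++ w ∷ q)
    step-glue []          (there ())
    step-glue (_ ∷ [])    here      = here
    step-glue (_ ∷ _ ∷ p) here      = here
    step-glue (_ ∷ p)     (there s) = there (step-glue p s)

    step-split : ∀ {u v w : V} p {q} → Step u v (p ++ w ∷ q) → Step u v (p ++ w ∷ []) ⊎ Step u v (w ∷ q)
    step-split []          s         = inj₂ s
    step-split (_ ∷ [])    here      = inj₁ here
    step-split (_ ∷ _ ∷ p) here      = inj₁ here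
    step-split (_ ∷ p)     (there s) with step-split p s
    ... | inj₁ t = inj₁ (there t)
    ... | inj₂ t = inj₂ t

    step-∈ˡ : ∀ {u v : V} {p} → Step u v p → u ∈ p
    step-∈ˡ here      = here refl
    step-∈ˡ (there s) = there (step-∈ˡ s)

    step-∈ʳ : ∀ {u v : V} {p} → Step u v p → v ∈ p
    step-∈ʳ here      = there (here refl)
    step-∈ʳ (there s) = there (step-∈ʳ s)

  step-map⁺ : ∀ {V W : Set} (f : V → W) {u v p} → Step u v p → Step (f u) (f v) (map f p)
  step-map⁺ f here      = here
  step-map⁺ f (there s) = there (step-map⁺ f s)

  step-map⁻ : ∀ {V W : Set} (f : V → W) {u v} p → Step u v (map f p) →
              ∃ λ u′ → ∃ λ v′ → Step u′ v′ p × u ≡ f u′ × v ≡ f v′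
  step-map⁻ f (x ∷ y ∷ p) here = x , y , here , refl , refl
  step-map⁻ f (x ∷ p) (there s) with step-map⁻ f p s
  ... | a , b , t , e , e′ = a , b , there t , e , e′

  -- The paths are indexed by the vertices they start from; an index g in spare
  -- is one such that no edge lies on path g alone.
  record System (V : Set) : Set where
    field
      tail      : V → List V
      simple    : ∀ v → Unique (v ∷ tail v)
    path : V → List V
    path v = v ∷ tail v
    field
      covers    : ∀ {x y} → x ≢ y → ∃ λ i → Joins (path i) x y
      separates : ∀ {x y z w} → x ≢ y → z ≢ w →
                  (∀ i → Joins (path i) x y → Joins (path i) z w) →
                  (∀ i → Joins (path i) z w → Joins (path i) x y) →
                  (x ≡ z × y ≡ w) ⊎ (x ≡ w × y ≡ z)
      spare     : List V
      spare!    : Unique spare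
      lonely    : ∀ {g x y} → g ∈ spare → x ≢ y → ¬ (∀ i → Joins (path i) x y → i ≡ g)

  module Orbit {Z : Set} (next : Z → Z) where

    orbit : ℕ → Z → List Z
    orbit zero    κ = []
    orbit (suc n) κ = κ ∷ orbit n (next κ)

    shift : ℕ → Z → Z
    shift zero    κ = κ
    shift (suc n) κ = shift n (next κ)

    orbit-next : ∀ {n κ λ′} → λ′ ∈ orbit n κ → next λ′ ∈ orbit n (next κ)
    orbit-next {suc n} (here refl) = here refl
    orbit-next {suc n} (there p)   = there (orbit-next p)

    module Blocks {V : Set} (first last : Z → V) (inner : Z → List V) where

      block : Z → List V
      block κ = first κ ∷ inner κ ++ last κ ∷ []

      walk : ℕ → Z → List V → List V
      walk n κ t = concatMap block (orbit n κ) ++ t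

      private
        unfold : ∀ n κ t → walk (suc n) κ t ≡ (first κ ∷ inner κ) ++ last κ ∷ walk n (next κ) t
        unfold n κ t = trans (++-assoc (block κ) _ t) (++-assoc (first κ ∷ inner κ) (last κ ∷ []) _)

      -- A step of a walk leads from one block to the next, lies inside a block, or comes after the
      -- last block. The vertex `last κ` in front stands for a block just completed, so that the
      -- induction can start between two blocks.
      walk-elim : (P : V → V → Set) → ∀ n κ t →
                  (∀ {λ′} → λ′ ∈ orbit n κ → P (last λ′) (first (next λ′))) →
                  (∀ {λ′ u v} → λ′ ∈ orbit n (next κ) → Step u v (block λ′) → P u v) →
                  (∀ {u v} → Step u v (last (shift n κ) ∷ t) → P u v) →
                  ∀ {u v} → Step u v (last κ ∷ walk n (next κ) t) → P u v
      walk-elim P zero    κ t across inside after s = after s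
      walk-elim P (suc n) κ t across inside after {u} {v} s
        with subst (λ l → Step u v (last κ ∷ l)) (unfold n (next κ) t) s
      ... | here    = across (here refl)
      ... | there s′ with step-split (first (next κ) ∷ inner (next κ)) s′
      ...   | inj₁ b = inside (here refl) b
      ...   | inj₂ r = walk-elim P n (next κ) t (λ q → across (there q)) (λ q → inside (there q)) after r

      walk-across : ∀ n κ t {λ′} → λ′ ∈ orbit n κ → Step (last λ′) (first (next λ′)) (last κ ∷ walk n (next κ) t)
      walk-across (suc n) κ t (here refl) = here
      walk-across (suc n) κ t (there q)   =
        there (subst (Step _ _) (sym (unfold n (next κ) t)) (step-++ʳ (first (next κ) ∷ inner (next κ)) (walk-across n (next κ) t q)))

      walk-after : ∀ n κ t {u v} → Step u v (last (shift n κ) ∷ t) → Step u v (last κ ∷ walk n (next κ) t)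
      walk-after zero    κ t s = s
      walk-after (suc n) κ t s =
        there (subst (Step _ _) (sym (unfold n (next κ) t)) (step-++ʳ (first (next κ) ∷ inner (next κ)) (walk-after n (next κ) t s)))

      walk-inside : ∀ n κ t {λ′ u v} → λ′ ∈ orbit n κ → Step u v (block λ′) → Step u v (walk n κ t)
      walk-inside (suc n) κ t (here refl) s = subst (Step _ _) (sym (unfold n κ t)) (step-glue (first κ ∷ inner κ) s)
      walk-inside (suc n) κ t (there q)   s =
        subst (Step _ _) (sym (++-assoc (block κ) _ t)) (step-++ʳ (block κ) (walk-inside n (next κ) t q s))

    orbit-last : ∀ n κ {λ′} → λ′ ∈ orbit (suc n) κ → λ′ ∈ orbit n κ ⊎ λ′ ≡ shift n κ
    orbit-last zero    κ (here e)  = inj₂ e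
    orbit-last (suc n) κ (here e)  = inj₁ (here e)
    orbit-last (suc n) κ (there q) with orbit-last n (next κ) q
    ... | inj₁ r = inj₁ (there r)
    ... | inj₂ e = inj₂ e

  module _ {V : Set} where

    step-++⁻ : ∀ {u v y : V} p {q} → Step u v (p ++ y ∷ q) → Step u v p ⊎ (u ∈ p × v ≡ y) ⊎ Step u v (y ∷ q)
    step-++⁻ []          s         = inj₂ (inj₂ s)
    step-++⁻ (_ ∷ [])    here      = inj₂ (inj₁ (here refl , refl))
    step-++⁻ (_ ∷ _ ∷ p) here      = inj₁ here
    step-++⁻ (_ ∷ p)     (there s) with step-++⁻ p s
    ... | inj₁ t              = inj₁ (there t)
    ... | inj₂ (inj₁ (e , f)) = inj₂ (inj₁ (there e , f))
    ... | inj₂ (inj₂ t)       = inj₂ (inj₂ t)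

-- Residue rings and the geometry of lines over them

module Cyclic where

  open Systems
  import Algebra.Solver.Ring
  open import Data.Nat using (ℕ; suc)

  record Residues : Set₁ where
    infixl 6 _+_
    infixl 7 _*_
    infix  8 -_
    field
      Z       : Set
      _+_ _*_ : Z → Z → Z
      -_      : Z → Z
      0# 1#   : Z
      isCommutativeRing : IsCommutativeRing _≡_ _+_ _*_ -_ 0# 1#
    almostRing : AlmostCommutativeRing 0ℓ 0ℓ
    almostRing = fromCommutativeRing (record { isCommutativeRing = isCommutativeRing })
    field
      reduce : CommutativeRing.rawRing ℤₚ.+-*-commutativeRing -Raw-AlmostCommutative⟶ almostRing
    -- The image of an integer under `reduce`, rather than the unit of the ring structure, so that
    -- it is literally the value of the solver's constant 1; likewise for `zer`.
    one : Z
    one = _-Raw-AlmostCommutative⟶_.⟦_⟧ reduce (ℤ.+ 1)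
    zer : Z
    zer = _-Raw-AlmostCommutative⟶_.⟦_⟧ reduce (ℤ.+ 0)
    next : Z → Z
    next κ = κ + one
    field
      _≟_      : DecidableEquality Z
      N        : ℕ
      full     : ∀ κ λ′ → λ′ ∈ Orbit.orbit next (suc N) κ
      distinct : ∀ κ → Unique (Orbit.orbit next (suc N) κ)
      period   : ∀ κ → next (Orbit.shift next N κ) ≡ κ

  module Arithmetic (C : Residues) where
    open Residues C public
    infixl 6 _-_
    open Orbit next public
    open _-Raw-AlmostCommutative⟶_ reduce public using (⟦_⟧)

    _-_ : Z → Z → Z
    x - y = x + - y

    same? : ∀ a b → Maybe (⟦ a ⟧ ≡ ⟦ b ⟧)
    same? a b with a ℤₚ.≟ b
    ... | yes e = just (cong ⟦_⟧ e)
    ... | no  _ = nothing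

    open Algebra.Solver.Ring _ almostRing reduce same? public
      using (solve; _:=_; _:+_; _:*_; _:-_; :-_; con)

    -- An equation follows from equations whose differences combine linearly to
    -- its own difference.
    module _ where
      open IsCommutativeRing isCommutativeRing using (+-assoc; -‿inverseˡ; -‿inverseʳ; +-identityˡ; +-identityʳ)

      abstract
        diff⇒≡ : ∀ {x y} → x - y ≡ 0# → x ≡ y
        diff⇒≡ {x} {y} e = trans (sym (+-identityʳ x)) (trans (cong (x +_) (sym (-‿inverseˡ y)))
          (trans (sym (+-assoc x (- y) y)) (trans (cong (_+ y) e) (+-identityˡ y))))

      abstract
        ≡⇒diff : ∀ {x y} → x ≡ y → x - y ≡ 0#
        ≡⇒diff {x} refl = -‿inverseʳ x

    module _ where
      open IsCommutativeRing isCommutativeRing using (zeroʳ; +-identityʳ)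

      abstract
        linear : ∀ {x y a b} c → a ≡ b → x - y ≡ c * (a - b) → x ≡ y
        linear c e q = diff⇒≡ (trans q (trans (cong (c *_) (≡⇒diff e)) (zeroʳ c)))

      abstract
        linear₂ : ∀ {x y a b a′ b′} c c′ → a ≡ b → a′ ≡ b′ → x - y ≡ c * (a - b) + c′ * (a′ - b′) → x ≡ y
        linear₂ c c′ e e′ q = diff⇒≡ (trans q (trans (cong₂ (λ s t → c * s + c′ * t) (≡⇒diff e) (≡⇒diff e′))
          (trans (cong₂ _+_ (zeroʳ c) (zeroʳ c′)) (+-identityʳ 0#))))

    others : ∀ {κ λ′} → λ′ ≢ κ → λ′ ∈ orbit N (next κ)
    others {κ} {λ′} ≢κ with full κ λ′
    ... | here e  = contradiction e ≢κ
    ... | there q = q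

    other : ∀ {κ λ′} → λ′ ∈ orbit N (next κ) → λ′ ≢ κ
    other {κ} q refl with distinct κ
    ... | κ∉ ∷ _ = All.lookup κ∉ q refl

    -- The line of slope k through the point (α , κ) of the plane is labelled
    -- α + kκ. Lines of slope k and their labels are not distinguished.
    at : Z → Z → Z → Z
    at k α κ = α + k * κ

    -- When the difference of two slopes is a unit, the pair of lines of these slopes through a
    -- point determines the point, and every pair of such lines arises. These are the formulas for
    -- the inverse map.
    module Coordinates (k l ι : Z) (inverse : (l - k) * ι ≡ one) where

      κ[_,_] α[_,_] : Z → Z → Z
      κ[ x , y ] = (y - x) * ι
      α[ x , y ] = x - k * κ[ x , y ]

      abstract
        at₁ : ∀ x y → at k α[ x , y ] κ[ x , y ] ≡ x
        at₁ x y = solve 2 (λ x z → (x :- z) :+ z := x) refl x (k * κ[ x , y ])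

      abstract
        at₂ : ∀ x y → at l α[ x , y ] κ[ x , y ] ≡ y
        at₂ x y = linear (y - x) inverse
          (solve 5 (λ x y k l ι → ((x :- k :* ((y :- x) :* ι)) :+ l :* ((y :- x) :* ι)) :- y := (y :- x) :* ((l :- k) :* ι :- con (ℤ.+ 1))) refl x y k l ι)

      abstract
        κ-at : ∀ α κ → κ[ at k α κ , at l α κ ] ≡ κ
        κ-at α κ = linear κ inverse
          (solve 5 (λ α κ k l ι → (((α :+ l :* κ) :- (α :+ k :* κ)) :* ι) :- κ := κ :* ((l :- k) :* ι :- con (ℤ.+ 1))) refl α κ k l ι)

      abstract
        unique : ∀ {α κ α′ κ′} → at k α κ ≡ at k α′ κ′ → at l α κ ≡ at l α′ κ′ → α ≡ α′ × κ ≡ κ′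
        unique {α} {κ} {α′} {κ′} e f = linear₂ one (k) e κ≡ 
          (solve 5 (λ α κ k α′ κ′ → α :- α′ := con (ℤ.+ 1) :* ((α :+ k :* κ) :- (α′ :+ k :* κ′)) :+ k :* (κ′ :- κ)) refl α κ k α′ κ′) , sym κ≡
          where
          κ≡ : κ′ ≡ κ
          κ≡ = trans (sym (κ-at α′ κ′)) (trans (sym (cong₂ κ[_,_] e f)) (κ-at α κ))

      abstract
        -- A common point at height `κ` forces (l - k) κ = y - x, and l - k is a unit.
        meet : ∀ {x y κ κ′} → x - k * κ ≡ y - l * κ → x - k * κ′ ≡ y - l * κ′ → κ ≡ κ′
        meet {x} {y} {κ} {κ′} e f = trans (sym (κ-meet e)) (κ-meet f)
          where
          κ-meet : ∀ {κ} → x - k * κ ≡ y - l * κ → κ[ x , y ] ≡ κ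
          κ-meet {κ} e = linear₂ (- ι) κ e inverse
            (solve 6 (λ x y κ k l ι → ((y :- x) :* ι) :- κ :=
              (:- ι) :* ((x :- k :* κ) :- (y :- l :* κ)) :+ κ :* ((l :- k) :* ι :- con (ℤ.+ 1))) refl x y κ k l ι)

    -- The line of slope l through the point at height κ of the line x of slope k.
    slot : Z → Z → Z → Z → Z
    slot k l x κ = at l (x - k * κ) κ

    abstract
      line : ∀ k α κ → at k α κ - k * κ ≡ α
      line k α κ = solve 3 (λ k α κ → (α :+ k :* κ) :- k :* κ := α) refl k α κ

    abstract
      -- Passes from the description of a line by a point on it to the description by which the path
      -- of another line through that point visits it.
      via : ∀ k l {α κ v} → at l α κ ≡ v → v ≡ slot k l (at k α κ) κ
      via k l {α} {κ} e = trans (sym e) (cong (λ α → at l α κ) (sym (line k α κ)))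

    abstract
      at-cancel : ∀ k {α α′} κ → at k α κ ≡ at k α′ κ → α ≡ α′
      at-cancel k {α} {α′} κ e = trans (sym (line k α κ)) (trans (cong (_- k * κ) e) (line k α′ κ))

    abstract
      flip : ∀ {k l ι} → (l - k) * ι ≡ one → (k - l) * (- ι) ≡ one
      flip {k} {l} {ι} e = trans (solve 3 (λ k l ι → (k :- l) :* (:- ι) := (l :- k) :* ι) refl k l ι) e

    abstract
      slot-κ : ∀ {k l ι} → (l - k) * ι ≡ one → ∀ x κ → (slot k l x κ - x) * ι ≡ κ
      slot-κ {k} {l} {ι} inv x κ = linear κ inv
        (solve 5 (λ k l ι x κ → (((x :- k :* κ) :+ l :* κ) :- x) :* ι :- κ := κ :* ((l :- k) :* ι :- con (ℤ.+ 1))) refl k l ι x κ)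

    abstract
      slot-zer : ∀ k l x → slot k l x zer ≡ x
      slot-zer k l x = solve 3 (λ k l x → (x :- k :* con (ℤ.+ 0)) :+ l :* con (ℤ.+ 0) := x) refl k l x

    abstract
      linear₃ : ∀ {x y a b a′ b′ a″ b″} c c′ c″ → a ≡ b → a′ ≡ b′ → a″ ≡ b″ →
                x - y ≡ c * (a - b) + c′ * (a′ - b′) + c″ * (a″ - b″) → x ≡ y
      linear₃ {a = a} {b} {a′} {b′} c c′ c″ refl e′ e″ q =
        linear₂ c′ c″ e′ e″ (trans q (solve 4 (λ c a s t → c :* (a :- a) :+ s :+ t := s :+ t) refl c a _ _))

    abstract
      slot-self : ∀ k x κ → slot k k x κ ≡ x
      slot-self k x κ = solve 3 (λ k x κ → (x :- k :* κ) :+ k :* κ := x) refl k x κ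

    -- Lines of slopes k and l meeting twice in the same pair of vertices, of
    -- slopes p and q at consecutive heights, do so at the same place.
    abstract
      crossing : ∀ {k l p q ι ι′ x x₂ y y₂ κ λ′ κ′ λ″} → (q - p) * ι ≡ one → (l - k) * ι′ ≡ one →
                 slot k p x κ ≡ slot l p y λ′ → slot k q x₂ (next κ) ≡ slot l q y₂ (next λ′) →
                 slot k p x κ′ ≡ slot l p y λ″ → slot k q x₂ (next κ′) ≡ slot l q y₂ (next λ″) → κ ≡ κ′
      crossing {k} {l} {p} {q} {ι} {ι′} {x} {x₂} {y} {y₂} {κ} {λ′} {κ′} {λ″} inv inv′ e e₂ f f₂ =
        linear₃ (ι * ι′) (- (κ - κ′) * ((q - p) * ι)) (- (κ - κ′)) product inv′ inv
          (solve 8 (λ κ κ′ k l p q ι ι′ → κ :- κ′ :=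
            (ι :* ι′) :* (((κ :- κ′) :* ((q :- p) :* (l :- k))) :- con (ℤ.+ 0))
            :+ ((:- (κ :- κ′)) :* ((q :- p) :* ι)) :* ((l :- k) :* ι′ :- con (ℤ.+ 1))
            :+ (:- (κ :- κ′)) :* ((q :- p) :* ι :- con (ℤ.+ 1))) refl κ κ′ k l p q ι ι′)
        where
        eₚ : (p - k) * (κ - κ′) ≡ (p - l) * (λ′ - λ″)
        eₚ = linear₂ one (- one) e f (solve 9 (λ p k l x y κ κ′ λ′ λ″ →
          (p :- k) :* (κ :- κ′) :- (p :- l) :* (λ′ :- λ″) :=
            con (ℤ.+ 1) :* (((x :- k :* κ) :+ p :* κ) :- ((y :- l :* λ′) :+ p :* λ′))
            :+ (:- con (ℤ.+ 1)) :* (((x :- k :* κ′) :+ p :* κ′) :- ((y :- l :* λ″) :+ p :* λ″))) refl p k l x y κ κ′ λ′ λ″)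
        e_q : (q - k) * (κ - κ′) ≡ (q - l) * (λ′ - λ″)
        e_q = linear₂ one (- one) e₂ f₂ (solve 9 (λ p k l x y κ κ′ λ′ λ″ →
          (p :- k) :* (κ :- κ′) :- (p :- l) :* (λ′ :- λ″) :=
            con (ℤ.+ 1) :* (((x :- k :* (κ :+ con (ℤ.+ 1))) :+ p :* (κ :+ con (ℤ.+ 1))) :- ((y :- l :* (λ′ :+ con (ℤ.+ 1))) :+ p :* (λ′ :+ con (ℤ.+ 1))))
            :+ (:- con (ℤ.+ 1)) :* (((x :- k :* (κ′ :+ con (ℤ.+ 1))) :+ p :* (κ′ :+ con (ℤ.+ 1))) :- ((y :- l :* (λ″ :+ con (ℤ.+ 1))) :+ p :* (λ″ :+ con (ℤ.+ 1))))) refl q k l x₂ y₂ κ κ′ λ′ λ″)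
        -- The two relations `eₚ` and `e_q` are a homogeneous linear system in the differences of
        -- heights on the two lines. Its determinant is (q - p)(l - k), a product of two units.
        product : (κ - κ′) * ((q - p) * (l - k)) ≡ zer
        product = linear₂ (p - l) (- (q - l)) (sym e_q) (sym eₚ) (solve 6 (λ δ η k l p q →
          δ :* ((q :- p) :* (l :- k)) :- con (ℤ.+ 0) :=
            (p :- l) :* ((q :- l) :* η :- (q :- k) :* δ) :+ (:- (q :- l)) :* ((p :- l) :* η :- (p :- k) :* δ)) refl (κ - κ′) (λ′ - λ″) k l p q)

    abstract
      -- One height further up the line of slope `k`, the crossing line of slope `l` has its label
      -- displaced by l - k. Subtracting this displacement turns a step between consecutive heights
      -- into an incidence at a single point.
      across : ∀ k l {α κ v} → at l α κ ≡ v - (l * one - k * one) → v ≡ slot k l (at k α κ) (next κ)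
      across k l {α} {κ} {v} e = linear (- one) e (solve 5 (λ k l α κ v →
        v :- (((α :+ k :* κ) :- k :* (κ :+ con (ℤ.+ 1))) :+ l :* (κ :+ con (ℤ.+ 1))) :=
        (:- con (ℤ.+ 1)) :* ((α :+ l :* κ) :- (v :- (l :* con (ℤ.+ 1) :- k :* con (ℤ.+ 1))))) refl k l α κ v)

    abstract
      at-next : ∀ k α κ → at k (next α) κ ≡ next (at k α κ)
      at-next k α κ = solve 3 (λ k α κ → (α :+ con (ℤ.+ 1)) :+ k :* κ := (α :+ k :* κ) :+ con (ℤ.+ 1)) refl k α κ

    abstract
      next-pred : ∀ x → next (x - one) ≡ x
      next-pred x = solve 1 (λ x → (x :- con (ℤ.+ 1)) :+ con (ℤ.+ 1) := x) refl x

    abstract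
      pred-next : ∀ x → next x - one ≡ x
      pred-next x = solve 1 (λ x → (x :+ con (ℤ.+ 1)) :- con (ℤ.+ 1) := x) refl x

    abstract
      pred-slot : ∀ k l x κ → slot k l (x - one) κ ≡ slot k l x κ - one
      pred-slot k l x κ = solve 4 (λ k l x κ → ((x :- con (ℤ.+ 1)) :- k :* κ) :+ l :* κ := ((x :- k :* κ) :+ l :* κ) :- con (ℤ.+ 1)) refl k l x κ

    abstract
      succ-slot : ∀ k l {v w κ} → v - one ≡ slot k l w κ → v ≡ slot k l (w + one) κ
      succ-slot k l {v} {w} {κ} e = linear one e (solve 5 (λ k l v w κ →
        v :- (((w :+ con (ℤ.+ 1)) :- k :* κ) :+ l :* κ) :=
        con (ℤ.+ 1) :* ((v :- con (ℤ.+ 1)) :- ((w :- k :* κ) :+ l :* κ))) refl k l v w κ)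

      unsucc-slot : ∀ k l {v x κ} → v + one ≡ slot k l x κ → v ≡ slot k l (x - one) κ
      unsucc-slot k l {v} {x} {κ} e = linear one e (solve 5 (λ k l v x κ →
        v :- (((x :- con (ℤ.+ 1)) :- k :* κ) :+ l :* κ) :=
        con (ℤ.+ 1) :* ((v :+ con (ℤ.+ 1)) :- ((x :- k :* κ) :+ l :* κ))) refl k l v x κ)

      label-cancel : ∀ {x x′} y → (x - one) - y ≡ (x′ - one) - y → x ≡ x′
      label-cancel {x} {x′} y e = linear one e (solve 3 (λ x x′ y →
        x :- x′ := con (ℤ.+ 1) :* (((x :- con (ℤ.+ 1)) :- y) :- ((x′ :- con (ℤ.+ 1)) :- y))) refl x x′ y)

      -- Together with `label-end` this makes two translations inverse to each other: between a line
      -- and the line of another slope that it meets at height 1, where the paths of slopes b and d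
      -- begin.
      end-label : ∀ k l v → slot k l (v + (k * one - l * one)) one ≡ v
      end-label k l v = solve 3 (λ k l v → ((v :+ (k :* con (ℤ.+ 1) :- l :* con (ℤ.+ 1))) :- k :* con (ℤ.+ 1)) :+ l :* con (ℤ.+ 1) := v) refl k l v

      label-end : ∀ k l y → slot k l y one + (k * one - l * one) ≡ y
      label-end k l y = solve 3 (λ k l y → ((y :- k :* con (ℤ.+ 1)) :+ l :* con (ℤ.+ 1)) :+ (k :* con (ℤ.+ 1) :- l :* con (ℤ.+ 1)) := y) refl k l y

-- The paths of the lines

module Construction where

  open Systems
  open Cyclic

  Sym : {V : Set} → (V → V → Set) → V → V → Set
  Sym P u v = P u v ⊎ P v u

  -- The closed walk through g₁ κ, inner κ, g₃ κ for all residues κ, opened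
  -- between g₁ κ₀ and g₂ κ₀ and continued with a given list.
  module Opened (C : Residues) {V : Set} (g₁ g₂ g₃ : Residues.Z C → V) (inner : Residues.Z C → List V) (κ₀ : Residues.Z C) where
    open Arithmetic C
    open Blocks g₁ g₃ inner

    opened : List V → List V
    -- The block at `κ₀` is broken in two: its end `g₂`, `g₃` opens the list and its head `g₁`
    -- closes the walk. All steps between blocks survive, including the one that returns to `κ₀`;
    -- only the step from `g₁` to `g₂` is lost.
    opened rest = g₂ κ₀ ∷ g₃ κ₀ ∷ walk N (next κ₀) (g₁ κ₀ ∷ rest)

    opened-elim : (P : V → V → Set) → ∀ {rest} →
                  (∀ κ → P (g₃ κ) (g₁ (next κ))) →
                  P (g₂ κ₀) (g₃ κ₀) →
                  (∀ κ {u v} → κ ≢ κ₀ → Step u v (block κ) → P u v) →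
                  (∀ {u v} → Step u v (g₁ κ₀ ∷ rest) → P u v) →
                  ∀ {u v} → Step u v (opened rest) → P u v
    opened-elim P across first inside after here = first
    opened-elim P {rest} across first inside after (there s) =
      walk-elim P N κ₀ (g₁ κ₀ ∷ rest) (λ {κ} _ → across κ) (λ {κ} q → inside κ (other q)) end s
      where
      end : ∀ {u v} → Step u v (g₃ (shift N κ₀) ∷ g₁ κ₀ ∷ rest) → P u v
      end here      = subst (λ κ → P (g₃ (shift N κ₀)) (g₁ κ)) (period κ₀) (across (shift N κ₀))
      end (there s) = after s

    opened-across : ∀ κ {rest} → Step (g₃ κ) (g₁ (next κ)) (opened rest)
    opened-across κ {rest} with orbit-last N κ₀ (full κ₀ κ)
    ... | inj₁ q    = there (walk-across N κ₀ _ q)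
    ... | inj₂ refl = there (walk-after N κ₀ _ (subst (λ κ → Step (g₃ (shift N κ₀)) (g₁ κ) (g₃ (shift N κ₀) ∷ g₁ κ₀ ∷ rest)) (sym (period κ₀)) here))

    opened-inside : ∀ {κ u v rest} → κ ≢ κ₀ → Step u v (block κ) → Step u v (opened rest)
    opened-inside ≢κ₀ s = there (there (walk-inside N (next κ₀) _ (others ≢κ₀) s))

    opened-after : ∀ {u v rest} → Step u v (g₁ κ₀ ∷ rest) → Step u v (opened rest)
    opened-after s = there (walk-after N κ₀ _ (there s))

  module _ {Z V : Set} (block : Z → List V) where

    concatMap-unique : (∀ κ → Unique (block κ)) → (∀ {κ κ′ w} → w ∈ block κ → w ∈ block κ′ → κ ≡ κ′) →
                       ∀ {ks} → Unique ks → Unique (concatMap block ks)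
    concatMap-unique block! same []        = []
    concatMap-unique block! same {_ ∷ ks} (κ∉ ∷ ks!) = Uniqueₚ.++⁺ (block! _) (concatMap-unique block! same ks!)
      λ (p , q) → let (κ′ , κ′∈ , r) = find (∈-concatMap⁻ block {xs = ks} q) in All.lookup κ∉ κ′∈ (same p r)

  module _ (C : Residues) where
    open Arithmetic C

    module _ {V : Set} (g₁ g₂ g₃ : Z → V) (inner : Z → List V) (κ₀ : Z) where
      open Blocks g₁ g₃ inner
      open Opened C g₁ g₂ g₃ inner κ₀

      -- A function `κof` that recovers the height from a vertex makes blocks at different heights
      -- disjoint, so only the two pieces of the broken block need separate care.
      opened-unique : (∀ κ → Unique (block κ)) → (κof : V → Z) → (∀ {κ w} → w ∈ block κ → κof w ≡ κ) →
                      (∀ κ → g₂ κ ∈ block κ) → g₁ κ₀ ≢ g₂ κ₀ → g₁ κ₀ ≢ g₃ κ₀ → g₂ κ₀ ≢ g₃ κ₀ →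
                      ∀ {rest} → Unique rest → (∀ {κ w} → w ∈ block κ → w ∉ rest) → Unique (opened rest)
      opened-unique block! κof ok g₂∈ 1≢2 1≢3 2≢3 {rest} rest! apart =
        All.tabulate no₂ ∷ All.tabulate no₃ ∷ Uniqueₚ.++⁺
          (concatMap-unique block block! (λ p q → trans (sym (ok p)) (ok q)) ks!)
          (All.tabulate (λ q e → apart (g₁∈ κ₀) (subst (_∈ rest) (sym e) q)) ∷ rest!)
          (λ { (p , here refl) → outside p (g₁∈ κ₀) ; (p , there q) → let (_ , _ , r) = find (∈-concatMap⁻ block {xs = ks} p) in apart r q })
        where
        ks = orbit N (next κ₀)
        ks! : Unique ks
        ks! with distinct κ₀
        ... | _ ∷ u = u
        g₁∈ : ∀ κ → g₁ κ ∈ block κ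
        g₁∈ κ = here refl
        g₃∈ : ∀ κ → g₃ κ ∈ block κ
        g₃∈ κ = there (∈-++⁺ʳ (inner κ) (here refl))
        outside : ∀ {w} → w ∈ concatMap block ks → w ∉ block κ₀
        outside p q = let (κ , κ∈ , r) = find (∈-concatMap⁻ block {xs = ks} p) in other κ∈ (trans (sym (ok r)) (ok q))
        late : ∀ {w x} → w ∈ block κ₀ → g₁ κ₀ ≢ w → x ∈ concatMap block ks ++ g₁ κ₀ ∷ rest → w ≢ x
        late w∈ ≢w x∈ refl with ∈-++⁻ (concatMap block ks) x∈
        ... | inj₁ p         = outside p w∈
        ... | inj₂ (here e)  = ≢w (sym e)
        ... | inj₂ (there q) = apart w∈ q
        no₃ : ∀ {x} → x ∈ concatMap block ks ++ g₁ κ₀ ∷ rest → g₃ κ₀ ≢ x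
        no₃ = late (g₃∈ κ₀) 1≢3
        no₂ : ∀ {x} → x ∈ g₃ κ₀ ∷ concatMap block ks ++ g₁ κ₀ ∷ rest → g₂ κ₀ ≢ x
        no₂ (here refl) = 2≢3
        no₂ (there p)   = late (g₂∈ κ₀) 1≢2 p

  data Vertex (Z U : Set) : Set where
    vA vB vC vD : Z → Vertex Z U
    vU          : U → Vertex Z U

  record Slopes (C : Residues) : Set where
    open Arithmetic C
    field
      ka kb kc kd : Z
      ιab ιac ιad ιbc ιbd ιcd : Z
      invab : (kb - ka) * ιab ≡ one
      invac : (kc - ka) * ιac ≡ one
      invad : (kd - ka) * ιad ≡ one
      invbc : (kc - kb) * ιbc ≡ one
      invbd : (kd - kb) * ιbd ≡ one
      invcd : (kd - kc) * ιcd ≡ one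
      zer≢one : zer ≢ one

  -- A further vertex j is placed at the height emb j; gap finds the vertex placed
  -- at a given height. The heights 0 and 1, where closed walks are opened, stay free.
  record Gaps (C : Residues) (U : Set) : Set where
    open Arithmetic C
    field
      gap      : Z → Maybe U
      emb      : U → Z
      gap-emb  : ∀ j → gap (emb j) ≡ just j
      emb-gap  : ∀ {κ j} → gap κ ≡ just j → κ ≡ emb j
      gap-zer  : gap zer ≡ nothing
      gap-one  : gap one ≡ nothing

  module Lines (C : Residues) (K : Slopes C) {U : Set} (G : Gaps C U)
               (S : System (Residues.Z C)) (SU : System U)
               (cut : U → Residues.Z C) where
    open Arithmetic C
    open Slopes K
    open Gaps G
    module S = System S
    module SU = System SU

    V : Set
    V = Vertex Z U

    -- The edges on the path of the line x of slope ka, and so on for OnB, OnC, OnD;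
    -- OnT describes the path of a further vertex.
    data OnA (x : Z) : V → V → Set where
      bc   : ∀ {b c} κ → b ≡ slot ka kb (x - one) κ → c ≡ slot ka kc x κ → OnA x (vB b) (vC c)
      cd   : ∀ {c d} κ → gap κ ≡ nothing → κ ≢ zer → c ≡ slot ka kc x κ → d ≡ slot ka kd x κ → OnA x (vC c) (vD d)
      sc   : ∀ {j c} κ → gap κ ≡ just j → c ≡ slot ka kc x κ → OnA x (vU j) (vC c)
      sd   : ∀ {j d} κ → gap κ ≡ just j → d ≡ slot ka kd x κ → OnA x (vU j) (vD d)
      bd   : ∀ {b d} κ → b ≡ slot ka kb (x - one) κ → d ≡ slot ka kd x (next κ) → OnA x (vB b) (vD d)
      da   : ∀ {d a} → d ≡ slot ka kd x zer → a ≡ x → OnA x (vD d) (vA a)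
      pure : ∀ {y z} → Joins (S.path x) y z → OnA x (vA y) (vA z)

    data OnB (x : Z) : V → V → Set where
      cd   : ∀ {c d} κ → c ≡ slot kb kc x κ → d ≡ slot kb kd x κ → OnB x (vC c) (vD d)
      da   : ∀ {d a} κ → gap κ ≡ nothing → κ ≢ one → d ≡ slot kb kd x κ → a ≡ slot kb ka x κ → OnB x (vD d) (vA a)
      sd   : ∀ {j d} κ → gap κ ≡ just j → d ≡ slot kb kd x κ → OnB x (vU j) (vD d)
      sa   : ∀ {j a} κ → gap κ ≡ just j → a ≡ slot kb ka x κ → OnB x (vU j) (vA a)
      ca   : ∀ {c a} κ → c ≡ slot kb kc x κ → a ≡ slot kb ka x (next κ) → OnB x (vC c) (vA a)
      ab   : ∀ {a b} → a ≡ slot kb ka x one → b ≡ x → OnB x (vA a) (vB b)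
      pure : ∀ {y z} → Joins (S.path x) y z → OnB x (vB y) (vB z)

    data OnC (x : Z) : V → V → Set where
      da   : ∀ {d a} κ → κ ≢ zer → d ≡ slot kc kd x κ → a ≡ slot kc ka x κ → OnC x (vD d) (vA a)
      ab   : ∀ {a b} κ → gap κ ≡ nothing → a ≡ slot kc ka x κ → b ≡ slot kc kb x κ → OnC x (vA a) (vB b)
      sa   : ∀ {j a} κ → gap κ ≡ just j → a ≡ slot kc ka x κ → OnC x (vU j) (vA a)
      sb   : ∀ {j b} κ → gap κ ≡ just j → b ≡ slot kc kb x κ → OnC x (vU j) (vB b)
      bd   : ∀ {b d} κ → b ≡ slot kc kb x κ → d ≡ slot kc kd x (next κ) → OnC x (vB b) (vD d)
      cd   : ∀ {c d} → c ≡ x → d ≡ slot kc kd x zer → OnC x (vC c) (vD d)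
      pure : ∀ {y z} → Joins (S.path x) y z → OnC x (vC y) (vC z)

    data OnD (x : Z) : V → V → Set where
      ab   : ∀ {a b} κ → κ ≢ one → a ≡ slot kd ka x κ → b ≡ slot kd kb x κ → OnD x (vA a) (vB b)
      bc   : ∀ {b c} κ → gap κ ≡ nothing → b ≡ slot kd kb x κ → c ≡ slot kd kc (x + one) κ → OnD x (vB b) (vC c)
      sb   : ∀ {j b} κ → gap κ ≡ just j → b ≡ slot kd kb x κ → OnD x (vU j) (vB b)
      sc   : ∀ {j c} κ → gap κ ≡ just j → c ≡ slot kd kc (x + one) κ → OnD x (vU j) (vC c)
      ca   : ∀ {c a} κ → c ≡ slot kd kc (x + one) κ → a ≡ slot kd ka x (next κ) → OnD x (vC c) (vA a)
      da   : ∀ {d a} → d ≡ x → a ≡ slot kd ka x one → OnD x (vD d) (vA a)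
      pure : ∀ {y z} → Joins (S.path x) y z → OnD x (vD y) (vD z)

    -- The point of height `emb j` on the line `cut j` of slope a. The walk of `j` starts there,
    -- which decides which line of slope a is left as the only owner of the missing edge.
    α₀ : U → Z
    α₀ j = cut j - ka * emb j

    data OnT (j : U) : V → V → Set where
      cd   : ∀ {c d} α → c ≡ at kc α (emb j) → d ≡ at kd α (emb j) → OnT j (vC c) (vD d)
      da   : ∀ {d a} α → d ≡ at kd α (emb j) → a ≡ at ka α (emb j) → OnT j (vD d) (vA a)
      ab   : ∀ {a b} α → a ≡ at ka α (emb j) → b ≡ at kb α (emb j) → OnT j (vA a) (vB b)
      bc   : ∀ {b c} α → next α ≢ α₀ j → b ≡ at kb α (emb j) → c ≡ at kc (next α) (emb j) → OnT j (vB b) (vC c)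
      link : ∀ {i c} → OnT j (vU i) (vC c)
      pure : ∀ {y z} → Joins (SU.path j) y z → OnT j (vU y) (vU z)

    ins : Maybe U → List V
    ins nothing  = []
    ins (just j) = vU j ∷ []

    module PathA (x : Z) where
      g₁ g₂ g₃ : Z → V
      g₁ κ = vD (slot ka kd x κ)
      g₂ κ = vC (slot ka kc x κ)
      -- The line of slope b through the preceding point of the same height: the edge bc of this
      -- path is thus one by which the walk of a further vertex goes from one point to the next.
      g₃ κ = vB (slot ka kb (x - one) κ)
      inner : Z → List V
      inner κ = ins (gap κ) ++ g₂ κ ∷ []
      open Opened C g₁ g₂ g₃ inner zer public
      open Blocks g₁ g₃ inner
      list : List V
      list = opened (map vA (S.path x))

      inside : ∀ κ {u v} → κ ≢ zer → Step u v (block κ) → Sym (OnA x) u v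
      inside κ ≢κ₀ s with gap κ in eq | s
      ... | nothing | here                    = inj₂ (cd κ eq ≢κ₀ refl refl)
      ... | nothing | there here              = inj₂ (bc κ refl refl)
      ... | nothing | there (there (there ()))
      ... | just j  | here                    = inj₂ (sd κ eq refl)
      ... | just j  | there here              = inj₁ (sc κ eq refl)
      ... | just j  | there (there here)      = inj₂ (bc κ refl refl)
      ... | just j  | there (there (there (there ())))

      after : ∀ {u v} → Step u v (g₁ zer ∷ map vA (S.path x)) → Sym (OnA x) u v
      -- At height 0 all lines through a point carry the same label, so the step to the first vertex
      -- `x` of the inner path is the edge da at a point of the line `x`.
      after here = inj₁ (da refl refl)
      after (there s) with step-map⁻ vA (S.path x) s
      ... | _ , _ , t , refl , refl = inj₁ (pure (inj₁ t))

      sound : ∀ {u v} → Joins list u v → Sym (OnA x) u v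
      sound = [ go , (λ s → swap (go s)) ]′
        where
        go : ∀ {u v} → Step u v list → Sym (OnA x) u v
        go = opened-elim (Sym (OnA x)) (λ κ → inj₁ (bd κ refl refl)) (inj₂ (bc zer refl refl)) inside after

      g₂g₃ : ∀ κ → Step (g₂ κ) (g₃ κ) (block κ)
      g₂g₃ κ with gap κ
      ... | nothing = there here
      ... | just _  = there (there here)

      g₁g₂ : ∀ κ → gap κ ≡ nothing → Step (g₁ κ) (g₂ κ) (block κ)
      g₁g₂ κ eq rewrite eq = here

      g₁u : ∀ κ {j} → gap κ ≡ just j → Step (g₁ κ) (vU j) (block κ)
      g₁u κ eq rewrite eq = here

      ug₂ : ∀ κ {j} → gap κ ≡ just j → Step (vU j) (g₂ κ) (block κ)
      ug₂ κ eq rewrite eq = there here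

      gap≢κ₀ : ∀ {κ j} → gap κ ≡ just j → κ ≢ zer
      gap≢κ₀ eq refl with trans (sym gap-zer) eq
      ... | ()

      complete : ∀ {u v} → OnA x u v → Joins list u v
      complete (bc κ refl refl) with κ ≟ zer
      ... | yes refl = inj₂ here
      ... | no  ≢κ₀  = inj₂ (opened-inside ≢κ₀ (g₂g₃ κ))
      complete (cd κ eq ≢κ₀ refl refl) = inj₂ (opened-inside ≢κ₀ (g₁g₂ κ eq))
      complete (sd κ eq refl) = inj₂ (opened-inside (gap≢κ₀ eq) (g₁u κ eq))
      complete (sc κ eq refl) = inj₁ (opened-inside (gap≢κ₀ eq) (ug₂ κ eq))
      complete (bd κ refl refl) = inj₁ (opened-across κ)
      complete (da refl refl) = inj₁ (opened-after here)
      complete (pure (inj₁ s)) = inj₁ (opened-after (there (step-map⁺ vA s)))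
      complete (pure (inj₂ s)) = inj₂ (opened-after (there (step-map⁺ vA s)))

      κof : V → Z
      κof (vB z) = (z - (x - one)) * ιab
      κof (vC z) = (z - x) * ιac
      κof (vD z) = (z - x) * ιad
      κof (vU j) = emb j
      κof (vA _) = zer

      κof-block : ∀ {κ w} → w ∈ block κ → κof w ≡ κ
      κof-block {κ} p with gap κ in eq | p
      ... | nothing | here refl = slot-κ invad x κ
      ... | nothing | there (here refl) = slot-κ invac x κ
      ... | nothing | there (there (here refl)) = slot-κ invab (x - one) κ
      ... | just _  | here refl = slot-κ invad x κ
      ... | just _  | there (here refl) = sym (emb-gap eq)
      ... | just _  | there (there (here refl)) = slot-κ invac x κ
      ... | just _  | there (there (there (here refl))) = slot-κ invab (x - one) κ

      block! : ∀ κ → Unique (block κ)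
      block! κ with gap κ
      ... | nothing = ((λ ()) ∷ (λ ()) ∷ []) ∷ ((λ ()) ∷ []) ∷ [] ∷ []
      ... | just _  = ((λ ()) ∷ (λ ()) ∷ (λ ()) ∷ []) ∷ ((λ ()) ∷ (λ ()) ∷ []) ∷ ((λ ()) ∷ []) ∷ [] ∷ []

      apart : ∀ {κ w} → w ∈ block κ → w ∉ map vA (S.path x)
      apart {κ} p q with ∈-map⁻ vA q
      ... | _ , _ , refl with gap κ | p
      ...   | nothing | there (there (there ()))
      ...   | just _  | there (there (there (there ())))

      list! : Unique list
      list! = opened-unique C g₁ g₂ g₃ inner zer block! κof κof-block (λ κ → there (∈-++⁺ˡ (∈-++⁺ʳ (ins (gap κ)) (here refl))))
        (λ ()) (λ ()) (λ ()) (Uniqueₚ.map⁺ (λ { refl → refl }) (S.simple x)) apart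

    module PathB (x : Z) where
      g₁ g₂ g₃ : Z → V
      g₁ κ = vA (slot kb ka x κ)
      g₂ κ = vD (slot kb kd x κ)
      g₃ κ = vC (slot kb kc x κ)
      inner : Z → List V
      inner κ = ins (gap κ) ++ g₂ κ ∷ []
      -- Opening at height 0, like the paths of slopes a and c, would put both ab and cd at a point
      -- of that height on the same pair of lines of slopes b and c.
      open Opened C g₁ g₂ g₃ inner one public
      open Blocks g₁ g₃ inner
      list : List V
      list = opened (map vB (S.path x))

      inside : ∀ κ {u v} → κ ≢ one → Step u v (block κ) → Sym (OnB x) u v
      inside κ ≢κ₀ s with gap κ in eq | s
      ... | nothing | here                    = inj₂ (da κ eq ≢κ₀ refl refl)
      ... | nothing | there here              = inj₂ (cd κ refl refl)
      ... | nothing | there (there (there ()))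
      ... | just j  | here                    = inj₂ (sa κ eq refl)
      ... | just j  | there here              = inj₁ (sd κ eq refl)
      ... | just j  | there (there here)      = inj₂ (cd κ refl refl)
      ... | just j  | there (there (there (there ())))

      after : ∀ {u v} → Step u v (g₁ one ∷ map vB (S.path x)) → Sym (OnB x) u v
      after here = inj₁ (ab refl refl)
      after (there s) with step-map⁻ vB (S.path x) s
      ... | _ , _ , t , refl , refl = inj₁ (pure (inj₁ t))

      sound : ∀ {u v} → Joins list u v → Sym (OnB x) u v
      sound = [ go , (λ s → swap (go s)) ]′
        where
        go : ∀ {u v} → Step u v list → Sym (OnB x) u v
        go = opened-elim (Sym (OnB x)) (λ κ → inj₁ (ca κ refl refl)) (inj₂ (cd one refl refl)) inside after

      g₂g₃ : ∀ κ → Step (g₂ κ) (g₃ κ) (block κ)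
      g₂g₃ κ with gap κ
      ... | nothing = there here
      ... | just _  = there (there here)

      g₁g₂ : ∀ κ → gap κ ≡ nothing → Step (g₁ κ) (g₂ κ) (block κ)
      g₁g₂ κ eq rewrite eq = here

      g₁u : ∀ κ {j} → gap κ ≡ just j → Step (g₁ κ) (vU j) (block κ)
      g₁u κ eq rewrite eq = here

      ug₂ : ∀ κ {j} → gap κ ≡ just j → Step (vU j) (g₂ κ) (block κ)
      ug₂ κ eq rewrite eq = there here

      gap≢κ₀ : ∀ {κ j} → gap κ ≡ just j → κ ≢ one
      gap≢κ₀ eq refl with trans (sym gap-one) eq
      ... | ()

      complete : ∀ {u v} → OnB x u v → Joins list u v
      complete (cd κ refl refl) with κ ≟ one
      ... | yes refl = inj₂ here
      ... | no  ≢κ₀  = inj₂ (opened-inside ≢κ₀ (g₂g₃ κ))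
      complete (da κ eq ≢κ₀ refl refl) = inj₂ (opened-inside ≢κ₀ (g₁g₂ κ eq))
      complete (sa κ eq refl) = inj₂ (opened-inside (gap≢κ₀ eq) (g₁u κ eq))
      complete (sd κ eq refl) = inj₁ (opened-inside (gap≢κ₀ eq) (ug₂ κ eq))
      complete (ca κ refl refl) = inj₁ (opened-across κ)
      complete (ab refl refl) = inj₁ (opened-after here)
      complete (pure (inj₁ s)) = inj₁ (opened-after (there (step-map⁺ vB s)))
      complete (pure (inj₂ s)) = inj₂ (opened-after (there (step-map⁺ vB s)))

      κof : V → Z
      κof (vA z) = (z - x) * (- ιab)
      κof (vC z) = (z - x) * ιbc
      κof (vD z) = (z - x) * ιbd
      κof (vU j) = emb j
      κof (vB _) = zer

      κof-block : ∀ {κ w} → w ∈ block κ → κof w ≡ κ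
      κof-block {κ} p with gap κ in eq | p
      ... | nothing | here refl = slot-κ (flip invab) x κ
      ... | nothing | there (here refl) = slot-κ invbd x κ
      ... | nothing | there (there (here refl)) = slot-κ invbc x κ
      ... | just _  | here refl = slot-κ (flip invab) x κ
      ... | just _  | there (here refl) = sym (emb-gap eq)
      ... | just _  | there (there (here refl)) = slot-κ invbd x κ
      ... | just _  | there (there (there (here refl))) = slot-κ invbc x κ

      block! : ∀ κ → Unique (block κ)
      block! κ with gap κ
      ... | nothing = ((λ ()) ∷ (λ ()) ∷ []) ∷ ((λ ()) ∷ []) ∷ [] ∷ []
      ... | just _  = ((λ ()) ∷ (λ ()) ∷ (λ ()) ∷ []) ∷ ((λ ()) ∷ (λ ()) ∷ []) ∷ ((λ ()) ∷ []) ∷ [] ∷ []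

      apart : ∀ {κ w} → w ∈ block κ → w ∉ map vB (S.path x)
      apart {κ} p q with ∈-map⁻ vB q
      ... | _ , _ , refl with gap κ | p
      ...   | nothing | there (there (there ()))
      ...   | just _  | there (there (there (there ())))

      list! : Unique list
      list! = opened-unique C g₁ g₂ g₃ inner one block! κof κof-block (λ κ → there (∈-++⁺ˡ (∈-++⁺ʳ (ins (gap κ)) (here refl))))
        (λ ()) (λ ()) (λ ()) (Uniqueₚ.map⁺ (λ { refl → refl }) (S.simple x)) apart

    module PathC (x : Z) where
      g₁ g₂ g₃ : Z → V
      g₁ κ = vD (slot kc kd x κ)
      g₂ κ = vA (slot kc ka x κ)
      g₃ κ = vB (slot kc kb x κ)
      inner : Z → List V
      inner κ = g₂ κ ∷ ins (gap κ)
      -- The same height as for slope a: there this path loses da and gains cd, whereas the paths of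
      -- slope a lose cd and gain da.
      open Opened C g₁ g₂ g₃ inner zer public
      open Blocks g₁ g₃ inner
      list : List V
      list = opened (map vC (S.path x))

      inside : ∀ κ {u v} → κ ≢ zer → Step u v (block κ) → Sym (OnC x) u v
      inside κ ≢κ₀ s with gap κ in eq | s
      ... | nothing | here                    = inj₁ (da κ ≢κ₀ refl refl)
      ... | nothing | there here              = inj₁ (ab κ eq refl refl)
      ... | nothing | there (there (there ()))
      ... | just j  | here                    = inj₁ (da κ ≢κ₀ refl refl)
      ... | just j  | there here              = inj₂ (sa κ eq refl)
      ... | just j  | there (there here)      = inj₁ (sb κ eq refl)
      ... | just j  | there (there (there (there ())))

      after : ∀ {u v} → Step u v (g₁ zer ∷ map vC (S.path x)) → Sym (OnC x) u v
      after here = inj₂ (cd refl refl)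
      after (there s) with step-map⁻ vC (S.path x) s
      ... | _ , _ , t , refl , refl = inj₁ (pure (inj₁ t))

      sound : ∀ {u v} → Joins list u v → Sym (OnC x) u v
      sound = [ go , (λ s → swap (go s)) ]′
        where
        go : ∀ {u v} → Step u v list → Sym (OnC x) u v
        go = opened-elim (Sym (OnC x)) (λ κ → inj₁ (bd κ refl refl)) (inj₁ (ab zer gap-zer refl refl)) inside after

      g₁g₂ : ∀ κ → Step (g₁ κ) (g₂ κ) (block κ)
      g₁g₂ κ = here

      g₂g₃ : ∀ κ → gap κ ≡ nothing → Step (g₂ κ) (g₃ κ) (block κ)
      g₂g₃ κ eq rewrite eq = there here

      g₂u : ∀ κ {j} → gap κ ≡ just j → Step (g₂ κ) (vU j) (block κ)
      g₂u κ eq rewrite eq = there here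

      ug₃ : ∀ κ {j} → gap κ ≡ just j → Step (vU j) (g₃ κ) (block κ)
      ug₃ κ eq rewrite eq = there (there here)

      gap≢κ₀ : ∀ {κ j} → gap κ ≡ just j → κ ≢ zer
      gap≢κ₀ eq refl with trans (sym gap-zer) eq
      ... | ()

      complete : ∀ {u v} → OnC x u v → Joins list u v
      complete (da κ ≢κ₀ refl refl) = inj₁ (opened-inside ≢κ₀ (g₁g₂ κ))
      complete (ab κ eq refl refl) with κ ≟ zer
      ... | yes refl = inj₁ here
      ... | no  ≢κ₀  = inj₁ (opened-inside ≢κ₀ (g₂g₃ κ eq))
      complete (sa κ eq refl) = inj₂ (opened-inside (gap≢κ₀ eq) (g₂u κ eq))
      complete (sb κ eq refl) = inj₁ (opened-inside (gap≢κ₀ eq) (ug₃ κ eq))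
      complete (bd κ refl refl) = inj₁ (opened-across κ)
      complete (cd refl refl) = inj₂ (opened-after here)
      complete (pure (inj₁ s)) = inj₁ (opened-after (there (step-map⁺ vC s)))
      complete (pure (inj₂ s)) = inj₂ (opened-after (there (step-map⁺ vC s)))

      κof : V → Z
      κof (vA z) = (z - x) * (- ιac)
      κof (vB z) = (z - x) * (- ιbc)
      κof (vD z) = (z - x) * ιcd
      κof (vU j) = emb j
      κof (vC _) = zer

      κof-block : ∀ {κ w} → w ∈ block κ → κof w ≡ κ
      κof-block {κ} p with gap κ in eq | p
      ... | nothing | here refl = slot-κ invcd x κ
      ... | nothing | there (here refl) = slot-κ (flip invac) x κ
      ... | nothing | there (there (here refl)) = slot-κ (flip invbc) x κ
      ... | just _  | here refl = slot-κ invcd x κ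
      ... | just _  | there (here refl) = slot-κ (flip invac) x κ
      ... | just _  | there (there (here refl)) = sym (emb-gap eq)
      ... | just _  | there (there (there (here refl))) = slot-κ (flip invbc) x κ

      block! : ∀ κ → Unique (block κ)
      block! κ with gap κ
      ... | nothing = ((λ ()) ∷ (λ ()) ∷ []) ∷ ((λ ()) ∷ []) ∷ [] ∷ []
      ... | just _  = ((λ ()) ∷ (λ ()) ∷ (λ ()) ∷ []) ∷ ((λ ()) ∷ (λ ()) ∷ []) ∷ ((λ ()) ∷ []) ∷ [] ∷ []

      apart : ∀ {κ w} → w ∈ block κ → w ∉ map vC (S.path x)
      apart {κ} p q with ∈-map⁻ vC q
      ... | _ , _ , refl with gap κ | p
      ...   | nothing | there (there (there ()))
      ...   | just _  | there (there (there (there ())))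

      list! : Unique list
      list! = opened-unique C g₁ g₂ g₃ inner zer block! κof κof-block (λ κ → there (here refl))
        (λ ()) (λ ()) (λ ()) (Uniqueₚ.map⁺ (λ { refl → refl }) (S.simple x)) apart

    module PathD (x : Z) where
      g₁ g₂ g₃ : Z → V
      g₁ κ = vA (slot kd ka x κ)
      g₂ κ = vB (slot kd kb x κ)
      g₃ κ = vC (slot kd kc (x + one) κ)
      inner : Z → List V
      inner κ = g₂ κ ∷ ins (gap κ)
      open Opened C g₁ g₂ g₃ inner one public
      open Blocks g₁ g₃ inner
      list : List V
      list = opened (map vD (S.path x))

      inside : ∀ κ {u v} → κ ≢ one → Step u v (block κ) → Sym (OnD x) u v
      inside κ ≢κ₀ s with gap κ in eq | s
      ... | nothing | here                    = inj₁ (ab κ ≢κ₀ refl refl)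
      ... | nothing | there here              = inj₁ (bc κ eq refl refl)
      ... | nothing | there (there (there ()))
      ... | just j  | here                    = inj₁ (ab κ ≢κ₀ refl refl)
      ... | just j  | there here              = inj₂ (sb κ eq refl)
      ... | just j  | there (there here)      = inj₁ (sc κ eq refl)
      ... | just j  | there (there (there (there ())))

      after : ∀ {u v} → Step u v (g₁ one ∷ map vD (S.path x)) → Sym (OnD x) u v
      after here = inj₂ (da refl refl)
      after (there s) with step-map⁻ vD (S.path x) s
      ... | _ , _ , t , refl , refl = inj₁ (pure (inj₁ t))

      sound : ∀ {u v} → Joins list u v → Sym (OnD x) u v
      sound = [ go , (λ s → swap (go s)) ]′
        where
        go : ∀ {u v} → Step u v list → Sym (OnD x) u v
        go = opened-elim (Sym (OnD x)) (λ κ → inj₁ (ca κ refl refl)) (inj₁ (bc one gap-one refl refl)) inside after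

      g₁g₂ : ∀ κ → Step (g₁ κ) (g₂ κ) (block κ)
      g₁g₂ κ = here

      g₂g₃ : ∀ κ → gap κ ≡ nothing → Step (g₂ κ) (g₃ κ) (block κ)
      g₂g₃ κ eq rewrite eq = there here

      g₂u : ∀ κ {j} → gap κ ≡ just j → Step (g₂ κ) (vU j) (block κ)
      g₂u κ eq rewrite eq = there here

      ug₃ : ∀ κ {j} → gap κ ≡ just j → Step (vU j) (g₃ κ) (block κ)
      ug₃ κ eq rewrite eq = there (there here)

      gap≢κ₀ : ∀ {κ j} → gap κ ≡ just j → κ ≢ one
      gap≢κ₀ eq refl with trans (sym gap-one) eq
      ... | ()

      complete : ∀ {u v} → OnD x u v → Joins list u v
      complete (ab κ ≢κ₀ refl refl) = inj₁ (opened-inside ≢κ₀ (g₁g₂ κ))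
      complete (bc κ eq refl refl) with κ ≟ one
      ... | yes refl = inj₁ here
      ... | no  ≢κ₀  = inj₁ (opened-inside ≢κ₀ (g₂g₃ κ eq))
      complete (sb κ eq refl) = inj₂ (opened-inside (gap≢κ₀ eq) (g₂u κ eq))
      complete (sc κ eq refl) = inj₁ (opened-inside (gap≢κ₀ eq) (ug₃ κ eq))
      complete (ca κ refl refl) = inj₁ (opened-across κ)
      complete (da refl refl) = inj₂ (opened-after here)
      complete (pure (inj₁ s)) = inj₁ (opened-after (there (step-map⁺ vD s)))
      complete (pure (inj₂ s)) = inj₂ (opened-after (there (step-map⁺ vD s)))

      κof : V → Z
      κof (vA z) = (z - x) * (- ιad)
      κof (vB z) = (z - x) * (- ιbd)
      κof (vC z) = (z - (x + one)) * (- ιcd)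
      κof (vU j) = emb j
      κof (vD _) = zer

      κof-block : ∀ {κ w} → w ∈ block κ → κof w ≡ κ
      κof-block {κ} p with gap κ in eq | p
      ... | nothing | here refl = slot-κ (flip invad) x κ
      ... | nothing | there (here refl) = slot-κ (flip invbd) x κ
      ... | nothing | there (there (here refl)) = slot-κ (flip invcd) (x + one) κ
      ... | just _  | here refl = slot-κ (flip invad) x κ
      ... | just _  | there (here refl) = slot-κ (flip invbd) x κ
      ... | just _  | there (there (here refl)) = sym (emb-gap eq)
      ... | just _  | there (there (there (here refl))) = slot-κ (flip invcd) (x + one) κ

      block! : ∀ κ → Unique (block κ)
      block! κ with gap κ
      ... | nothing = ((λ ()) ∷ (λ ()) ∷ []) ∷ ((λ ()) ∷ []) ∷ [] ∷ []
      ... | just _  = ((λ ()) ∷ (λ ()) ∷ (λ ()) ∷ []) ∷ ((λ ()) ∷ (λ ()) ∷ []) ∷ ((λ ()) ∷ []) ∷ [] ∷ []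

      apart : ∀ {κ w} → w ∈ block κ → w ∉ map vD (S.path x)
      apart {κ} p q with ∈-map⁻ vD q
      ... | _ , _ , refl with gap κ | p
      ...   | nothing | there (there (there ()))
      ...   | just _  | there (there (there (there ())))

      list! : Unique list
      list! = opened-unique C g₁ g₂ g₃ inner one block! κof κof-block (λ κ → there (here refl))
        (λ ()) (λ ()) (λ ()) (Uniqueₚ.map⁺ (λ { refl → refl }) (S.simple x)) apart

-- The paths of the further vertices, and the edges common to the paths of two lines

module Intersections where

  open Systems
  open Cyclic
  open Construction
  open import Data.Nat using (suc)

  module Meets (C : Residues) (K : Slopes C) {U : Set} (G : Gaps C U)
               (S : System (Residues.Z C)) (SU : System U)
               (cut : U → Residues.Z C) where
    open Lines C K G S SU cut
    open Arithmetic C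
    open Slopes K
    open Gaps G
    
    module PathT (j : U) where
      ε : Z
      ε = emb j
      g₁ g₃ : Z → V
      g₁ α = vC (at kc α ε)
      g₃ α = vB (at kb α ε)
      inner : Z → List V
      inner α = vD (at kd α ε) ∷ vA (at ka α ε) ∷ []
      open Blocks g₁ g₃ inner
      list : List V
      list = map vU (SU.path j) ++ walk (suc N) (α₀ j) []

      inside : ∀ α {u v} → Step u v (block α) → Sym (OnT j) u v
      inside α here                 = inj₁ (cd α refl refl)
      inside α (there here)         = inj₁ (da α refl refl)
      inside α (there (there here)) = inj₁ (ab α refl refl)
      inside α (there (there (there (there ()))))

      sound : ∀ {u v} → Joins list u v → Sym (OnT j) u v
      sound = [ go , (λ s → swap (go s)) ]′
        where
        end : ∀ {u v} → Step u v (g₃ (shift N (α₀ j)) ∷ []) → Sym (OnT j) u v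
        end (there ())
        go : ∀ {u v} → Step u v list → Sym (OnT j) u v
        go s with step-++⁻ (map vU (SU.path j)) s
        ... | inj₁ t with step-map⁻ vU (SU.path j) t
        ...   | _ , _ , r , refl , refl = inj₁ (pure (inj₁ r))
        go s | inj₂ (inj₁ (p , refl)) with ∈-map⁻ vU p
        ...   | _ , _ , refl = inj₁ link
        go s | inj₂ (inj₂ here)                 = inj₁ (cd _ refl refl)
        go s | inj₂ (inj₂ (there here))         = inj₁ (da _ refl refl)
        go s | inj₂ (inj₂ (there (there here))) = inj₁ (ab _ refl refl)
        go s | inj₂ (inj₂ (there (there (there t)))) =
          -- Steps between blocks leave only the first `N` points of the orbit, so none of them
          -- leads back to `α₀ j`: the walk is open there.
          walk-elim (Sym (OnT j)) N (α₀ j) [] (λ q → inj₁ (bc _ (other (orbit-next q)) refl refl)) (λ {α} _ → inside α) end t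

      spine : ∀ α {u v} → Step u v (block α) → Step u v list
      spine α s = step-++ʳ (map vU (SU.path j)) (walk-inside (suc N) (α₀ j) [] (full (α₀ j) α) s)

      before : ∀ {α} → next α ≢ α₀ j → α ∈ orbit N (α₀ j)
      before {α} ne with orbit-last N (α₀ j) (full (α₀ j) α)
      ... | inj₁ q    = q
      ... | inj₂ refl = contradiction (period (α₀ j)) ne

      -- The constructor `link` is an overestimate: it admits every edge between a further vertex
      -- and a line of slope c, so these edges cannot be traced back to the path. They are
      -- identified by the classes A and D instead.
      complete : ∀ {u v} → OnT j u v → ¬ (∃ λ i → ∃ λ c → u ≡ vU i × v ≡ vC c) → Joins list u v
      complete (cd α refl refl) _ = inj₁ (spine α here)
      complete (da α refl refl) _ = inj₁ (spine α (there here))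
      complete (ab α refl refl) _ = inj₁ (spine α (there (there here)))
      complete (bc α ne refl refl) _ = inj₁ (step-++ʳ (map vU (SU.path j)) (there (there (there (walk-across N (α₀ j) [] (before ne))))))
      complete link n = contradiction (_ , _ , refl , refl) n
      complete (pure (inj₁ s)) _ = inj₁ (step-++ˡ _ (step-map⁺ vU s))
      complete (pure (inj₂ s)) _ = inj₂ (step-++ˡ _ (step-map⁺ vU s))

      αof : V → Z
      αof (vA z) = z - ka * ε
      αof (vB z) = z - kb * ε
      αof (vC z) = z - kc * ε
      αof (vD z) = z - kd * ε
      αof (vU _) = zer

      αof-block : ∀ {α w} → w ∈ block α → αof w ≡ α
      αof-block {α} (here refl)                         = line kc α ε
      αof-block {α} (there (here refl))                 = line kd α ε
      αof-block {α} (there (there (here refl)))         = line ka α ε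
      αof-block {α} (there (there (there (here refl)))) = line kb α ε

      block! : ∀ α → Unique (block α)
      block! α = ((λ ()) ∷ (λ ()) ∷ (λ ()) ∷ []) ∷ ((λ ()) ∷ (λ ()) ∷ []) ∷ ((λ ()) ∷ []) ∷ [] ∷ []

      apart : ∀ {α w} → w ∈ block α → w ∉ map vU (SU.path j)
      apart p q with ∈-map⁻ vU q
      apart (there (there (there (there ())))) q | _ , _ , refl

      list! : Unique list
      list! = Uniqueₚ.++⁺ (Uniqueₚ.map⁺ (λ { refl → refl }) (SU.simple j))
        (Uniqueₚ.++⁺ (concatMap-unique block block! (λ p q → trans (sym (αof-block p)) (αof-block q)) (distinct (α₀ j))) [] λ { (_ , ()) })
        λ (q , p) → disjoint p q
        where
        disjoint : ∀ {w} → w ∈ walk (suc N) (α₀ j) [] → w ∉ map vU (SU.path j)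
        disjoint p q with ∈-++⁻ (concatMap block (orbit (suc N) (α₀ j))) p
        ... | inj₁ r = let (_ , _ , t) = find (∈-concatMap⁻ block {xs = orbit (suc N) (α₀ j)} r) in apart t q

    module CAB = Coordinates ka kb ιab invab
    module CAC = Coordinates ka kc ιac invac
    module CAD = Coordinates ka kd ιad invad
    module CBC = Coordinates kb kc ιbc invbc
    module CBD = Coordinates kb kd ιbd invbd
    module CCD = Coordinates kc kd ιcd invcd

    one≢zer : one ≢ zer
    one≢zer e = zer≢one (sym e)

    gap-same : ∀ {κ κ′ j} → gap κ ≡ just j → gap κ′ ≡ just j → κ ≡ κ′
    gap-same e f = trans (emb-gap e) (sym (emb-gap f))

    taut : ∀ {κ j} {W : Set} → gap κ ≡ nothing → κ ≡ emb j → W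
    taut e refl with trans (sym e) (gap-emb _)
    ... | ()

    clash : ∀ {κ j} {W : Set} → gap κ ≡ nothing → gap κ ≡ just j → W
    clash e f with trans (sym e) f
    ... | ()

    infixr 5 _⨾_
    _⨾_ : ∀ {x y z : Z} → x ≡ y → x ≡ z → y ≡ z
    e ⨾ f = trans (sym e) f

    -- The three cases exclude one another by the kind of height: an ordinary one, the height 0
    -- where paths of slope a are opened, or the height of a further vertex. So each height leaves
    -- one candidate for a common edge.
    data MeetAB (x κ : Z) : V → V → Set where
      cd : ∀ {c d} → gap κ ≡ nothing → κ ≢ zer → c ≡ slot ka kc x κ → d ≡ slot ka kd x κ → MeetAB x κ (vC c) (vD d)
      da : ∀ {d a} → κ ≡ zer → d ≡ slot ka kd x zer → a ≡ x → MeetAB x κ (vD d) (vA a)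
      sd : ∀ {j d} → gap κ ≡ just j → d ≡ slot ka kd x κ → MeetAB x κ (vU j) (vD d)

    meetAB : ∀ {x y u v} → OnA x u v → OnB y u v → ∃ λ κ → x - ka * κ ≡ y - kb * κ × MeetAB x κ u v
    meetAB {x} {y} (cd κ g ne c d) (cd κ′ c′ d′) with CCD.unique (c ⨾ c′) (d ⨾ d′)
    ... | e , refl = κ , e , cd g ne c d
    meetAB {x} {y} (sd κ g d) (sd κ′ g′ d′) with gap-same g g′
    ... | refl = κ , at-cancel kd κ (d ⨾ d′) , sd g d
    meetAB {x} {y} (da d a) (da κ′ _ _ d′ a′) with CAD.unique (trans (slot-self ka x zer) (a ⨾ a′)) (d ⨾ d′)
    ... | e , refl = zer , e , da refl d a

    sameAB : ∀ {x κ u v u′ v′} → MeetAB x κ u v → MeetAB x κ u′ v′ → u ≡ u′ × v ≡ v′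
    sameAB (cd _ _ refl refl) (cd _ _ refl refl) = refl , refl
    sameAB (cd _ ne _ _)      (da z _ _)         = contradiction z ne
    sameAB (cd g _ _ _)       (sd g′ _)          = clash g g′
    sameAB (da z _ _)         (cd _ ne _ _)      = contradiction z ne
    sameAB (da _ refl refl)   (da _ refl refl)   = refl , refl
    sameAB (da refl _ _)      (sd g _)           = clash gap-zer g
    sameAB (sd g _)           (cd g′ _ _ _)      = clash g′ g
    sameAB (sd g _)           (da refl _ _)      = clash gap-zer g
    sameAB (sd g refl)        (sd g′ refl)       with just-injective (trans (sym g) g′)
    ... | refl = refl , refl

    -- Lines of different slopes have the same point at only one height, and that height fixes the
    -- common edge of their paths.
    onceAB : ∀ {x y u v u′ v′} → OnA x u v → OnB y u v → OnA x u′ v′ → OnB y u′ v′ → u ≡ u′ × v ≡ v′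
    onceAB p q p′ q′ with meetAB p q | meetAB p′ q′
    ... | _ , e , s | _ , e′ , s′ with CAB.meet e e′
    ...   | refl = sameAB s s′

    -- Both opening heights intervene here: at ordinary heights the common edge is da, but cd
    -- replaces it at height 0 and ab at height 1.
    data MeetBC (y κ : Z) : V → V → Set where
      da : ∀ {d a} → gap κ ≡ nothing → κ ≢ one → κ ≢ zer → d ≡ slot kb kd y κ → a ≡ slot kb ka y κ → MeetBC y κ (vD d) (vA a)
      sa : ∀ {j a} → gap κ ≡ just j → a ≡ slot kb ka y κ → MeetBC y κ (vU j) (vA a)
      ab : ∀ {a b} → κ ≡ one → a ≡ slot kb ka y one → b ≡ y → MeetBC y κ (vA a) (vB b)
      cd : ∀ {c d} → κ ≡ zer → c ≡ slot kb kc y κ → d ≡ slot kb kd y κ → MeetBC y κ (vC c) (vD d)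

    meetBC : ∀ {y z u v} → OnB y u v → OnC z u v → ∃ λ κ → y - kb * κ ≡ z - kc * κ × MeetBC y κ u v
    meetBC {y} {z} (cd κ c d) (cd c′ d′) with CCD.unique (c ⨾ trans c′ (sym (slot-self kc z zer))) (d ⨾ d′)
    ... | e , refl = κ , e , cd refl c d
    meetBC (da κ g ne d a) (da κ′ ne′ d′ a′) with CAD.unique (a ⨾ a′) (d ⨾ d′)
    ... | e , refl = κ , e , da g ne ne′ d a
    meetBC (sa κ g a) (sa κ′ g′ a′) with gap-same g g′
    ... | refl = κ , at-cancel ka κ (a ⨾ a′) , sa g a
    meetBC {y} {z} (ab a b) (ab κ′ g a′ b′) with CAB.unique (a ⨾ a′) (trans (slot-self kb y one) (b ⨾ b′))
    ... | e , refl = one , e , ab refl a b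

    sameBC : ∀ {y κ u v u′ v′} → MeetBC y κ u v → MeetBC y κ u′ v′ → u ≡ u′ × v ≡ v′
    sameBC (da _ _ _ refl refl) (da _ _ _ refl refl) = refl , refl
    sameBC (da g _ _ _ _)       (sa g′ _)            = clash g g′
    sameBC (da _ ne _ _ _)      (ab e _ _)           = contradiction e ne
    sameBC (da _ _ ne _ _)      (cd e _ _)           = contradiction e ne
    sameBC (sa g _)             (da g′ _ _ _ _)      = clash g′ g
    sameBC (sa g refl)          (sa g′ refl)         with just-injective (trans (sym g) g′)
    ... | refl = refl , refl
    sameBC (sa g _)             (ab refl _ _)        = clash gap-one g
    sameBC (sa g _)             (cd refl _ _)        = clash gap-zer g
    sameBC (ab e _ _)           (da _ ne _ _ _)      = contradiction e ne
    sameBC (ab refl _ _)        (sa g _)             = clash gap-one g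
    sameBC (ab _ refl refl)     (ab _ refl refl)     = refl , refl
    sameBC (ab refl _ _)        (cd e _ _)           = contradiction e one≢zer
    sameBC (cd e _ _)           (da _ _ ne _ _)      = contradiction e ne
    sameBC (cd refl _ _)        (sa g _)             = clash gap-zer g
    sameBC (cd refl _ _)        (ab e _ _)           = contradiction e zer≢one
    sameBC (cd _ refl refl)     (cd _ refl refl)     = refl , refl

    onceBC : ∀ {y z u v u′ v′} → OnB y u v → OnC z u v → OnB y u′ v′ → OnC z u′ v′ → u ≡ u′ × v ≡ v′
    onceBC p q p′ q′ with meetBC p q | meetBC p′ q′
    ... | _ , e , s | _ , e′ , s′ with CBC.meet e e′
    ...   | refl = sameBC s s′

    data MeetCD (z κ : Z) : V → V → Set where
      ab : ∀ {a b} → gap κ ≡ nothing → κ ≢ one → a ≡ slot kc ka z κ → b ≡ slot kc kb z κ → MeetCD z κ (vA a) (vB b)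
      sb : ∀ {j b} → gap κ ≡ just j → b ≡ slot kc kb z κ → MeetCD z κ (vU j) (vB b)
      da : ∀ {d a} → κ ≡ one → d ≡ slot kc kd z κ → a ≡ slot kc ka z κ → MeetCD z κ (vD d) (vA a)

    meetCD : ∀ {z w u v} → OnC z u v → OnD w u v → ∃ λ κ → z - kc * κ ≡ w - kd * κ × MeetCD z κ u v
    meetCD {z} {w} (da κ ne d a) (da d′ a′) with CAD.unique (a ⨾ a′) (d ⨾ trans d′ (sym (slot-self kd w one)))
    ... | e , refl = κ , e , da refl d a
    meetCD (ab κ g a b) (ab κ′ ne a′ b′) with CAB.unique (a ⨾ a′) (b ⨾ b′)
    ... | e , refl = κ , e , ab g ne a b
    meetCD (sb κ g b) (sb κ′ g′ b′) with gap-same g g′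
    ... | refl = κ , at-cancel kb κ (b ⨾ b′) , sb g b

    sameCD : ∀ {z κ u v u′ v′} → MeetCD z κ u v → MeetCD z κ u′ v′ → u ≡ u′ × v ≡ v′
    sameCD (ab _ _ refl refl) (ab _ _ refl refl) = refl , refl
    sameCD (ab g _ _ _)       (sb g′ _)          = clash g g′
    sameCD (ab _ ne _ _)      (da e _ _)         = contradiction e ne
    sameCD (sb g _)           (ab g′ _ _ _)      = clash g′ g
    sameCD (sb g refl)        (sb g′ refl)       with just-injective (trans (sym g) g′)
    ... | refl = refl , refl
    sameCD (sb g _)           (da refl _ _)      = clash gap-one g
    sameCD (da e _ _)         (ab _ ne _ _)      = contradiction e ne
    sameCD (da refl _ _)      (sb g _)           = clash gap-one g
    sameCD (da _ refl refl)   (da _ refl refl)   = refl , refl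

    onceCD : ∀ {z w u v u′ v′} → OnC z u v → OnD w u v → OnC z u′ v′ → OnD w u′ v′ → u ≡ u′ × v ≡ v′
    onceCD p q p′ q′ with meetCD p q | meetCD p′ q′
    ... | _ , e , s | _ , e′ , s′ with CCD.meet e e′
    ...   | refl = sameCD s s′

    data MeetAD (x κ : Z) : V → V → Set where
      bc : ∀ {b c} → gap κ ≡ nothing → b ≡ slot ka kb (x - one) κ → c ≡ slot ka kc x κ → MeetAD x κ (vB b) (vC c)
      sc : ∀ {j c} → gap κ ≡ just j → c ≡ slot ka kc x κ → MeetAD x κ (vU j) (vC c)

    shiftAD : ∀ {k x κ w κ′} → slot ka k x κ ≡ slot kd k (w + one) κ′ → slot ka k (x - one) κ ≡ slot kd k w κ′
    shiftAD {k} {x} {κ} {w} {κ′} e = trans (pred-slot ka k x κ) (trans (cong (_- one) e)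
      (trans (sym (pred-slot kd k (w + one) κ′)) (cong (λ w → slot kd k w κ′) (pred-next w))))

    -- The shift in the edges bc makes `x - one`, not `x`, the line to be intersected with `w`. The
    -- edge da cannot be common: it occurs on paths of slope a only at height 0 and on paths of
    -- slope d only at height 1.
    meetAD : ∀ {x w u v} → OnA x u v → OnD w u v → ∃ λ κ → (x - one) - ka * κ ≡ w - kd * κ × MeetAD x κ u v
    meetAD {x} {w} (bc κ b c) (bc κ′ g b′ c′) with CBC.unique (b ⨾ b′) (shiftAD (c ⨾ c′))
    ... | e , refl = κ , e , bc g b c
    meetAD {x} {w} (sc κ g c) (sc κ′ g′ c′) with gap-same g g′
    ... | refl = κ , at-cancel kc κ (shiftAD (c ⨾ c′)) , sc g c
    meetAD {x} {w} (da d a) (da d′ a′) with CAD.unique (trans (slot-self ka x zer) (a ⨾ a′)) (d ⨾ trans d′ (sym (slot-self kd w one)))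
    ... | _ , e = contradiction e zer≢one

    onceAD : ∀ {x w u v u′ v′} → OnA x u v → OnD w u v → OnA x u′ v′ → OnD w u′ v′ → u ≡ u′ × v ≡ v′
    onceAD p q p′ q′ with meetAD p q | meetAD p′ q′
    ... | _ , e , s | _ , e′ , s′ with CAD.meet e e′
    ...   | refl = same s s′
      where
      same : ∀ {x κ u v u′ v′} → MeetAD x κ u v → MeetAD x κ u′ v′ → u ≡ u′ × v ≡ v′
      same (bc _ refl refl) (bc _ refl refl) = refl , refl
      same (bc g _ _)       (sc g′ _)        = clash g g′
      same (sc g _)         (bc g′ _ _)      = clash g′ g
      same (sc g refl)      (sc g′ refl)     with just-injective (trans (sym g) g′)
      ... | refl = refl , refl

    data OnlyAC (x z : Z) : V → V → Set where
      bd : ∀ {b d} κ λ′ → b ≡ slot ka kb (x - one) κ → d ≡ slot ka kd x (next κ) →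
           b ≡ slot kc kb z λ′ → d ≡ slot kc kd z (next λ′) → OnlyAC x z (vB b) (vD d)

    meetAC : ∀ {x z u v} → OnA x u v → OnC z u v → OnlyAC x z u v
    meetAC (bd κ b d) (bd κ′ b′ d′) = bd κ κ′ b d b′ d′
    meetAC {x} {z} (cd κ _ ne c d) (cd c′ d′) with CCD.unique (c ⨾ trans c′ (sym (slot-self kc z zer))) (d ⨾ d′)
    ... | _ , e = contradiction e ne
    meetAC {x} {z} (da d a) (da κ ne d′ a′) with CAD.unique (trans (slot-self ka x zer) (a ⨾ a′)) (d ⨾ d′)
    ... | _ , e = contradiction (sym e) ne

    -- The common edges are diagonals bd, which the two paths may use at different heights. The
    -- intersection of the two lines is then of no help, and `crossing` takes its place.
    onceAC : ∀ {x z u v u′ v′} → OnA x u v → OnC z u v → OnA x u′ v′ → OnC z u′ v′ → u ≡ u′ × v ≡ v′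
    onceAC {x} {z} p q p′ q′ with meetAC p q | meetAC p′ q′
    ... | bd κ λ′ refl refl e f | bd κ′ λ″ refl refl e′ f′
      with crossing {x = x - one} {x₂ = x} {y = z} {y₂ = z} invbd invac e f e′ f′
    ...   | refl = refl , refl

    data OnlyBD (y w : Z) : V → V → Set where
      ca : ∀ {c a} κ λ′ → c ≡ slot kb kc y κ → a ≡ slot kb ka y (next κ) →
           c ≡ slot kd kc (w + one) λ′ → a ≡ slot kd ka w (next λ′) → OnlyBD y w (vC c) (vA a)

    meetBD : ∀ {y w u v} → OnB y u v → OnD w u v → OnlyBD y w u v
    meetBD (ca κ c a) (ca κ′ c′ a′) = ca κ κ′ c a c′ a′
    meetBD {y} {w} (da κ _ ne d a) (da d′ a′) with CAD.unique (a ⨾ a′) (d ⨾ trans d′ (sym (slot-self kd w one)))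
    ... | _ , e = contradiction e ne
    meetBD {y} {w} (ab a b) (ab κ ne a′ b′) with CAB.unique (a ⨾ a′) (trans (slot-self kb y one) (b ⨾ b′))
    ... | _ , e = contradiction (sym e) ne

    onceBD : ∀ {y w u v u′ v′} → OnB y u v → OnD w u v → OnB y u′ v′ → OnD w u′ v′ → u ≡ u′ × v ≡ v′
    onceBD {y} {w} p q p′ q′ with meetBD p q | meetBD p′ q′
    ... | ca κ λ′ refl refl e f | ca κ′ λ″ refl refl e′ f′
      with crossing {x = y} {x₂ = y} {y = w + one} {y₂ = w} (flip invac) invbd e f e′ f′
    ...   | refl = refl , refl

-- The composite system: coverage, separation and spare indices

module Composition where

  open Systems
  open Cyclic
  open Construction
  open Intersections

  module Composite (C : Residues) (K : Slopes C) {U : Set} (G : Gaps C U)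
                   (S : System (Residues.Z C)) (SU : System U)
                   (cut : U → Residues.Z C) (cut-injective : ∀ {i j} → cut i ≡ cut j → i ≡ j)
                   (cut∈ : ∀ j → cut j ∈ System.spare S) where
    open Lines C K G S SU cut
    open Meets C K G S SU cut
    open Arithmetic C
    open Slopes K
    open Gaps G

    UC : V → V → Set
    UC u v = ∃ λ i → ∃ λ c → u ≡ vU i × v ≡ vC c

    unshift : ∀ {k x κ α j} → slot ka k x κ ≡ at k (next α) (emb j) → slot ka k (x - one) κ ≡ at k α (emb j)
    unshift {k} {x} {κ} {α} e = trans (pred-slot ka k x κ) (trans (cong (_- one) (trans e (at-next k α _))) (pred-next _))

    unshiftD : ∀ {k w κ α j} → slot kd k (w + one) κ ≡ at k (next α) (emb j) → slot kd k w κ ≡ at k α (emb j)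
    unshiftD {k} {w} {κ} {α} e = trans (cong (λ w → slot kd k w κ) (sym (pred-next w)))
      (trans (pred-slot kd k (w + one) κ) (trans (cong (_- one) (trans e (at-next k α _))) (pred-next _)))

    -- The walk of `j` stays at one height, so a common edge lies at that height on the line `x`.
    -- Edges that the path of `x` uses only at free heights are thereby ruled out.
    teeA : ∀ {x j u v} → OnA x u v → OnT j u v → ¬ UC u v → u ≡ vB (slot ka kb (x - one) (emb j)) × v ≡ vC (slot ka kc x (emb j))
    teeA (bc κ b c) (bc α _ b′ c′) _ with CBC.unique (b ⨾ b′) (unshift (c ⨾ c′))
    ... | _ , refl = cong vB b , cong vC c
    teeA (cd κ g _ c d) (cd α c′ d′) _ = taut g (proj₂ (CCD.unique (c ⨾ c′) (d ⨾ d′)))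
    teeA {x} (da d a) (da α d′ a′) _ = taut gap-zer (proj₂ (CAD.unique (trans (slot-self ka x zer) (a ⨾ a′)) (d ⨾ d′)))
    teeA (sc _ _ _) link n = contradiction (_ , _ , refl , refl) n

    teeB : ∀ {y j u v} → OnB y u v → OnT j u v → u ≡ vC (slot kb kc y (emb j)) × v ≡ vD (slot kb kd y (emb j))
    teeB (cd κ c d) (cd α c′ d′) with CCD.unique (c ⨾ c′) (d ⨾ d′)
    ... | _ , refl = cong vC c , cong vD d
    teeB (da κ g _ d a) (da α d′ a′) = taut g (proj₂ (CAD.unique (a ⨾ a′) (d ⨾ d′)))
    teeB {y} (ab a b) (ab α a′ b′) = taut gap-one (proj₂ (CAB.unique (a ⨾ a′) (trans (slot-self kb y one) (b ⨾ b′))))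

    teeC : ∀ {z j u v} → OnC z u v → OnT j u v → u ≡ vD (slot kc kd z (emb j)) × v ≡ vA (slot kc ka z (emb j))
    teeC (da κ _ d a) (da α d′ a′) with CAD.unique (a ⨾ a′) (d ⨾ d′)
    ... | _ , refl = cong vD d , cong vA a
    teeC (ab κ g a b) (ab α a′ b′) = taut g (proj₂ (CAB.unique (a ⨾ a′) (b ⨾ b′)))
    teeC {z} (cd c d) (cd α c′ d′) = taut gap-zer (proj₂ (CCD.unique (trans (slot-self kc z zer) (c ⨾ c′)) (d ⨾ d′)))

    teeD : ∀ {w j u v} → OnD w u v → OnT j u v → ¬ UC u v → u ≡ vA (slot kd ka w (emb j)) × v ≡ vB (slot kd kb w (emb j))
    teeD (ab κ _ a b) (ab α a′ b′) _ with CAB.unique (a ⨾ a′) (b ⨾ b′)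
    ... | _ , refl = cong vA a , cong vB b
    teeD {w} {j} (bc κ g b c) (bc α _ b′ c′) _ = taut g (proj₂ (CBC.unique (b ⨾ b′) (unshiftD {j = j} (c ⨾ c′))))
    teeD {w} (da d a) (da α d′ a′) _ = taut gap-one (proj₂ (CAD.unique (a ⨾ a′) (trans (slot-self kd w one) (d ⨾ d′))))
    teeD (sc _ _ _) link n = contradiction (_ , _ , refl , refl) n

    data Two (u v : V) : Set where
      AB : ∀ {x y} → OnA x u v → OnB y u v → Two u v
      AC : ∀ {x y} → OnA x u v → OnC y u v → Two u v
      AD : ∀ {x y} → OnA x u v → OnD y u v → Two u v
      BC : ∀ {x y} → OnB x u v → OnC y u v → Two u v
      BD : ∀ {x y} → OnB x u v → OnD y u v → Two u v
      CD : ∀ {x y} → OnC x u v → OnD y u v → Two u v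

    data Tee (u v : V) : Set where
      A : ∀ {x j} → OnA x u v → OnT j u v → ¬ UC u v → Tee u v
      B : ∀ {x j} → OnB x u v → OnT j u v → ¬ UC u v → Tee u v
      C′ : ∀ {x j} → OnC x u v → OnT j u v → ¬ UC u v → Tee u v
      D : ∀ {x j} → OnD x u v → OnT j u v → ¬ UC u v → Tee u v

    data Pure : V → V → Set where
      aa : ∀ {p q} → Pure (vA p) (vA q)
      bb : ∀ {p q} → Pure (vB p) (vB q)
      cc : ∀ {p q} → Pure (vC p) (vC q)
      dd : ∀ {p q} → Pure (vD p) (vD q)
      uu : ∀ {p q} → Pure (vU p) (vU q)

    -- Every edge lies on paths of two of the classes A, B, C, D, or on one of
    -- these and a path of the class T, or is the edge where a path of class T is
    -- cut, or joins two vertices of the same part.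
    data Kind : V → V → Set where
      two  : ∀ {u v} → Two u v → Kind u v
      tee  : ∀ {u v} → Tee u v → Kind u v
      left : ∀ j {b c} → b ≡ slot ka kb (cut j - one) (emb j) → c ≡ slot ka kc (cut j) (emb j) → Kind (vB b) (vC c)
      pure : ∀ {u v} → Pure u v → u ≢ v → Kind u v

    at-emb : ∀ k {α κ j v} → gap κ ≡ just j → at k α κ ≡ v → v ≡ at k α (emb j)
    at-emb k {α} g e = trans (sym e) (cong (at k α) (emb-gap g))

    -- In general an edge at a point is owned by the other two lines through the point. The case
    -- distinction records the exceptions: at an opening height one line hands the edge to another,
    -- and at an occupied height one line hands it to the further vertex.
    edge-ab : ∀ {a b} α κ → at ka α κ ≡ a → at kb α κ ≡ b → Kind (vA a) (vB b)
    edge-ab α κ a b with gap κ in g | κ ≟ one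
    ... | nothing | no ne    = two (CD (ab κ g (via kc ka a) (via kc kb b)) (ab κ ne (via kd ka a) (via kd kb b)))
    ... | nothing | yes refl = two (BC (ab (trans (via kb ka a) (cong (λ y → slot kb ka y one) b)) refl) (ab one g (via kc ka a) (via kc kb b)))
    ... | just j  | yes refl = clash gap-one g
    ... | just j  | no ne    = tee (D (ab κ ne (via kd ka a) (via kd kb b)) (ab α (at-emb ka g a) (at-emb kb g b)) λ ())

    edge-bc : ∀ {b c} α κ → at kb α κ ≡ b → at kc (next α) κ ≡ c → Kind (vB b) (vC c)
    edge-bc {b′} {c′} α κ b c = go
      where
      bA : b′ ≡ slot ka kb (at ka (next α) κ - one) κ
      bA = trans (via ka kb b) (cong (λ y → slot ka kb y κ) (sym (trans (cong (_- one) (at-next ka α κ)) (pred-next _))))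
      cD : c′ ≡ slot kd kc (at kd α κ + one) κ
      cD = trans (via kd kc c) (cong (λ y → slot kd kc y κ) (at-next kd α κ))
      go : Kind (vB b′) (vC c′)
      go with gap κ in g
      ... | nothing = two (AD (bc κ bA (via ka kc c)) (bc κ g (via kd kb b) cD))
      ... | just j with next α ≟ α₀ j
      ...   | no ne = tee (A (bc κ bA (via ka kc c)) (bc α ne (at-emb kb g b) (at-emb kc g c)) λ ())
      -- Here the line of slope d has given the edge to the further vertex `j`, whose walk is cut
      -- exactly at this edge. The line `cut j` of slope a remains as its only owner.
      ...   | yes e = left j (trans bA (cong₂ (λ y κ → slot ka kb (y - one) κ) x≡ (emb-gap g)))
                             (trans (via ka kc c) (cong₂ (λ y κ → slot ka kc y κ) x≡ (emb-gap g)))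
        where
        x≡ : at ka (next α) κ ≡ cut j
        x≡ = trans (cong₂ (at ka) e (emb-gap g)) (slot-self ka (cut j) (emb j))

    edge-cd : ∀ {c d} α κ → at kc α κ ≡ c → at kd α κ ≡ d → Kind (vC c) (vD d)
    edge-cd α κ c d with gap κ in g | κ ≟ zer
    ... | nothing | no ne    = two (AB (cd κ g ne (via ka kc c) (via ka kd d)) (cd κ (via kb kc c) (via kb kd d)))
    ... | nothing | yes refl = two (BC (cd zer (via kb kc c) (via kb kd d)) (cd refl (trans (via kc kd d) (cong (λ y → slot kc kd y zer) c))))
    ... | just j  | _        = tee (B (cd κ (via kb kc c) (via kb kd d)) (cd α (at-emb kc g c) (at-emb kd g d)) λ ())

    edge-da : ∀ {d a} α κ → at ka α κ ≡ a → at kd α κ ≡ d → Kind (vD d) (vA a)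
    edge-da α κ a d with gap κ in g | κ ≟ zer | κ ≟ one
    ... | just j  | no ne    | _        = tee (C′ (da κ ne (via kc kd d) (via kc ka a)) (da α (at-emb kd g d) (at-emb ka g a)) λ ())
    ... | just j  | yes refl | _        = clash gap-zer g
    ... | nothing | yes refl | _        = two (AB (da (trans (via ka kd d) (cong (λ y → slot ka kd y zer) a)) refl) (da zer g zer≢one (via kb kd d) (via kb ka a)))
    ... | nothing | no ne    | yes refl = two (CD (da one ne (via kc kd d) (via kc ka a)) (da refl (trans (via kd ka a) (cong (λ y → slot kd ka y one) d))))
    ... | nothing | no ne    | no ne′   = two (BC (da κ g ne′ (via kb kd d) (via kb ka a)) (da κ ne (via kc kd d) (via kc ka a)))

    -- Lowering `a` by the displacement of one height makes the diagonal an incidence, and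
    -- coordinates supply its point. The displacement depends on the slope along which the height
    -- rises, so the owners of slopes b and d are found at points of their own.
    edge-ca : ∀ c a → Kind (vC c) (vA a)
    edge-ca c a = two (BD
      (ca _ (via kb kc (CAC.at₂ (a - (ka * one - kb * one)) c)) (across kb ka (CAC.at₁ (a - (ka * one - kb * one)) c)))
      (ca _ (succ-slot kd kc (via kd kc (CAC.at₂ (a - (ka * one - kd * one)) (c - one)))) (across kd ka (CAC.at₁ (a - (ka * one - kd * one)) (c - one)))))

    edge-bd : ∀ b d → Kind (vB b) (vD d)
    edge-bd b d = two (AC
      (bd _ (unsucc-slot ka kb (via ka kb (CBD.at₁ (b + one) (d - (kd * one - ka * one))))) (across ka kd (CBD.at₂ (b + one) (d - (kd * one - ka * one)))))
      (bd _ (via kc kb (CBD.at₁ b (d - (kd * one - kc * one)))) (across kc kd (CBD.at₂ b (d - (kd * one - kc * one))))))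

    edge-ua : ∀ j a → Kind (vU j) (vA a)
    edge-ua j a = two (BC (sa _ (gap-emb j) (via kb ka (slot-self ka a (emb j)))) (sa _ (gap-emb j) (via kc ka (slot-self ka a (emb j)))))

    edge-ub : ∀ j b → Kind (vU j) (vB b)
    edge-ub j b = two (CD (sb _ (gap-emb j) (via kc kb (slot-self kb b (emb j)))) (sb _ (gap-emb j) (via kd kb (slot-self kb b (emb j)))))

    edge-uc : ∀ j c → Kind (vU j) (vC c)
    edge-uc j c = two (AD (sc _ (gap-emb j) (via ka kc (slot-self kc c (emb j))))
      (sc {x = at kd (c - kc * emb j) (emb j) - one} _ (gap-emb j) (trans (via kd kc (slot-self kc c (emb j))) (cong (λ w → slot kd kc w (emb j)) (sym (next-pred _))))))

    edge-ud : ∀ j d → Kind (vU j) (vD d)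
    edge-ud j d = two (AB (sd _ (gap-emb j) (via ka kd (slot-self kd d (emb j)))) (sd _ (gap-emb j) (via kb kd (slot-self kd d (emb j)))))

    edge-bc′ : ∀ b c → Kind (vB b) (vC c)
    edge-bc′ b c = edge-bc _ _ (CBC.at₁ b (c - one)) (trans (at-next kc _ _) (trans (cong next (CBC.at₂ b (c - one))) (next-pred c)))

    kind : ∀ u v → u ≢ v → Kind u v ⊎ Kind v u
    kind (vA a) (vA _) ne = inj₁ (pure aa ne)
    kind (vB a) (vB _) ne = inj₁ (pure bb ne)
    kind (vC a) (vC _) ne = inj₁ (pure cc ne)
    kind (vD a) (vD _) ne = inj₁ (pure dd ne)
    kind (vU a) (vU _) ne = inj₁ (pure uu ne)
    kind (vA a) (vB b) _  = inj₁ (edge-ab _ _ (CAB.at₁ a b) (CAB.at₂ a b))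
    kind (vB b) (vA a) _  = inj₂ (edge-ab _ _ (CAB.at₁ a b) (CAB.at₂ a b))
    kind (vB b) (vC c) _  = inj₁ (edge-bc′ b c)
    kind (vC c) (vB b) _  = inj₂ (edge-bc′ b c)
    kind (vC c) (vD d) _  = inj₁ (edge-cd _ _ (CCD.at₁ c d) (CCD.at₂ c d))
    kind (vD d) (vC c) _  = inj₂ (edge-cd _ _ (CCD.at₁ c d) (CCD.at₂ c d))
    kind (vD d) (vA a) _  = inj₁ (edge-da _ _ (CAD.at₁ a d) (CAD.at₂ a d))
    kind (vA a) (vD d) _  = inj₂ (edge-da _ _ (CAD.at₁ a d) (CAD.at₂ a d))
    kind (vC c) (vA a) _  = inj₁ (edge-ca c a)
    kind (vA a) (vC c) _  = inj₂ (edge-ca c a)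
    kind (vB b) (vD d) _  = inj₁ (edge-bd b d)
    kind (vD d) (vB b) _  = inj₂ (edge-bd b d)
    kind (vU j) (vA a) _  = inj₁ (edge-ua j a)
    kind (vA a) (vU j) _  = inj₂ (edge-ua j a)
    kind (vU j) (vB b) _  = inj₁ (edge-ub j b)
    kind (vB b) (vU j) _  = inj₂ (edge-ub j b)
    kind (vU j) (vC c) _  = inj₁ (edge-uc j c)
    kind (vC c) (vU j) _  = inj₂ (edge-uc j c)
    kind (vU j) (vD d) _  = inj₁ (edge-ud j d)
    kind (vD d) (vU j) _  = inj₂ (edge-ud j d)

    -- The consequences, class by class, of every path through uv also passing through zw. For the
    -- class T the edge uv is restricted to those on which `OnT` is exact.
    record Same (u v z w : V) : Set where
      field
        sA : ∀ {x} → OnA x u v → OnA x z w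
        sB : ∀ {x} → OnB x u v → OnB x z w
        sC : ∀ {x} → OnC x u v → OnC x z w
        sD : ∀ {x} → OnD x u v → OnD x z w
        sT : ∀ {j} → OnT j u v → ¬ UC u v → OnT j z w
        sU : ∀ {j p q} → u ≡ vU p → v ≡ vU q → Joins (SU.path j) p q → OnT j z w
    open Same

    two-same : ∀ {u v z w} → Two u v → Same u v z w → u ≡ z × v ≡ w
    two-same (AB p q) h = onceAB p q (sA h p) (sB h q)
    two-same (AC p q) h = onceAC p q (sA h p) (sC h q)
    two-same (AD p q) h = onceAD p q (sA h p) (sD h q)
    two-same (BC p q) h = onceBC p q (sB h p) (sC h q)
    two-same (BD p q) h = onceBD p q (sB h p) (sD h q)
    two-same (CD p q) h = onceCD p q (sC h p) (sD h q)

    both : ∀ {u v z w r s : V} → u ≡ r × v ≡ s → z ≡ r × w ≡ s → u ≡ z × v ≡ w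
    both (e , f) (e′ , f′) = trans e (sym e′) , trans f (sym f′)

    tee-same : ∀ {u v z w} → Tee u v → ¬ UC z w → Same u v z w → u ≡ z × v ≡ w
    tee-same (A p t n)  n′ h = both (teeA p t n) (teeA (sA h p) (sT h t n) n′)
    tee-same (B p t n)  n′ h = both (teeB p t) (teeB (sB h p) (sT h t n))
    tee-same (C′ p t n) n′ h = both (teeC p t) (teeC (sC h p) (sT h t n))
    tee-same (D p t n)  n′ h = both (teeD p t n) (teeD (sD h p) (sT h t n) n′)

    -- The lines of slopes b and c fix a point, and with it the line of slope a.
    only-A : ∀ {x x′ b c} → OnA x (vB b) (vC c) → OnA x′ (vB b) (vC c) → x ≡ x′
    only-A {x} {x′} (bc κ b c) (bc κ′ b′ c′)
      with CBC.unique (b ⨾ b′) (trans (pred-slot ka kc x κ) (trans (cong (_- one) (c ⨾ c′)) (sym (pred-slot ka kc x′ κ′))))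
    ... | e , refl = label-cancel (ka * κ) e

    not-UC : ∀ {z w} → Tee z w ⊎ Pure z w ⊎ (∃ λ b → ∃ λ c → z ≡ vB b × w ≡ vC c) → ¬ UC z w
    not-UC (inj₁ (A _ _ n))  = n
    not-UC (inj₁ (B _ _ n))  = n
    not-UC (inj₁ (C′ _ _ n)) = n
    not-UC (inj₁ (D _ _ n))  = n
    not-UC (inj₂ (inj₁ aa)) (_ , _ , () , _)
    not-UC (inj₂ (inj₁ bb)) (_ , _ , () , _)
    not-UC (inj₂ (inj₁ cc)) (_ , _ , () , _)
    not-UC (inj₂ (inj₁ dd)) (_ , _ , () , _)
    not-UC (inj₂ (inj₁ uu)) (_ , _ , _ , ())
    not-UC (inj₂ (inj₂ (_ , _ , refl , _))) (_ , _ , () , _)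

    own-A : ∀ {x z w} → OnA x z w → Pure z w → ∃ λ p → ∃ λ q → z ≡ vA p × w ≡ vA q × Joins (S.path x) p q
    own-A (pure j) aa = _ , _ , refl , refl , j
    own-B : ∀ {x z w} → OnB x z w → Pure z w → ∃ λ p → ∃ λ q → z ≡ vB p × w ≡ vB q × Joins (S.path x) p q
    own-B (pure j) bb = _ , _ , refl , refl , j
    own-C : ∀ {x z w} → OnC x z w → Pure z w → ∃ λ p → ∃ λ q → z ≡ vC p × w ≡ vC q × Joins (S.path x) p q
    own-C (pure j) cc = _ , _ , refl , refl , j
    own-D : ∀ {x z w} → OnD x z w → Pure z w → ∃ λ p → ∃ λ q → z ≡ vD p × w ≡ vD q × Joins (S.path x) p q
    own-D (pure j) dd = _ , _ , refl , refl , j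
    own-U : ∀ {x z w} → OnT x z w → Pure z w → ∃ λ p → ∃ λ q → z ≡ vU p × w ≡ vU q × Joins (SU.path x) p q
    own-U (pure j) uu = _ , _ , refl , refl , j

    un-A : ∀ {x p q} → OnA x (vA p) (vA q) → Joins (S.path x) p q
    un-A (pure j) = j
    un-B : ∀ {x p q} → OnB x (vB p) (vB q) → Joins (S.path x) p q
    un-B (pure j) = j
    un-C : ∀ {x p q} → OnC x (vC p) (vC q) → Joins (S.path x) p q
    un-C (pure j) = j
    un-D : ∀ {x p q} → OnD x (vD p) (vD q) → Joins (S.path x) p q
    un-D (pure j) = j
    un-U : ∀ {x p q} → OnT x (vU p) (vU q) → Joins (SU.path x) p q
    un-U (pure j) = j

    SamePair′ : V → V → V → V → Set
    SamePair′ u v z w = (u ≡ z × v ≡ w) ⊎ (u ≡ w × v ≡ z)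

    lift : ∀ {X : Set} (f : X → V) {p q r s} → (p ≡ r × q ≡ s) ⊎ (p ≡ s × q ≡ r) → SamePair′ (f p) (f q) (f r) (f s)
    lift f (inj₁ (e , e′)) = inj₁ (cong f e , cong f e′)
    lift f (inj₂ (e , e′)) = inj₂ (cong f e , cong f e′)

    pure-same : ∀ {u v z w} → Pure u v → u ≢ v → Pure z w → z ≢ w → Same u v z w → Same z w u v → SamePair′ u v z w
    pure-same aa ne P ne′ h h′ with S.covers (λ e → ne (cong vA e))
    ... | _ , j with own-A (sA h (pure j)) P
    ...   | _ , _ , refl , refl , _ = lift vA (S.separates (λ e → ne (cong vA e)) (λ e → ne′ (cong vA e))
              (λ i k → un-A (sA h (pure k))) (λ i k → un-A (sA h′ (pure k))))
    pure-same bb ne P ne′ h h′ with S.covers (λ e → ne (cong vB e))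
    ... | _ , j with own-B (sB h (pure j)) P
    ...   | _ , _ , refl , refl , _ = lift vB (S.separates (λ e → ne (cong vB e)) (λ e → ne′ (cong vB e))
              (λ i k → un-B (sB h (pure k))) (λ i k → un-B (sB h′ (pure k))))
    pure-same cc ne P ne′ h h′ with S.covers (λ e → ne (cong vC e))
    ... | _ , j with own-C (sC h (pure j)) P
    ...   | _ , _ , refl , refl , _ = lift vC (S.separates (λ e → ne (cong vC e)) (λ e → ne′ (cong vC e))
              (λ i k → un-C (sC h (pure k))) (λ i k → un-C (sC h′ (pure k))))
    pure-same dd ne P ne′ h h′ with S.covers (λ e → ne (cong vD e))
    ... | _ , j with own-D (sD h (pure j)) P
    ...   | _ , _ , refl , refl , _ = lift vD (S.separates (λ e → ne (cong vD e)) (λ e → ne′ (cong vD e))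
              (λ i k → un-D (sD h (pure k))) (λ i k → un-D (sD h′ (pure k))))
    pure-same uu ne P ne′ h h′ with SU.covers (λ e → ne (cong vU e))
    ... | _ , j with own-U (sU h refl refl j) P
    ...   | _ , _ , refl , refl , _ = lift vU (SU.separates (λ e → ne (cong vU e)) (λ e → ne′ (cong vU e))
              (λ i k → un-U (sU h refl refl k)) (λ i k → un-U (sU h′ refl refl k)))

    left-A : ∀ j {b c} → b ≡ slot ka kb (cut j - one) (emb j) → c ≡ slot ka kc (cut j) (emb j) → OnA (cut j) (vB b) (vC c)
    left-A j b c = bc (emb j) b c

    -- An edge zw on the same paths as the edge left by `j` would have to lie inside the part A and
    -- on the path `cut j` of `S` alone. That `cut j` is spare forbids this.
    left-pure : ∀ j {b c z w} → b ≡ slot ka kb (cut j - one) (emb j) → c ≡ slot ka kc (cut j) (emb j) →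
                Pure z w → z ≢ w → Same (vB b) (vC c) z w → Same z w (vB b) (vC c) → ⊥
    left-pure j eb ec P ne h h′ with own-A (sA h (left-A j eb ec)) P
    ... | _ , _ , refl , refl , _ = S.lonely (cut∈ j) (λ e → ne (cong vA e))
            λ i k → only-A (sA h′ (pure k)) (left-A j eb ec)

    -- One edge determined by its paths settles a case, whatever the other is. The kinds are
    -- consulted in the order `two`, `tee`, `left`, each time with the inclusion that starts from
    -- the edge of that kind.
    resolve : ∀ {u v z w} → Kind u v → Kind z w → Same u v z w → Same z w u v → SamePair′ u v z w
    resolve (two t) _ h _ = inj₁ (two-same t h)
    resolve (tee _) (two t) _ h′ = let (e , f) = two-same t h′ in inj₁ (sym e , sym f)
    resolve (left _ _ _) (two t) _ h′ = let (e , f) = two-same t h′ in inj₁ (sym e , sym f)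
    resolve (pure _ _) (two t) _ h′ = let (e , f) = two-same t h′ in inj₁ (sym e , sym f)
    resolve (tee t) (tee t′) h _ = inj₁ (tee-same t (not-UC (inj₁ t′)) h)
    resolve (tee t) (left _ _ _) h _ = inj₁ (tee-same t (not-UC (inj₂ (inj₂ (_ , _ , refl , refl)))) h)
    resolve (tee t) (pure P _) h _ = inj₁ (tee-same t (not-UC (inj₂ (inj₁ P))) h)
    resolve (left _ _ _) (tee t) _ h′ = let (e , f) = tee-same t (not-UC (inj₂ (inj₂ (_ , _ , refl , refl)))) h′ in inj₁ (sym e , sym f)
    resolve (pure P _) (tee t) _ h′ = let (e , f) = tee-same t (not-UC (inj₂ (inj₁ P))) h′ in inj₁ (sym e , sym f)
    resolve (left j b c) (left i b′ c′) h _ with cut-injective (only-A (sA h (left-A j b c)) (left-A i b′ c′))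
    ... | refl = inj₁ (cong vB (trans b (sym b′)) , cong vC (trans c (sym c′)))
    resolve (left j b c) (pure P ne) h h′ = ⊥-elim (left-pure j b c P ne h h′)
    resolve (pure P ne) (left j b c) h h′ = ⊥-elim (left-pure j b c P ne h′ h)
    resolve (pure P ne) (pure Q ne′) h h′ = pure-same P ne Q ne′ h h′

    -- All descriptions of edges name the ends in one fixed order of the parts. Hence the two
    -- directions of an edge can be confused only inside a part, where `Joins` is symmetric.
    data Oriented : V → V → Set where
      ab : ∀ {p q} → Oriented (vA p) (vB q)
      bc : ∀ {p q} → Oriented (vB p) (vC q)
      cd : ∀ {p q} → Oriented (vC p) (vD q)
      da : ∀ {p q} → Oriented (vD p) (vA q)
      ca : ∀ {p q} → Oriented (vC p) (vA q)
      bd : ∀ {p q} → Oriented (vB p) (vD q)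
      ua : ∀ {p q} → Oriented (vU p) (vA q)
      ub : ∀ {p q} → Oriented (vU p) (vB q)
      uc : ∀ {p q} → Oriented (vU p) (vC q)
      ud : ∀ {p q} → Oriented (vU p) (vD q)
      pure : ∀ {u v} → Pure u v → Oriented u v

    orient-A : ∀ {x u v} → OnA x u v → Oriented u v
    orient-A (bc _ _ _)     = bc
    orient-A (cd _ _ _ _ _) = cd
    orient-A (sc _ _ _)     = uc
    orient-A (sd _ _ _)     = ud
    orient-A (bd _ _ _)     = bd
    orient-A (da _ _)       = da
    orient-A (pure _)       = pure aa

    orient-B : ∀ {x u v} → OnB x u v → Oriented u v
    orient-B (cd _ _ _)     = cd
    orient-B (da _ _ _ _ _) = da
    orient-B (sd _ _ _)     = ud
    orient-B (sa _ _ _)     = ua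
    orient-B (ca _ _ _)     = ca
    orient-B (ab _ _)       = ab
    orient-B (pure _)       = pure bb

    orient-C : ∀ {x u v} → OnC x u v → Oriented u v
    orient-C (da _ _ _ _)   = da
    orient-C (ab _ _ _ _)   = ab
    orient-C (sa _ _ _)     = ua
    orient-C (sb _ _ _)     = ub
    orient-C (bd _ _ _)     = bd
    orient-C (cd _ _)       = cd
    orient-C (pure _)       = pure cc

    orient-D : ∀ {x u v} → OnD x u v → Oriented u v
    orient-D (ab _ _ _ _)   = ab
    orient-D (bc _ _ _ _)   = bc
    orient-D (sb _ _ _)     = ub
    orient-D (sc _ _ _)     = uc
    orient-D (ca _ _ _)     = ca
    orient-D (da _ _)       = da
    orient-D (pure _)       = pure dd

    orient-T : ∀ {x u v} → OnT x u v → Oriented u v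
    orient-T (cd _ _ _)   = cd
    orient-T (da _ _ _)   = da
    orient-T (ab _ _ _)   = ab
    orient-T (bc _ _ _ _) = bc
    orient-T link         = uc
    orient-T (pure _)     = pure uu

    orient : ∀ {u v} → Kind u v → Oriented u v
    orient (two (AB p _)) = orient-A p
    orient (two (AC p _)) = orient-A p
    orient (two (AD p _)) = orient-A p
    orient (two (BC p _)) = orient-B p
    orient (two (BD p _)) = orient-B p
    orient (two (CD p _)) = orient-C p
    orient (tee (A _ t _))  = orient-T t
    orient (tee (B _ t _))  = orient-T t
    orient (tee (C′ _ t _)) = orient-T t
    orient (tee (D _ t _))  = orient-T t
    orient (left _ _ _)   = bc
    orient (pure P _)     = pure P

    oriented-pure : ∀ {u v} → Oriented u v → Oriented v u → Pure u v
    oriented-pure (pure P)  _ = P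
    oriented-pure ab (pure ())
    oriented-pure bc (pure ())
    oriented-pure cd (pure ())
    oriented-pure da (pure ())
    oriented-pure ca (pure ())
    oriented-pure bd (pure ())
    oriented-pure ua (pure ())
    oriented-pure ub (pure ())
    oriented-pure uc (pure ())
    oriented-pure ud (pure ())

    turn-A : ∀ {x u v} → Oriented u v → Sym (OnA x) u v → OnA x u v
    turn-A o (inj₁ p) = p
    turn-A o (inj₂ p) with oriented-pure o (orient-A p)
    turn-A o (inj₂ (pure j)) | aa = pure (swap j)

    turn-B : ∀ {x u v} → Oriented u v → Sym (OnB x) u v → OnB x u v
    turn-B o (inj₁ p) = p
    turn-B o (inj₂ p) with oriented-pure o (orient-B p)
    turn-B o (inj₂ (pure j)) | bb = pure (swap j)

    turn-C : ∀ {x u v} → Oriented u v → Sym (OnC x) u v → OnC x u v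
    turn-C o (inj₁ p) = p
    turn-C o (inj₂ p) with oriented-pure o (orient-C p)
    turn-C o (inj₂ (pure j)) | cc = pure (swap j)

    turn-D : ∀ {x u v} → Oriented u v → Sym (OnD x) u v → OnD x u v
    turn-D o (inj₁ p) = p
    turn-D o (inj₂ p) with oriented-pure o (orient-D p)
    turn-D o (inj₂ (pure j)) | dd = pure (swap j)

    turn-T : ∀ {x u v} → Oriented u v → Sym (OnT x) u v → OnT x u v
    turn-T o (inj₁ p) = p
    turn-T o (inj₂ p) with oriented-pure o (orient-T p)
    turn-T o (inj₂ (pure j)) | uu = pure (swap j)

    -- The paths of slopes b and d start at height 1, where the lines through a point have different
    -- labels. Indexing these paths by their first vertices therefore takes a translation.
    labelB labelD endB endD : Z → Z
    labelB v = v + (kb * one - kd * one)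
    labelD v = v + (kd * one - kb * one)
    endB y = slot kb kd y one
    endD w = slot kd kb w one

    -- The slopes are permuted because a path starts at `g₂` of its opening height: the paths of
    -- lines of slopes a, b, c, d start at lines of slopes c, d, a, b.
    list : V → List V
    list (vC x) = PathA.list x
    list (vD v) = PathB.list (labelB v)
    list (vA z) = PathC.list z
    list (vB v) = PathD.list (labelD v)
    list (vU j) = PathT.list j

    rest : List V → List V
    rest []      = []
    rest (_ ∷ l) = l

    list-head : ∀ v → v ∷ rest (list v) ≡ list v
    list-head (vC x) = cong (λ y → vC y ∷ rest (PathA.list x)) (sym (slot-zer ka kc x))
    list-head (vD v) = cong (λ y → vD y ∷ rest (PathB.list (labelB v))) (sym (end-label kb kd v))
    list-head (vA z) = cong (λ y → vA y ∷ rest (PathC.list z)) (sym (slot-zer kc ka z))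
    list-head (vB v) = cong (λ y → vB y ∷ rest (PathD.list (labelD v))) (sym (end-label kd kb v))
    list-head (vU j) = refl

    list! : ∀ v → Unique (list v)
    list! (vC x) = PathA.list! x
    list! (vD v) = PathB.list! (labelB v)
    list! (vA z) = PathC.list! z
    list! (vB v) = PathD.list! (labelD v)
    list! (vU j) = PathT.list! j

    inA : ∀ {x u v} → OnA x u v → Joins (list (vC x)) u v
    inA {x} = PathA.complete x
    inB : ∀ {x u v} → OnB x u v → Joins (list (vD (endB x))) u v
    inB {x} p = subst (λ y → Joins (PathB.list y) _ _) (sym (label-end kb kd x)) (PathB.complete x p)
    inC : ∀ {x u v} → OnC x u v → Joins (list (vA x)) u v
    inC {x} = PathC.complete x
    inD : ∀ {x u v} → OnD x u v → Joins (list (vB (endD x))) u v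
    inD {x} p = subst (λ y → Joins (PathD.list y) _ _) (sym (label-end kd kb x)) (PathD.complete x p)

    atA : ∀ {P : V → Set} {x u v} → (∀ i → Joins (list i) u v → P i) → OnA x u v → P (vC x)
    atA {x = x} h p = h (vC x) (inA p)
    coverA : ∀ {x u v} → OnA x u v → ∃ λ i → Joins (list i) u v
    coverA {x} p = vC x , inA p
    atB : ∀ {P : V → Set} {x u v} → (∀ i → Joins (list i) u v → P i) → OnB x u v → P (vD (endB x))
    atB {x = x} h p = h (vD (endB x)) (inB p)
    coverB : ∀ {x u v} → OnB x u v → ∃ λ i → Joins (list i) u v
    coverB {x} p = vD (endB x) , inB p
    atC : ∀ {P : V → Set} {x u v} → (∀ i → Joins (list i) u v → P i) → OnC x u v → P (vA x)
    atC {x = x} h p = h (vA x) (inC p)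
    coverC : ∀ {x u v} → OnC x u v → ∃ λ i → Joins (list i) u v
    coverC {x} p = vA x , inC p
    atD : ∀ {P : V → Set} {x u v} → (∀ i → Joins (list i) u v → P i) → OnD x u v → P (vB (endD x))
    atD {x = x} h p = h (vB (endD x)) (inD p)
    coverD : ∀ {x u v} → OnD x u v → ∃ λ i → Joins (list i) u v
    coverD {x} p = vB (endD x) , inD p

    outB : ∀ {x u v} → Joins (list (vD (endB x))) u v → Sym (OnB x) u v
    outB {x} j = subst (λ y → Sym (OnB y) _ _) (label-end kb kd x) (PathB.sound _ j)
    outD : ∀ {x u v} → Joins (list (vB (endD x))) u v → Sym (OnD x) u v
    outD {x} j = subst (λ y → Sym (OnD y) _ _) (label-end kd kb x) (PathD.sound _ j)

    same : ∀ {u v z w} → Oriented z w → (∀ i → Joins (list i) u v → Joins (list i) z w) → Same u v z w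
    same o h = record
      { sA = λ p → turn-A o (PathA.sound _ (atA {P = λ i → Joins (list i) _ _} h p))
      ; sB = λ p → turn-B o (outB (atB {P = λ i → Joins (list i) _ _} h p))
      ; sC = λ p → turn-C o (PathC.sound _ (atC {P = λ i → Joins (list i) _ _} h p))
      ; sD = λ p → turn-D o (outD (atD {P = λ i → Joins (list i) _ _} h p))
      ; sT = λ {j} p n → turn-T o (PathT.sound j (h (vU j) (PathT.complete j p n)))
      ; sU = λ { {j} refl refl k → turn-T o (PathT.sound j (h (vU j) (PathT.complete j (pure k) λ { (_ , _ , _ , ()) }))) }
      }

    coverU : ∀ {p q : U} → vU {Z} p ≢ vU q → ∃ λ i → Joins (list (vU i)) (vU p) (vU q)
    coverU ne = let (i , j) = SU.covers (λ e → ne (cong vU e)) in i , PathT.complete i (pure j) λ { (_ , _ , _ , ()) }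

    covered : ∀ {u v} → Kind u v → ∃ λ i → Joins (list i) u v
    covered (two (AB p _))  = coverA p
    covered (two (AC p _))  = coverA p
    covered (two (AD p _))  = coverA p
    covered (two (BC p _))  = coverB p
    covered (two (BD p _))  = coverB p
    covered (two (CD p _))  = coverC p
    covered (tee (A p _ _))  = coverA p
    covered (tee (B p _ _))  = coverB p
    covered (tee (C′ p _ _)) = coverC p
    covered (tee (D p _ _))  = coverD p
    covered (left j b c)    = coverA (left-A j b c)
    covered (pure aa ne) = let (_ , j) = S.covers (λ e → ne (cong vA e)) in coverA (pure j)
    covered (pure bb ne) = let (_ , j) = S.covers (λ e → ne (cong vB e)) in coverB (pure j)
    covered (pure cc ne) = let (_ , j) = S.covers (λ e → ne (cong vC e)) in coverC (pure j)
    covered (pure dd ne) = let (_ , j) = S.covers (λ e → ne (cong vD e)) in coverD (pure j)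
    covered (pure uu ne) = let (i , j) = coverU ne in vU i , j

    data Part : Set where
      pA pB pC pD pU : Part

    part : V → Part
    part (vA _) = pA
    part (vB _) = pB
    part (vC _) = pC
    part (vD _) = pD
    part (vU _) = pU

    alone : ∀ {u v g} → Kind u v → (∀ i → Joins (list i) u v → i ≡ g) → Pure u v ⊎ part g ≡ pC
    alone (pure P _) h = inj₁ P
    alone (left j b c) h = inj₂ (cong part (sym (atA h (left-A j b c))))
    alone (two (AB p q)) h with trans (atA h p) (sym (atB h q))
    ... | ()
    alone (two (AC p q)) h with trans (atA h p) (sym (atC h q))
    ... | ()
    alone (two (AD p q)) h with trans (atA h p) (sym (atD h q))
    ... | ()
    alone (two (BC p q)) h with trans (atB h p) (sym (atC h q))
    ... | ()
    alone (two (BD p q)) h with trans (atB h p) (sym (atD h q))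
    ... | ()
    alone (two (CD p q)) h with trans (atC h p) (sym (atD h q))
    ... | ()
    alone (tee (A p t n)) h = inj₂ (cong part (sym (atA h p)))
    alone (tee (B {j = j} p t n)) h with trans (atB h p) (sym (h (vU j) (PathT.complete j t n)))
    ... | ()
    alone (tee (C′ {j = j} p t n)) h with trans (atC h p) (sym (h (vU j) (PathT.complete j t n)))
    ... | ()
    alone (tee (D {j = j} p t n)) h with trans (atD h p) (sym (h (vU j) (PathT.complete j t n)))
    ... | ()

    pure-part : ∀ {u v g} → Pure u v → u ≢ v → (∀ i → Joins (list i) u v → i ≡ g) →
                (∃ λ p → ∃ λ q → u ≡ vA p × v ≡ vA q × part g ≡ pC) ⊎
                (∃ λ p → ∃ λ q → u ≡ vB p × v ≡ vB q × part g ≡ pD) ⊎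
                (∃ λ p → ∃ λ q → u ≡ vC p × v ≡ vC q × part g ≡ pA) ⊎
                (∃ λ p → ∃ λ q → u ≡ vD p × v ≡ vD q × part g ≡ pB) ⊎ part g ≡ pU
    pure-part aa ne h = inj₁ (_ , _ , refl , refl , cong part (sym (atA h (pure (proj₂ (S.covers (λ e → ne (cong vA e))))))))
    pure-part bb ne h = inj₂ (inj₁ (_ , _ , refl , refl , cong part (sym (atB h (pure (proj₂ (S.covers (λ e → ne (cong vB e)))))))))
    pure-part cc ne h = inj₂ (inj₂ (inj₁ (_ , _ , refl , refl , cong part (sym (atC h (pure (proj₂ (S.covers (λ e → ne (cong vC e))))))))))
    pure-part dd ne h = inj₂ (inj₂ (inj₂ (inj₁ (_ , _ , refl , refl , cong part (sym (atD h (pure (proj₂ (S.covers (λ e → ne (cong vD e)))))))))))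
    pure-part uu ne h = inj₂ (inj₂ (inj₂ (inj₂ (cong part (sym (h (vU (proj₁ (coverU ne))) (proj₂ (coverU ne))))))))

    spareB spareC spareD : List V
    spareB = map (λ y → vD (endB y)) S.spare
    spareC = map vA S.spare
    spareD = map (λ y → vB (endD y)) S.spare

    unD : ∀ {x y : Z} → vD {Z} {U} x ≡ vD y → x ≡ y
    unD refl = refl
    unB : ∀ {x y : Z} → vB {Z} {U} x ≡ vB y → x ≡ y
    unB refl = refl
    unC : ∀ {x y : Z} → vA {Z} {U} x ≡ vA y → x ≡ y
    unC refl = refl

    endB-injective : ∀ {x y} → endB x ≡ endB y → x ≡ y
    endB-injective {x} {y} e = trans (sym (label-end kb kd x)) (trans (cong labelB e) (label-end kb kd y))
    endD-injective : ∀ {x y} → endD x ≡ endD y → x ≡ y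
    endD-injective {x} {y} e = trans (sym (label-end kd kb x)) (trans (cong labelD e) (label-end kd kb y))

    no-spare : ∀ {g u v} → g ∈ spareB ++ spareC ++ spareD → Kind u v → u ≢ v → ¬ (∀ i → Joins (list i) u v → i ≡ g)
    no-spare g∈ k ne h with ∈-++⁻ spareB g∈
    no-spare g∈ k ne h | inj₁ b with ∈-map⁻ (λ y → vD (endB y)) b
    ... | y , y∈ , refl with alone k h
    ...   | inj₁ P with pure-part P ne h
    ...     | inj₂ (inj₁ (p , q , refl , refl , _)) = S.lonely y∈ (λ e → ne (cong vB e)) λ i j → endB-injective (unD (atB h (pure j)))
    ...     | inj₁ (_ , _ , _ , _ , ())
    ...     | inj₂ (inj₂ (inj₁ (_ , _ , _ , _ , ())))
    ...     | inj₂ (inj₂ (inj₂ (inj₁ (_ , _ , _ , _ , ()))))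
    ...     | inj₂ (inj₂ (inj₂ (inj₂ ())))
    no-spare g∈ k ne h | inj₂ r with ∈-++⁻ spareC r
    no-spare g∈ k ne h | inj₂ r | inj₁ c with ∈-map⁻ vA c
    ... | y , y∈ , refl with alone k h
    ...   | inj₁ P with pure-part P ne h
    ...     | inj₂ (inj₂ (inj₁ (p , q , refl , refl , _))) = S.lonely y∈ (λ e → ne (cong vC e)) λ i j → unC (atC h (pure j))
    ...     | inj₁ (_ , _ , _ , _ , ())
    ...     | inj₂ (inj₁ (_ , _ , _ , _ , ()))
    ...     | inj₂ (inj₂ (inj₂ (inj₁ (_ , _ , _ , _ , ()))))
    ...     | inj₂ (inj₂ (inj₂ (inj₂ ())))
    no-spare g∈ k ne h | inj₂ r | inj₂ d with ∈-map⁻ (λ y → vB (endD y)) d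
    ... | y , y∈ , refl with alone k h
    ...   | inj₁ P with pure-part P ne h
    ...     | inj₂ (inj₂ (inj₂ (inj₁ (p , q , refl , refl , _)))) = S.lonely y∈ (λ e → ne (cong vD e)) λ i j → endD-injective (unB (atD h (pure j)))
    ...     | inj₁ (_ , _ , _ , _ , ())
    ...     | inj₂ (inj₁ (_ , _ , _ , _ , ()))
    ...     | inj₂ (inj₂ (inj₁ (_ , _ , _ , _ , ())))
    ...     | inj₂ (inj₂ (inj₂ (inj₂ ())))

    to-list : ∀ i {u v} → Joins (i ∷ rest (list i)) u v → Joins (list i) u v
    to-list i = subst (λ l → Joins l _ _) (list-head i)
    from-list : ∀ i {u v} → Joins (list i) u v → Joins (i ∷ rest (list i)) u v
    from-list i = subst (λ l → Joins l _ _) (sym (list-head i))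

    composite : System V
    composite = record
      { tail      = λ v → rest (list v)
      ; simple    = λ v → subst Unique (sym (list-head v)) (list! v)
      ; covers    = λ {x} {y} ne → [ (λ k → let (i , j) = covered k in i , from-list i j)
                                   , (λ k → let (i , j) = covered k in i , from-list i (swap j)) ]′ (kind x y ne)
      ; separates = λ {x} {y} {z} {w} ne ne′ h h′ → decide ne ne′
                      (λ i j → to-list i (h i (from-list i j))) (λ i j → to-list i (h′ i (from-list i j)))
      ; spare     = spareB ++ spareC ++ spareD
      ; spare!    = Uniqueₚ.++⁺ (Uniqueₚ.map⁺ (λ e → endB-injective (unD e)) S.spare!)
                      (Uniqueₚ.++⁺ (Uniqueₚ.map⁺ unC S.spare!) (Uniqueₚ.map⁺ (λ e → endD-injective (unB e)) S.spare!) apartCD) apartB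
      ; lonely    = λ {g} {x} {y} g∈ ne h → [ (λ k → no-spare g∈ k ne (λ i j → h i (from-list i j)))
                                            , (λ k → no-spare g∈ k (λ e → ne (sym e)) (λ i j → h i (from-list i (swap j)))) ]′ (kind x y ne)
      }
      where
      apartCD : ∀ {v} → ¬ (v ∈ spareC × v ∈ spareD)
      apartCD (p , q) with ∈-map⁻ vA p
      ... | _ , _ , refl with ∈-map⁻ (λ y → vB (endD y)) q
      ...   | _ , _ , ()
      apartB : ∀ {v} → ¬ (v ∈ spareB × v ∈ spareC ++ spareD)
      apartB (p , q) with ∈-map⁻ (λ y → vD (endB y)) p
      ... | _ , _ , refl with ∈-++⁻ spareC q
      ...   | inj₁ r with ∈-map⁻ vA r
      ...     | _ , _ , ()
      apartB (p , q) | _ , _ , refl | inj₂ r with ∈-map⁻ (λ y → vB (endD y)) r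
      ...     | _ , _ , ()
      decide : ∀ {x y z w} → x ≢ y → z ≢ w → (∀ i → Joins (list i) x y → Joins (list i) z w) →
               (∀ i → Joins (list i) z w → Joins (list i) x y) → SamePair′ x y z w
      decide {x} {y} {z} {w} ne ne′ h h′ with kind x y ne | kind z w ne′
      ... | inj₁ k | inj₁ k′ = resolve k k′ (same (orient k′) h) (same (orient k) h′)
      ... | inj₁ k | inj₂ k′ = swap (resolve k k′ (same (orient k′) (λ i j → swap (h i j))) (same (orient k) (λ i j → h′ i (swap j))))
      ... | inj₂ k | inj₁ k′ = flip′ (resolve k k′ (same (orient k′) (λ i j → h i (swap j))) (same (orient k) (λ i j → swap (h′ i j))))
        where
        flip′ : SamePair′ y x z w → SamePair′ x y z w
        flip′ (inj₁ (e , f)) = inj₂ (f , e)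
        flip′ (inj₂ (e , f)) = inj₁ (f , e)
      ... | inj₂ k | inj₂ k′ = turn (resolve k k′ (same (orient k′) (λ i j → swap (h i (swap j)))) (same (orient k) (λ i j → swap (h′ i (swap j)))))
        where
        turn : SamePair′ y x w z → SamePair′ x y z w
        turn (inj₁ (e , f)) = inj₁ (f , e)
        turn (inj₂ (e , f)) = inj₂ (f , e)

-- Integers modulo m, with slopes and heights

module Residue where

  open Systems
  open Cyclic
  open Construction using (Slopes; Gaps)
  open import Data.Fin using (Fin; toℕ; fromℕ<; zero; suc)
  open import Data.Integer using (ℤ; +_)
  open import Data.Integer.DivMod using (_%ℕ_; _/ℕ_; a≡a%ℕn+[a/ℕn]*n; n%ℕd<d)
  open import Data.Integer.Tactic.RingSolver using (solve-∀)
  open import Data.Nat as ℕ using (ℕ; suc; zero; _<_; _≤_; s≤s; z≤n)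

  module Modular (N : ℕ) where

    m : ℕ
    m = suc N

    infix 4 _≈_
    data _≈_ (a b : ℤ) : Set where
      by : ∀ k → a ≡ b ℤ.+ k ℤ.* + m → a ≈ b

    ≈-sym : ∀ {a b} → a ≈ b → b ≈ a
    ≈-sym {a} {b} (by k refl) = by (ℤ.- k) (lemma b k (+ m))
      where
      lemma : ∀ b k n → b ≡ (b ℤ.+ k ℤ.* n) ℤ.+ (ℤ.- k) ℤ.* n
      lemma = solve-∀

    ≈-trans : ∀ {a b c} → a ≈ b → b ≈ c → a ≈ c
    ≈-trans {c = c} (by k refl) (by l refl) = by (l ℤ.+ k) (lemma c k l (+ m))
      where
      lemma : ∀ c k l n → (c ℤ.+ l ℤ.* n) ℤ.+ k ℤ.* n ≡ c ℤ.+ (l ℤ.+ k) ℤ.* n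
      lemma = solve-∀

    ≈-reflexive : ∀ {a b} → a ≡ b → a ≈ b
    ≈-reflexive {a} refl = by (+ 0) (lemma a (+ m))
      where
      lemma : ∀ a n → a ≡ a ℤ.+ + 0 ℤ.* n
      lemma = solve-∀

    ≈-+ : ∀ {a b c d} → a ≈ b → c ≈ d → a ℤ.+ c ≈ b ℤ.+ d
    ≈-+ {b = b} {d = d} (by k refl) (by l refl) = by (k ℤ.+ l) (lemma b d k l (+ m))
      where
      lemma : ∀ b d k l n → (b ℤ.+ k ℤ.* n) ℤ.+ (d ℤ.+ l ℤ.* n) ≡ (b ℤ.+ d) ℤ.+ (k ℤ.+ l) ℤ.* n
      lemma = solve-∀

    ≈-* : ∀ {a b c d} → a ≈ b → c ≈ d → a ℤ.* c ≈ b ℤ.* d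
    ≈-* {b = b} {d = d} (by k refl) (by l refl) = by (k ℤ.* d ℤ.+ b ℤ.* l ℤ.+ k ℤ.* (+ m) ℤ.* l) (lemma b d k l (+ m))
      where
      lemma : ∀ b d k l n → (b ℤ.+ k ℤ.* n) ℤ.* (d ℤ.+ l ℤ.* n) ≡ b ℤ.* d ℤ.+ (k ℤ.* d ℤ.+ b ℤ.* l ℤ.+ k ℤ.* n ℤ.* l) ℤ.* n
      lemma = solve-∀

    ≈-neg : ∀ {a b} → a ≈ b → ℤ.- a ≈ ℤ.- b
    ≈-neg {b = b} (by k refl) = by (ℤ.- k) (lemma b k (+ m))
      where
      lemma : ∀ b k n → ℤ.- (b ℤ.+ k ℤ.* n) ≡ ℤ.- b ℤ.+ (ℤ.- k) ℤ.* n
      lemma = solve-∀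

    -- The difference of `i` and `j` is a multiple of `m` whose absolute value is less than `m`.
    residue-unique : ∀ {i j} → i < m → j < m → + i ≈ + j → i ≡ j
    residue-unique {i} {j} i<m j<m (by k e) = ℤₚ.+-injective (trans e (trans (cong (λ k → + j ℤ.+ k ℤ.* + m) k≡0) (lemma (+ j) (+ m))))
      where
      lemma : ∀ j n → j ℤ.+ + 0 ℤ.* n ≡ j
      lemma = solve-∀
      diff : i ℤ.⊖ j ≡ k ℤ.* + m
      diff = trans (sym (ℤₚ.m-n≡m⊖n i j)) (trans (cong (λ x → x ℤ.- (+ j)) e) (lem (+ j) (k ℤ.* + m)))
        where
        lem : ∀ j x → (j ℤ.+ x) ℤ.- j ≡ x
        lem = solve-∀
      small : ℤ.∣ k ∣ ℕ.* m < m
      small = subst (_< m) (trans (cong ℤ.∣_∣ diff) (ℤₚ.abs-* k (+ m)))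
        (ℕₚ.≤-<-trans (ℤₚ.∣m⊝n∣≤m⊔n i j) (ℕₚ.⊔-lub i<m j<m))
      zero-of : ∀ n → n ℕ.* m < m → n ≡ 0
      zero-of zero    _ = refl
      zero-of (suc n) p = contradiction (ℕₚ.≤-trans p (ℕₚ.m≤m+n m (n ℕ.* m))) (ℕₚ.<-irrefl refl)
      k≡0 : k ≡ + 0
      k≡0 = ℤₚ.∣i∣≡0⇒i≡0 (zero-of ℤ.∣ k ∣ small)

    Z : Set
    Z = Fin m

    ι : Z → ℤ
    ι z = + toℕ z

    π : ℤ → Z
    π a = fromℕ< (n%ℕd<d a m)

    ι-π : ∀ a → ι (π a) ≈ a
    ι-π a = ≈-sym (by (a /ℕ m) (trans (a≡a%ℕn+[a/ℕn]*n a m) (cong (λ r → + r ℤ.+ (a /ℕ m) ℤ.* + m) (sym (toℕ-fromℕ< (n%ℕd<d a m))))))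

    π-cong : ∀ {a b} → a ≈ b → π a ≡ π b
    π-cong {a} {b} e = toℕ-injective (residue-unique (toℕ<n (π a)) (toℕ<n (π b)) (≈-trans (ι-π a) (≈-trans e (≈-sym (ι-π b)))))

    π-injective : ∀ {a b} → π a ≡ π b → a ≈ b
    π-injective {a} {b} e = ≈-trans (≈-sym (ι-π a)) (≈-trans (≈-reflexive (cong ι e)) (ι-π b))

    π-ι : ∀ z → π (ι z) ≡ z
    π-ι z = toℕ-injective (residue-unique (toℕ<n (π (ι z))) (toℕ<n z) (ι-π (ι z)))

    infixl 6 _+_
    infixl 7 _*_
    _+_ _*_ : Z → Z → Z
    x + y = π (ι x ℤ.+ ι y)
    x * y = π (ι x ℤ.* ι y)
    -_ : Z → Z
    - x = π (ℤ.- ι x)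

    π-+ : ∀ a b → π (a ℤ.+ b) ≡ π a + π b
    π-+ a b = π-cong (≈-sym (≈-+ (ι-π a) (ι-π b)))
    π-* : ∀ a b → π (a ℤ.* b) ≡ π a * π b
    π-* a b = π-cong (≈-sym (≈-* (ι-π a) (ι-π b)))
    π-neg : ∀ a → π (ℤ.- a) ≡ - π a
    π-neg a = π-cong (≈-sym (≈-neg (ι-π a)))

    isCommutativeRing : IsCommutativeRing _≡_ _+_ _*_ -_ (π (+ 0)) (π (+ 1))
    isCommutativeRing = record
      { isRing = record
        { +-isAbelianGroup = record
          { isGroup = record
            { isMonoid = record
              { isSemigroup = record
                { isMagma = record
                  { isEquivalence = isEquivalence
                  ; ∙-cong = cong₂ _+_ }
                ; assoc = λ x y z → π-cong (≈-trans (≈-+ (ι-π (ι x ℤ.+ ι y)) (≈-reflexive {ι z} refl))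
                    (≈-trans (≈-reflexive (ℤₚ.+-assoc (ι x) (ι y) (ι z))) (≈-+ (≈-reflexive {ι x} refl) (≈-sym (ι-π (ι y ℤ.+ ι z)))))) }
              ; identity = (λ x → trans (π-cong (≈-trans (≈-+ (ι-π (+ 0)) (≈-reflexive {ι x} refl)) (≈-reflexive (ℤₚ.+-identityˡ (ι x))))) (π-ι x))
                         , (λ x → trans (π-cong (≈-trans (≈-+ (≈-reflexive {ι x} refl) (ι-π (+ 0))) (≈-reflexive (ℤₚ.+-identityʳ (ι x))))) (π-ι x)) }
            ; inverse = (λ x → π-cong (≈-trans (≈-+ (ι-π (ℤ.- ι x)) (≈-reflexive {ι x} refl)) (≈-reflexive (ℤₚ.+-inverseˡ (ι x)))))
                      , (λ x → π-cong (≈-trans (≈-+ (≈-reflexive {ι x} refl) (ι-π (ℤ.- ι x))) (≈-reflexive (ℤₚ.+-inverseʳ (ι x)))))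
            ; ⁻¹-cong = cong -_ }
          ; comm = λ x y → cong π (ℤₚ.+-comm (ι x) (ι y)) }
        ; *-cong = cong₂ _*_
        ; *-assoc = λ x y z → π-cong (≈-trans (≈-* (ι-π (ι x ℤ.* ι y)) (≈-reflexive {ι z} refl))
            (≈-trans (≈-reflexive (ℤₚ.*-assoc (ι x) (ι y) (ι z))) (≈-* (≈-reflexive {ι x} refl) (≈-sym (ι-π (ι y ℤ.* ι z))))))
        ; *-identity = (λ x → trans (π-cong (≈-trans (≈-* (ι-π (+ 1)) (≈-reflexive {ι x} refl)) (≈-reflexive (ℤₚ.*-identityˡ (ι x))))) (π-ι x))
                     , (λ x → trans (π-cong (≈-trans (≈-* (≈-reflexive {ι x} refl) (ι-π (+ 1))) (≈-reflexive (ℤₚ.*-identityʳ (ι x))))) (π-ι x))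
        ; distrib = (λ x y z → π-cong (≈-trans (≈-* (≈-reflexive {ι x} refl) (ι-π (ι y ℤ.+ ι z)))
                      (≈-trans (≈-reflexive (ℤₚ.*-distribˡ-+ (ι x) (ι y) (ι z))) (≈-sym (≈-+ (ι-π (ι x ℤ.* ι y)) (ι-π (ι x ℤ.* ι z)))))))
                  , (λ x y z → π-cong (≈-trans (≈-* (ι-π (ι y ℤ.+ ι z)) (≈-reflexive {ι x} refl))
                      (≈-trans (≈-reflexive (ℤₚ.*-distribʳ-+ (ι x) (ι y) (ι z))) (≈-sym (≈-+ (ι-π (ι y ℤ.* ι x)) (ι-π (ι z ℤ.* ι x))))))) }
      ; *-comm = λ x y → cong π (ℤₚ.*-comm (ι x) (ι y)) }

    open Orbit (λ κ → κ + π (+ 1))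

    next-π : ∀ a → π a + π (+ 1) ≡ π (a ℤ.+ + 1)
    next-π a = sym (π-+ a (+ 1))

    later : ∀ a i → (a ℤ.+ + 1) ℤ.+ + i ≡ a ℤ.+ + suc i
    later a i = ℤₚ.+-assoc a (+ 1) (+ i)

    shift-π : ∀ n a → shift n (π a) ≡ π (a ℤ.+ + n)
    shift-π zero    a = cong π (sym (ℤₚ.+-identityʳ a))
    shift-π (suc n) a = trans (cong (shift n) (next-π a)) (trans (shift-π n (a ℤ.+ + 1)) (cong π (later a n)))

    orbit⁺ : ∀ n a {i} → i < n → π (a ℤ.+ + i) ∈ orbit n (π a)
    orbit⁺ (suc n) a {zero}  _         = here (cong π (ℤₚ.+-identityʳ a))
    orbit⁺ (suc n) a {suc i} (s≤s i<n) = there (subst (_ ∈_) (cong (orbit n) (sym (next-π a)))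
      (subst (λ x → π x ∈ orbit n (π (a ℤ.+ + 1))) (later a i) (orbit⁺ n (a ℤ.+ + 1) i<n)))

    orbit⁻ : ∀ n a {z} → z ∈ orbit n (π a) → ∃ λ i → i < n × z ≡ π (a ℤ.+ + i)
    orbit⁻ (suc n) a (here refl) = 0 , s≤s z≤n , cong π (sym (ℤₚ.+-identityʳ a))
    orbit⁻ (suc n) a {z} (there q) with orbit⁻ n (a ℤ.+ + 1) (subst (λ κ → z ∈ orbit n κ) (next-π a) q)
    ... | i , i<n , e = suc i , s≤s i<n , trans e (cong π (later a i))

    orbit! : ∀ n a → n ≤ m → Unique (orbit n (π a))
    orbit! zero    a _   = []
    orbit! (suc n) a n<m = All.tabulate fresh ∷ subst (λ κ → Unique (orbit n κ)) (sym (next-π a)) (orbit! n (a ℤ.+ + 1) (ℕₚ.<⇒≤ n<m))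
      where
      fresh : ∀ {z} → z ∈ orbit n (π a + π (+ 1)) → π a ≢ z
      fresh {z} q e with orbit⁻ n (a ℤ.+ + 1) (subst (λ κ → z ∈ orbit n κ) (next-π a) q)
      ... | i , i<n , e′ with residue-unique {0} {suc i} (s≤s z≤n) (ℕₚ.≤-<-trans i<n n<m)
                              (≈-trans (≈-reflexive (lem₁ a)) (≈-trans (≈-+ (≈-reflexive {ℤ.- a} refl) (π-injective (trans e e′))) (≈-reflexive (trans (cong (λ x → (ℤ.- a) ℤ.+ x) (later a i)) (lem₂ a (+ suc i))))))
        where
        lem₁ : ∀ a → + 0 ≡ ℤ.- a ℤ.+ a
        lem₁ = solve-∀
        lem₂ : ∀ a i → ℤ.- a ℤ.+ (a ℤ.+ i) ≡ i
        lem₂ = solve-∀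
      ... | ()

    residues : Residues
    residues = record
      { Z = Z ; _+_ = _+_ ; _*_ = _*_ ; -_ = -_ ; 0# = π (+ 0) ; 1# = π (+ 1)
      ; isCommutativeRing = isCommutativeRing
      ; reduce = record { ⟦_⟧ = π ; +-homo = π-+ ; *-homo = π-* ; -‿homo = π-neg ; 0-homo = refl ; 1-homo = refl }
      ; _≟_ = Fin._≟_
      ; N = N
      ; full = λ κ λ′ → subst (λ κ → λ′ ∈ orbit m κ) (π-ι κ) (subst (_∈ orbit m (π (ι κ))) (reach κ λ′)
                 (orbit⁺ m (ι κ) (n%ℕd<d (ι λ′ ℤ.- ι κ) m)))
      ; distinct = λ κ → subst (λ κ → Unique (orbit m κ)) (π-ι κ) (orbit! m (ι κ) ℕₚ.≤-refl)
      ; period = λ κ → trans (cong (λ κ → shift N κ + π (+ 1)) (sym (π-ι κ))) (trans (cong (_+ π (+ 1)) (shift-π N (ι κ)))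
                 (trans (next-π (ι κ ℤ.+ + N)) (trans (π-cong {b = ι κ} (by (+ 1) (lem (ι κ) (+ N)))) (π-ι κ))))
      }
      where
      lem : ∀ k n → (k ℤ.+ n) ℤ.+ + 1 ≡ k ℤ.+ + 1 ℤ.* (+ 1 ℤ.+ n)
      lem = solve-∀
      reach : ∀ κ λ′ → π (ι κ ℤ.+ + ((ι λ′ ℤ.- ι κ) %ℕ m)) ≡ λ′
      reach κ λ′ = trans (π-cong {b = ι λ′} (by (ℤ.- ((ι λ′ ℤ.- ι κ) /ℕ m)) (goal (ι κ) (ι λ′) (+ ((ι λ′ ℤ.- ι κ) %ℕ m)) ((ι λ′ ℤ.- ι κ) /ℕ m) (+ m) (a≡a%ℕn+[a/ℕn]*n (ι λ′ ℤ.- ι κ) m)))) (π-ι λ′)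
        where
        goal : ∀ k l r q n → l ℤ.- k ≡ r ℤ.+ q ℤ.* n → k ℤ.+ r ≡ l ℤ.+ (ℤ.- q) ℤ.* n
        goal k l r q n e = trans (lem₁ k r (q ℤ.* n)) (trans (cong (λ x → k ℤ.+ x ℤ.- q ℤ.* n) (sym e)) (lem₂ k l q n))
          where
          lem₁ : ∀ k r x → k ℤ.+ r ≡ k ℤ.+ (r ℤ.+ x) ℤ.- x
          lem₁ = solve-∀
          lem₂ : ∀ k l q n → k ℤ.+ (l ℤ.- k) ℤ.- q ℤ.* n ≡ l ℤ.+ (ℤ.- q) ℤ.* n
          lem₂ = solve-∀

    -- The slopes 0, 1, -1, 2 have differences ±1, ±2, ±3.
    slopes : ∀ h t → + 2 ℤ.* h ≈ + 1 → + 3 ℤ.* t ≈ + 1 → 1 < m → Slopes residues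
    slopes h t 2h 3t 1<m = record
      { ka = π (+ 0) ; kb = π (+ 1) ; kc = π (ℤ.- + 1) ; kd = π (+ 2)
      ; ιab = π (+ 1) ; ιac = π (ℤ.- + 1) ; ιad = π h ; ιbc = π (ℤ.- h) ; ιbd = π (+ 1) ; ιcd = π t
      ; invab = inv (+ 1) (+ 0) (+ 1) (≈-reflexive refl)
      ; invac = inv (ℤ.- + 1) (+ 0) (ℤ.- + 1) (≈-reflexive refl)
      ; invad = inv (+ 2) (+ 0) h 2h
      ; invbc = inv (ℤ.- + 1) (+ 1) (ℤ.- h) (≈-trans (≈-reflexive (lem h)) 2h)
      ; invbd = inv (+ 2) (+ 1) (+ 1) (≈-reflexive refl)
      ; invcd = inv (+ 2) (ℤ.- + 1) t 3t
      ; zer≢one = λ e → contradiction (residue-unique {0} {1} (s≤s z≤n) 1<m (π-injective e)) λ ()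
      }
      where
      inv : ∀ a b c → (a ℤ.- b) ℤ.* c ≈ + 1 → (π a + - π b) * π c ≡ π (+ 1)
      inv a b c e = trans (cong (_* π c) (trans (cong (λ x → π a + x) (sym (π-neg b))) (sym (π-+ a (ℤ.- b))))) (trans (sym (π-* (a ℤ.- b) c)) (π-cong e))
      lem : ∀ h → (ℤ.- + 1 ℤ.- + 1) ℤ.* (ℤ.- h) ≡ + 2 ℤ.* h
      lem = solve-∀

    gaps : ∀ u → 2 ℕ.+ u ≤ m → Gaps residues (Fin u)
    gaps u 2+u≤m = record
      { gap = λ κ → gap (toℕ κ) ; emb = emb
      ; gap-emb = λ j → trans (cong gap (toℕ-fromℕ< (bound j))) (gap-toℕ j)
      ; emb-gap = λ {κ} {j} e → toℕ-injective (trans (gap⁻ (toℕ κ) e) (sym (toℕ-fromℕ< (bound j))))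
      ; gap-zer = cong gap (toℕ-fromℕ< (n%ℕd<d (+ 0) m))
      ; gap-one = cong gap (toℕ≡ 1 (ℕₚ.≤-trans (s≤s (s≤s z≤n)) 2+u≤m))
      }
      where
      toℕ≡ : ∀ i → i < m → toℕ (π (+ i)) ≡ i
      toℕ≡ i i<m = residue-unique (toℕ<n (π (+ i))) i<m (ι-π (+ i))
      gap : ℕ → Maybe (Fin u)
      gap (suc (suc i)) with i ℕₚ.<? u
      ... | yes i<u = just (fromℕ< i<u)
      ... | no  _   = nothing
      gap _ = nothing
      bound : ∀ (j : Fin u) → 2 ℕ.+ toℕ j < m
      bound j = ℕₚ.≤-trans (s≤s (s≤s (toℕ<n j))) 2+u≤m
      emb : Fin u → Z
      emb j = fromℕ< (bound j)
      gap-toℕ : ∀ j → gap (2 ℕ.+ toℕ j) ≡ just j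
      gap-toℕ j with toℕ j ℕₚ.<? u
      ... | yes p = cong just (fromℕ<-toℕ j p)
      ... | no  n = contradiction (toℕ<n j) n
      gap⁻ : ∀ i {j} → gap i ≡ just j → i ≡ 2 ℕ.+ toℕ j
      gap⁻ (suc (suc i)) e with i ℕₚ.<? u
      gap⁻ (suc (suc i)) refl | yes p = cong (2 ℕ.+_) (sym (toℕ-fromℕ< p))

-- Checking explicit systems by evaluation

module Verification where

  open Systems
  open import Data.Bool using (Bool; true; false; _∧_; _∨_; not; if_then_else_; T)
  open import Data.Fin using (Fin; toℕ)
  open import Data.Nat using (ℕ; zero; suc; _*_; _<_; _≡ᵇ_; _<ᵇ_; s≤s)
  open import Data.Nat.DivMod using (_mod_; m<n⇒m%n≡m)
  open import Data.Nat.Properties using (≡ᵇ⇒≡; ≡⇒≡ᵇ; <ᵇ⇒<; m<1+n⇒m<n∨m≡n; <-cmp)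

  ∧⁻ : ∀ a {b} → a ∧ b ≡ true → a ≡ true × b ≡ true
  ∧⁻ true e = refl , e

  ∨⁻ : ∀ {a b} → a ∨ b ≡ true → a ≡ true ⊎ b ≡ true
  ∨⁻ {true}  e = inj₁ refl
  ∨⁻ {false} e = inj₂ e

  ∨⁺ : ∀ {a b} → a ≡ true ⊎ b ≡ true → a ∨ b ≡ true
  ∨⁺ {true}  _          = refl
  ∨⁺ {false} (inj₂ e)   = e

  agree : ∀ {a b} → (a ≡ true → b ≡ true) → (b ≡ true → a ≡ true) → a ≡ b
  agree {true}  {b}     f g = sym (f refl)
  agree {false} {true}  f g = g refl
  agree {false} {false} f g = refl

  ≡ᵇ⁻ : ∀ {x y} → (x ≡ᵇ y) ≡ true → x ≡ y
  ≡ᵇ⁻ {x} {y} e = ≡ᵇ⇒≡ x y (subst T (sym e) tt)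

  ≡ᵇ⁺ : ∀ {x y} → x ≡ y → (x ≡ᵇ y) ≡ true
  ≡ᵇ⁺ {x} {y} e = Equivalence.to T-≡ (≡⇒≡ᵇ x y e)

  ≢ᵇ⁻ : ∀ {x y} → not (x ≡ᵇ y) ≡ true → x ≢ y
  ≢ᵇ⁻ {x} e refl = contradiction (trans (cong not (sym (≡ᵇ⁺ {x} refl))) e) λ ()

  allᵇ : {A : Set} → (A → Bool) → List A → Bool
  allᵇ f []      = true
  allᵇ f (x ∷ l) = f x ∧ allᵇ f l

  allᵇ⁻ : ∀ {A : Set} (f : A → Bool) l → allᵇ f l ≡ true → All (λ x → f x ≡ true) l
  allᵇ⁻ f []      e = []
  allᵇ⁻ f (x ∷ l) e = proj₁ (∧⁻ (f x) e) ∷ allᵇ⁻ f l (proj₂ (∧⁻ (f x) e))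

  anyᵇ : {A : Set} → (A → Bool) → List A → Bool
  anyᵇ f []      = false
  anyᵇ f (x ∷ l) = f x ∨ anyᵇ f l

  uniqueᵇ : List ℕ → Bool
  uniqueᵇ []      = true
  uniqueᵇ (x ∷ l) = allᵇ (λ y → not (x ≡ᵇ y)) l ∧ uniqueᵇ l

  uniqueᵇ⁻ : ∀ l → uniqueᵇ l ≡ true → Unique l
  uniqueᵇ⁻ []      e = []
  uniqueᵇ⁻ (x ∷ l) e = All.map ≢ᵇ⁻ (allᵇ⁻ fresh l (proj₁ (∧⁻ (allᵇ fresh l) e))) ∷ uniqueᵇ⁻ l (proj₂ (∧⁻ (allᵇ fresh l) e))
    where
    fresh : ℕ → Bool
    fresh y = not (x ≡ᵇ y)

  below : ℕ → (ℕ → Bool) → Bool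
  below zero    f = true
  below (suc n) f = f n ∧ below n f

  below⁻ : ∀ n f {i} → below n f ≡ true → i < n → f i ≡ true
  below⁻ (suc n) f e i<n with m<1+n⇒m<n∨m≡n i<n
  ... | inj₁ i<  = below⁻ n f (proj₂ (∧⁻ (f n) e)) i<
  ... | inj₂ refl = proj₁ (∧⁻ (f n) e)

  _!_ : {A : Set} → List (List A) → ℕ → List A
  []      ! _     = []
  (x ∷ l) ! zero  = x
  (x ∷ l) ! suc i = l ! i

  !-applyUpTo : ∀ {A : Set} (f : ℕ → List A) {n i} → i < n → applyUpTo f n ! i ≡ f i
  !-applyUpTo f {suc n} {zero}  _         = refl
  !-applyUpTo f {suc n} {suc i} (s≤s i<n) = !-applyUpTo (λ x → f (suc x)) i<n

  -- The successor is increased by one so that 0 can mean that there is none.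
  after : List ℕ → ℕ → ℕ
  after (a ∷ b ∷ l) x = if a ≡ᵇ x then suc b else after (b ∷ l) x
  after _           x = 0

  after⁻ : ∀ l {x y} → after l x ≡ suc y → Step x y l
  after⁻ (a ∷ b ∷ l) {x} {y} e with after⁻ (b ∷ l) {x} {y} | a ≡ᵇ x in q
  ... | rec | false = there (rec e)
  ... | _   | true  with ≡ᵇ⁻ {a} q | e
  ...   | refl | refl = here

  after⁺ : ∀ {l x y} → Unique l → Step x y l → after l x ≡ suc y
  after⁺ {a ∷ b ∷ l} u here rewrite ≡ᵇ⁺ {a} refl = refl
  after⁺ {a ∷ b ∷ l} {x} (a∉ ∷ u) (there s) with a ≡ᵇ x in q
  ... | false = after⁺ u s
  ... | true  = contradiction (≡ᵇ⁻ {a} q) (All.lookup a∉ (step-∈ˡ s))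

  on : ℕ → ℕ → List ℕ → Bool
  on x y l = (after l x ≡ᵇ suc y) ∨ (after l y ≡ᵇ suc x)

  on⁻ : ∀ {x y} l → on x y l ≡ true → Joins l x y
  on⁻ {x} l e with ∨⁻ e
  ... | inj₁ q = inj₁ (after⁻ l (≡ᵇ⁻ q))
  ... | inj₂ q = inj₂ (after⁻ l (≡ᵇ⁻ q))

  on⁺ : ∀ {x y l} → Unique l → Joins l x y → on x y l ≡ true
  on⁺ u (inj₁ s) = ∨⁺ (inj₁ (≡ᵇ⁺ (after⁺ u s)))
  on⁺ u (inj₂ s) = ∨⁺ (inj₂ (≡ᵇ⁺ (after⁺ u s)))

  cons : Bool → ℕ → ℕ
  cons b s = if b then suc (2 * s) else 2 * s

  -- A set of paths as a binary number, so that two sets are compared by one comparison of numerals.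
  code : {A : Set} → (A → Bool) → List A → ℕ
  code f []      = 0
  code f (x ∷ l) = cons (f x) (code f l)

  code-cong : ∀ {A : Set} {f g : A → Bool} l → (∀ {x} → x ∈ l → f x ≡ g x) → code f l ≡ code g l
  code-cong []      h = refl
  code-cong (x ∷ l) h = cong₂ cons (h (here refl)) (code-cong l λ p → h (there p))

  code≢0 : ∀ {A : Set} (f : A → Bool) l → code f l ≢ 0 → ∃ λ x → x ∈ l × f x ≡ true
  code≢0 f []      h = contradiction refl h
  code≢0 f (x ∷ l) h with f x in q
  ... | true  = x , here refl , q
  ... | false with code≢0 f l (λ e → h (cong (2 *_) e))
  ...   | y , y∈ , e = y , there y∈ , e

  -- The number whose binary digits tell which paths use the edge xy, computed
  -- from the successors of x and of y along each of the paths.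
  sig : ℕ → ℕ → List ℕ → List ℕ → ℕ
  sig x′ y′ (a ∷ as) (b ∷ bs) = cons ((a ≡ᵇ y′) ∨ (b ≡ᵇ x′)) (sig x′ y′ as bs)
  sig x′ y′ _        _        = 0

  sig-code : ∀ x y ls → sig (suc x) (suc y) (map (λ l → after l x) ls) (map (λ l → after l y) ls) ≡ code (on x y) ls
  sig-code x y []       = refl
  sig-code x y (l ∷ ls) = cong (cons (on x y l)) (sig-code x y ls)

  sigᵗ : List (List ℕ) → ℕ → ℕ → ℕ
  sigᵗ rows x y = sig (suc x) (suc y) (rows ! x) (rows ! y)

  sigs : List (List ℕ) → List ℕ → List ℕ
  sigs rows (a ∷ b ∷ l) = sigᵗ rows a b ∷ sigs rows (b ∷ l)
  sigs rows _           = []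

  sigs⁺ : ∀ rows {x y l} → Step x y l → sigᵗ rows x y ∈ sigs rows l
  sigs⁺ rows {l = a ∷ b ∷ l} here      = here refl
  sigs⁺ rows {l = a ∷ b ∷ l} (there s) = there (sigs⁺ rows s)

  sigs-injective : ∀ rows {l x y z w} → Unique (sigs rows l) → Step x y l → Step z w l →
                   sigᵗ rows x y ≡ sigᵗ rows z w → x ≡ z × y ≡ w
  sigs-injective rows {a ∷ b ∷ l} u        here      here      e = refl , refl
  sigs-injective rows {a ∷ b ∷ l} (p ∷ u)  here      (there t) e = contradiction e (All.lookup p (sigs⁺ rows t))
  sigs-injective rows {a ∷ b ∷ l} (p ∷ u)  (there s) here      e = contradiction (sym e) (All.lookup p (sigs⁺ rows s))
  sigs-injective rows {a ∷ b ∷ l} (p ∷ u)  (there s) (there t) e = sigs-injective rows u s t e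

  startsᵇ : ℕ → List ℕ → Bool
  startsᵇ i []      = false
  startsᵇ i (x ∷ l) = x ≡ᵇ i

  startsᵇ⁻ : ∀ {i} l → startsᵇ i l ≡ true → l ≡ i ∷ drop 1 l
  startsᵇ⁻ (x ∷ l) e = cong (_∷ l) (≡ᵇ⁻ e)

  module Check (N : ℕ) (line : ℕ → List ℕ) (good : List ℕ) where

    n : ℕ
    n = suc N

    lines : List (List ℕ)
    lines = applyUpTo line n

    rowsOf : List (List ℕ) → List (List ℕ)
    rowsOf ls = applyUpTo (λ x → map (λ l → after l x) ls) n

    -- The code of the set consisting of the path from `g` alone, which no edge may have if `g` is
    -- to be spare.
    ind : ℕ → ℕ
    ind g = code (startsᵇ g) lines

    wellFormed : List ℕ → Bool
    wellFormed l = allᵇ (_<ᵇ n) l ∧ uniqueᵇ l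

    edgeOK : List ℕ → ℕ → Bool
    edgeOK inds s = not (s ≡ᵇ 0) ∧ allᵇ (λ t → not (s ≡ᵇ t)) inds

    -- Edges on the same paths share a path, because every edge is covered. It is thus enough to
    -- compare signatures along each path, instead of those of all pairs of edges.
    distinctOn : List (List ℕ) → List ℕ → Bool
    distinctOn rows l = uniqueᵇ (sigs rows l)

    edgesOK : List (List ℕ) → List ℕ → ℕ → Bool
    edgesOK rows inds y = below y (λ x → edgeOK inds (sigᵗ rows x y))

    -- The lines, the table of successors and the codes are passed as arguments so that evaluation
    -- shares them.
    tableOK : List (List ℕ) → List (List ℕ) → List ℕ → Bool
    tableOK ls rows inds = allᵇ (distinctOn rows) ls ∧ below n (edgesOK rows inds)

    linesOK : List (List ℕ) → Bool
    linesOK ls = allᵇ wellFormed ls ∧ tableOK ls (rowsOf ls) (map ind good)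

    startOK : ℕ → Bool
    startOK i = startsᵇ i (line i)

    check : Bool
    check = below n startOK ∧ wellFormed good ∧ linesOK lines

    module Sound (ok : check ≡ true) where

      rows : List (List ℕ)
      rows = rowsOf lines

      starts : ∀ {i} → i < n → line i ≡ i ∷ drop 1 (line i)
      starts {i} i<n = startsᵇ⁻ (line i) (below⁻ n startOK (proj₁ (∧⁻ (below n startOK) ok)) i<n)

      good! : wellFormed good ≡ true
      good! = proj₁ (∧⁻ (wellFormed good) (proj₂ (∧⁻ (below n startOK) ok)))

      linesOK! : linesOK lines ≡ true
      linesOK! = proj₂ (∧⁻ (wellFormed good) (proj₂ (∧⁻ (below n startOK) ok)))

      wf : ∀ {l} → l ∈ lines → wellFormed l ≡ true
      wf l∈ = All.lookup (allᵇ⁻ wellFormed lines (proj₁ (∧⁻ (allᵇ wellFormed lines) linesOK!))) l∈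

      bounded : ∀ {l} → wellFormed l ≡ true → ∀ {x} → x ∈ l → x < n
      bounded {l} e {x} x∈ = <ᵇ⇒< x n (Equivalence.from T-≡ (All.lookup (allᵇ⁻ (_<ᵇ n) l (proj₁ (∧⁻ (allᵇ (_<ᵇ n) l) e))) x∈))

      unique : ∀ {l} → wellFormed l ≡ true → Unique l
      unique {l} e = uniqueᵇ⁻ l (proj₂ (∧⁻ (allᵇ (_<ᵇ n) l) e))

      tableOK! : tableOK lines rows (map ind good) ≡ true
      tableOK! = proj₂ (∧⁻ (allᵇ wellFormed lines) linesOK!)

      edge : ∀ {x y} → x < y → y < n → edgeOK (map ind good) (sigᵗ rows x y) ≡ true
      edge {y = y} x<y y<n = below⁻ y (λ x → edgeOK (map ind good) (sigᵗ rows x y))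
        (below⁻ n (edgesOK rows (map ind good)) (proj₂ (∧⁻ (allᵇ (distinctOn rows) lines) tableOK!)) y<n) x<y

      sigᵗ-code : ∀ {x y} → x < n → y < n → sigᵗ rows x y ≡ code (on x y) lines
      sigᵗ-code {x} {y} x<n y<n = trans
        (cong₂ (sig (suc x) (suc y)) (!-applyUpTo (λ x → map (λ l → after l x) lines) x<n) (!-applyUpTo (λ x → map (λ l → after l x) lines) y<n))
        (sig-code x y lines)

      on-sym : ∀ x y l → on x y l ≡ on y x l
      on-sym x y l = ∨-comm (after l x ≡ᵇ suc y) (after l y ≡ᵇ suc x)

      edge′ : ∀ {x y} → x ≢ y → x < n → y < n → edgeOK (map ind good) (code (on x y) lines) ≡ true
      edge′ {x} {y} ne x<n y<n with <-cmp x y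
      ... | tri< x<y _ _ = subst (λ s → edgeOK (map ind good) s ≡ true) (sigᵗ-code x<n y<n) (edge x<y y<n)
      ... | tri≈ _ x≡y _ = contradiction x≡y ne
      ... | tri> _ _ y<x = subst (λ s → edgeOK (map ind good) s ≡ true)
        (trans (sigᵗ-code y<n x<n) (code-cong lines λ {l} _ → on-sym y x l)) (edge y<x x<n)

      -- Reduction modulo `n` makes this total, so lists are converted first and their bounds are
      -- invoked only where the conversion has to be undone.
      point : ℕ → Fin n
      point x = x mod n

      toℕ-point : ∀ {x} → x < n → toℕ (point x) ≡ x
      toℕ-point x<n = trans (toℕ-fromℕ< _) (m<n⇒m%n≡m x<n)

      point-toℕ : ∀ v → point (toℕ v) ≡ v
      point-toℕ v = toℕ-injective (toℕ-point (toℕ<n v))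

      line∈ : ∀ v → line (toℕ v) ∈ lines
      line∈ v = ∈-applyUpTo⁺ line (toℕ<n v)

      tail : Fin n → List (Fin n)
      tail v = map point (drop 1 (line (toℕ v)))

      path≡ : ∀ v → map point (line (toℕ v)) ≡ v ∷ tail v
      path≡ v = trans (cong (map point) (starts (toℕ<n v))) (cong (_∷ tail v) (point-toℕ v))

      map-point-unique : ∀ {l} → wellFormed l ≡ true → Unique (map point l)
      map-point-unique {l} e = AllPairs.map (λ ne e → ne (cong toℕ e)) (AllPairsₚ.map⁻ (subst Unique
        (sym (trans (sym (map-∘ l)) (map-id-local (All.tabulate λ x∈ → toℕ-point (bounded e x∈))))) (unique e)))

      step⁻ : ∀ {l u v} → wellFormed l ≡ true → Step u v (map point l) → Step (toℕ u) (toℕ v) l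
      step⁻ {l} e s with step-map⁻ point l s
      ... | x , y , t , refl , refl = subst₂ (λ x y → Step x y l)
        (sym (toℕ-point (bounded e (step-∈ˡ t)))) (sym (toℕ-point (bounded e (step-∈ʳ t)))) t

      step⁺ : ∀ {l u v} → Step (toℕ u) (toℕ v) l → Step u v (map point l)
      step⁺ {l} {u} {v} s = subst₂ (λ u v → Step u v (map point l)) (point-toℕ u) (point-toℕ v) (step-map⁺ point s)

      joins⁻ : ∀ i {u v} → Joins (i ∷ tail i) u v → Joins (line (toℕ i)) (toℕ u) (toℕ v)
      joins⁻ i j with subst (λ l → Joins l _ _) (sym (path≡ i)) j
      ... | inj₁ s = inj₁ (step⁻ (wf (line∈ i)) s)
      ... | inj₂ s = inj₂ (step⁻ (wf (line∈ i)) s)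

      joins⁺ : ∀ i {u v} → Joins (line (toℕ i)) (toℕ u) (toℕ v) → Joins (i ∷ tail i) u v
      joins⁺ i (inj₁ s) = subst (λ l → Joins l _ _) (path≡ i) (inj₁ (step⁺ s))
      joins⁺ i (inj₂ s) = subst (λ l → Joins l _ _) (path≡ i) (inj₂ (step⁺ s))

      index : ∀ {l} → l ∈ lines → ∃ λ v → l ≡ line (toℕ v)
      index l∈ with ∈-applyUpTo⁻ line l∈
      ... | i , i<n , refl = point i , cong line (sym (toℕ-point i<n))

      on-joins : ∀ i {u v} → on (toℕ u) (toℕ v) (line (toℕ i)) ≡ true → Joins (i ∷ tail i) u v
      on-joins i e = joins⁺ i (on⁻ (line (toℕ i)) e)

      joins-on : ∀ i {u v} → Joins (i ∷ tail i) u v → on (toℕ u) (toℕ v) (line (toℕ i)) ≡ true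
      joins-on i j = on⁺ (unique (wf (line∈ i))) (joins⁻ i j)

      covers : ∀ {x y} → x ≢ y → ∃ λ i → Joins (i ∷ tail i) x y
      covers {x} {y} ne with code≢0 (on (toℕ x) (toℕ y)) lines (≢ᵇ⁻ (proj₁ (∧⁻ (not (code (on (toℕ x) (toℕ y)) lines ≡ᵇ 0)) (edge′ (λ e → ne (toℕ-injective e)) (toℕ<n x) (toℕ<n y)))))
      ... | l , l∈ , o with index l∈
      ...   | i , refl = i , on-joins i o

      same-code : ∀ {x y z w} → (∀ i → Joins (i ∷ tail i) x y → Joins (i ∷ tail i) z w) →
                  (∀ i → Joins (i ∷ tail i) z w → Joins (i ∷ tail i) x y) →
                  code (on (toℕ x) (toℕ y)) lines ≡ code (on (toℕ z) (toℕ w)) lines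
      same-code h h′ = code-cong lines same
        where
        same : ∀ {l} → l ∈ lines → _
        same l∈ with index l∈
        ... | i , refl = agree (λ o → joins-on i (h i (on-joins i o))) (λ o → joins-on i (h′ i (on-joins i o)))

      match : ∀ {l x y z w} → l ∈ lines → Step x y l → Step z w l →
              code (on x y) lines ≡ code (on z w) lines → x ≡ z × y ≡ w
      match {l} l∈ s t e = sigs-injective rows
        (uniqueᵇ⁻ (sigs rows l) (All.lookup (allᵇ⁻ (distinctOn rows) lines (proj₁ (∧⁻ (allᵇ (distinctOn rows) lines) tableOK!))) l∈)) s t
        (trans (sigᵗ-code (b (step-∈ˡ s)) (b (step-∈ʳ s))) (trans e (sym (sigᵗ-code (b (step-∈ˡ t)) (b (step-∈ʳ t))))))
        where
        b : ∀ {x} → x ∈ l → x < n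
        b = bounded (wf l∈)

      turn : ∀ x y → code (on x y) lines ≡ code (on y x) lines
      turn x y = code-cong lines λ {l} _ → on-sym x y l

      separates : ∀ {x y z w} → x ≢ y → z ≢ w → (∀ i → Joins (i ∷ tail i) x y → Joins (i ∷ tail i) z w) →
                  (∀ i → Joins (i ∷ tail i) z w → Joins (i ∷ tail i) x y) → (x ≡ z × y ≡ w) ⊎ (x ≡ w × y ≡ z)
      separates {x} {y} {z} {w} ne _ h h′ with covers ne
      ... | i , j with joins⁻ i j | joins⁻ i (h i j)
      ...   | inj₁ s | inj₁ t = let e , f = match (line∈ i) s t (same-code h h′)
                                in inj₁ (toℕ-injective e , toℕ-injective f)
      ...   | inj₂ s | inj₂ t = let e , f = match (line∈ i) s t (trans (turn (toℕ y) (toℕ x)) (trans (same-code h h′) (turn (toℕ z) (toℕ w))))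
                                in inj₁ (toℕ-injective f , toℕ-injective e)
      ...   | inj₁ s | inj₂ t = let e , f = match (line∈ i) s t (trans (same-code h h′) (turn (toℕ z) (toℕ w)))
                                in inj₂ (toℕ-injective e , toℕ-injective f)
      ...   | inj₂ s | inj₁ t = let e , f = match (line∈ i) s t (trans (turn (toℕ y) (toℕ x)) (same-code h h′))
                                in inj₂ (toℕ-injective f , toℕ-injective e)

      -- Coverage gives some path through the edge, and by hypothesis it can only be path `g`. The
      -- code of the edge would then be that of the single path `g`, which the check has excluded.
      lonely : ∀ {g x y} → g ∈ map point good → x ≢ y → ¬ (∀ i → Joins (i ∷ tail i) x y → i ≡ g)
      lonely {g} {x} {y} g∈ ne h with ∈-map⁻ point g∈
      ... | k , k∈ , refl = ≢ᵇ⁻ (All.lookup (allᵇ⁻ (λ t → not (code (on (toℕ x) (toℕ y)) lines ≡ᵇ t)) (map ind good)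
            (proj₂ (∧⁻ (not (code (on (toℕ x) (toℕ y)) lines ≡ᵇ 0)) (edge′ (λ e → ne (toℕ-injective e)) (toℕ<n x) (toℕ<n y))))) (∈-map⁺ ind k∈))
          (code-cong lines only)
        where
        k<n : k < n
        k<n = bounded good! k∈
        head : ∀ {l} → l ≡ k ∷ drop 1 l → startsᵇ k l ≡ true
        head {a ∷ l} refl = ≡ᵇ⁺ {a} refl
        start : ∀ {i l} → l ≡ i ∷ drop 1 l → startsᵇ k l ≡ true → i ≡ k
        start {i} {a ∷ l} refl e = ≡ᵇ⁻ e
        only : ∀ {l} → l ∈ lines → on (toℕ x) (toℕ y) l ≡ startsᵇ k l
        only l∈ with index l∈ | covers ne
        ... | i , refl | i′ , j with h i′ j
        ...   | refl = agree
          (λ o → head (subst (λ a → line (toℕ i) ≡ a ∷ drop 1 (line (toℕ i)))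
                   (trans (cong toℕ (h i (on-joins i o))) (toℕ-point k<n)) (starts (toℕ<n i))))
          (λ e → subst (λ v → on (toℕ x) (toℕ y) (line (toℕ v)) ≡ true)
                   (toℕ-injective (trans (toℕ-point k<n) (sym (start (starts (toℕ<n i)) e)))) (joins-on (point k) j))

      system : System (Fin n)
      system = record
        { tail = tail
        ; simple = λ v → subst Unique (path≡ v) (map-point-unique (wf (line∈ v)))
        ; covers = covers
        ; separates = separates
        ; spare = map point good
        ; spare! = map-point-unique good!
        ; lonely = lonely
        }

-- The small systems

module Layouts where

  open Systems
  open Verification
  open import Data.Bool using (Bool; true; false; _∧_; if_then_else_)
  open import Data.Nat using (ℕ; zero; suc; _+_; _∸_; _<ᵇ_; _≤ᵇ_; _⊓_)
  open import Data.Nat.DivMod using (_%_)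

  -- Its arguments in the layouts are sums of two residues, so one subtraction replaces a division.
  reduce : ℕ → ℕ → ℕ
  reduce p x = if x <ᵇ p then x else x ∸ p

  progression : ℕ → ℕ → ℕ → ℕ → List ℕ
  progression p d zero    x = []
  progression p d (suc k) x = x ∷ progression p d k (reduce p (x + d))

  -- In a cyclic layout the vertices are the residues modulo p and the further
  -- vertices p, p + 1, …. Its paths are the p translates of one path and, for
  -- each further vertex, a path of the inner layout continued by a progression
  -- modulo p with the listed first term and difference.
  data Layout : Set where
    explicit : List (List ℕ) → Layout
    cyclic   : ℕ → List ℕ → List (ℕ × ℕ) → Layout → Layout

  line : Layout → ℕ → List ℕ
  line (explicit ls)         i = ls ! i
  line (cyclic p base ds l) i =
    if i <ᵇ p then map (λ x → if x <ᵇ p then reduce p (x + i) else x) base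
    else map (p +_) (line l (i ∸ p)) ++ (map (λ (s , d) → progression p d p s) ds ! (i ∸ p))

  layout1 : Layout
  layout1 = explicit (
      (0 ∷ []) ∷ [])

  layout2 : Layout
  layout2 = explicit (
      (0 ∷ []) ∷
      (1 ∷ 0 ∷ []) ∷ [])

  layout3 : Layout
  layout3 = explicit (
      (0 ∷ 2 ∷ 1 ∷ []) ∷
      (1 ∷ 2 ∷ []) ∷
      (2 ∷ 0 ∷ 1 ∷ []) ∷ [])

  layout4 : Layout
  layout4 = explicit (
      (0 ∷ 2 ∷ 1 ∷ []) ∷
      (1 ∷ 2 ∷ 3 ∷ 0 ∷ []) ∷
      (2 ∷ 3 ∷ 1 ∷ 0 ∷ []) ∷
      (3 ∷ 1 ∷ []) ∷ [])

  layout5 : Layout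
  layout5 = explicit (
      (0 ∷ 1 ∷ 4 ∷ 2 ∷ 3 ∷ []) ∷
      (1 ∷ 3 ∷ 0 ∷ 2 ∷ 4 ∷ []) ∷
      (2 ∷ 4 ∷ 0 ∷ 1 ∷ 3 ∷ []) ∷
      (3 ∷ 4 ∷ 1 ∷ 2 ∷ 0 ∷ []) ∷
      (4 ∷ 0 ∷ 3 ∷ 1 ∷ 2 ∷ []) ∷ [])

  layout6 : Layout
  layout6 = explicit (
      (0 ∷ 5 ∷ 1 ∷ 2 ∷ 4 ∷ 3 ∷ []) ∷
      (1 ∷ 5 ∷ 3 ∷ 0 ∷ 2 ∷ 4 ∷ []) ∷
      (2 ∷ 3 ∷ 0 ∷ 4 ∷ 1 ∷ 5 ∷ []) ∷
      (3 ∷ 0 ∷ 2 ∷ 1 ∷ 4 ∷ 5 ∷ []) ∷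
      (4 ∷ 5 ∷ 2 ∷ 1 ∷ 0 ∷ 3 ∷ []) ∷
      (5 ∷ 0 ∷ 1 ∷ 3 ∷ 2 ∷ 4 ∷ []) ∷ [])

  layout7 : Layout
  layout7 = explicit (
      (0 ∷ 1 ∷ 4 ∷ 5 ∷ 2 ∷ 3 ∷ 6 ∷ []) ∷
      (1 ∷ 2 ∷ 3 ∷ 4 ∷ 0 ∷ 5 ∷ 6 ∷ []) ∷
      (2 ∷ 1 ∷ 5 ∷ 3 ∷ 0 ∷ 6 ∷ 4 ∷ []) ∷
      (3 ∷ 6 ∷ 2 ∷ 4 ∷ 1 ∷ 5 ∷ 0 ∷ []) ∷
      (4 ∷ 3 ∷ 5 ∷ 2 ∷ 0 ∷ 6 ∷ 1 ∷ []) ∷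
      (5 ∷ 3 ∷ 1 ∷ 0 ∷ 4 ∷ 6 ∷ 2 ∷ []) ∷
      (6 ∷ 5 ∷ 4 ∷ 1 ∷ 3 ∷ 0 ∷ 2 ∷ []) ∷ [])

  layout8 : Layout
  layout8 = explicit (
      (0 ∷ 6 ∷ 1 ∷ 7 ∷ 5 ∷ 3 ∷ 2 ∷ 4 ∷ []) ∷
      (1 ∷ 4 ∷ 5 ∷ 3 ∷ 7 ∷ 0 ∷ 6 ∷ 2 ∷ []) ∷
      (2 ∷ 6 ∷ 5 ∷ 7 ∷ 4 ∷ 0 ∷ 1 ∷ 3 ∷ []) ∷
      (3 ∷ 0 ∷ 1 ∷ 5 ∷ 4 ∷ 6 ∷ 7 ∷ 2 ∷ []) ∷
      (4 ∷ 1 ∷ 6 ∷ 7 ∷ 5 ∷ 0 ∷ 3 ∷ 2 ∷ []) ∷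
      (5 ∷ 2 ∷ 7 ∷ 0 ∷ 6 ∷ 1 ∷ 3 ∷ 4 ∷ []) ∷
      (6 ∷ 5 ∷ 7 ∷ 3 ∷ 4 ∷ 1 ∷ 2 ∷ 0 ∷ []) ∷
      (7 ∷ 4 ∷ 2 ∷ 0 ∷ 3 ∷ 6 ∷ 1 ∷ 5 ∷ []) ∷ [])

  layout9 : Layout
  layout9 = explicit (
      (0 ∷ 6 ∷ 2 ∷ 7 ∷ 4 ∷ 1 ∷ 8 ∷ 3 ∷ 5 ∷ []) ∷
      (1 ∷ 2 ∷ 8 ∷ 3 ∷ 0 ∷ 4 ∷ 6 ∷ 5 ∷ 7 ∷ []) ∷
      (2 ∷ 4 ∷ 3 ∷ 1 ∷ 0 ∷ 7 ∷ 5 ∷ 6 ∷ 8 ∷ []) ∷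
      (3 ∷ 2 ∷ 8 ∷ 6 ∷ 7 ∷ 5 ∷ 0 ∷ 1 ∷ 4 ∷ []) ∷
      (4 ∷ 5 ∷ 2 ∷ 6 ∷ 0 ∷ 3 ∷ 7 ∷ 8 ∷ 1 ∷ []) ∷
      (5 ∷ 1 ∷ 7 ∷ 8 ∷ 0 ∷ 4 ∷ 2 ∷ 3 ∷ 6 ∷ []) ∷
      (6 ∷ 0 ∷ 2 ∷ 7 ∷ 3 ∷ 1 ∷ 5 ∷ 8 ∷ 4 ∷ []) ∷
      (7 ∷ 5 ∷ 3 ∷ 4 ∷ 8 ∷ 0 ∷ 1 ∷ 6 ∷ 2 ∷ []) ∷
      (8 ∷ 1 ∷ 2 ∷ 0 ∷ 4 ∷ 5 ∷ 3 ∷ 6 ∷ 7 ∷ []) ∷ [])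

  layout10 : Layout
  layout10 = explicit (
      (0 ∷ 3 ∷ 6 ∷ 4 ∷ 9 ∷ 1 ∷ 2 ∷ 5 ∷ 8 ∷ 7 ∷ []) ∷
      (1 ∷ 9 ∷ 7 ∷ 5 ∷ 6 ∷ 0 ∷ 4 ∷ 3 ∷ 2 ∷ 8 ∷ []) ∷
      (2 ∷ 7 ∷ 4 ∷ 8 ∷ 1 ∷ 6 ∷ 3 ∷ 0 ∷ 5 ∷ 9 ∷ []) ∷
      (3 ∷ 7 ∷ 0 ∷ 6 ∷ 1 ∷ 8 ∷ 9 ∷ 2 ∷ 5 ∷ 4 ∷ []) ∷
      (4 ∷ 7 ∷ 1 ∷ 0 ∷ 2 ∷ 3 ∷ 8 ∷ 6 ∷ 9 ∷ 5 ∷ []) ∷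
      (5 ∷ 7 ∷ 4 ∷ 1 ∷ 0 ∷ 3 ∷ 9 ∷ 2 ∷ 6 ∷ 8 ∷ []) ∷
      (6 ∷ 7 ∷ 1 ∷ 2 ∷ 8 ∷ 3 ∷ 9 ∷ 0 ∷ 5 ∷ 4 ∷ []) ∷
      (7 ∷ 3 ∷ 8 ∷ 6 ∷ 5 ∷ 1 ∷ 2 ∷ 4 ∷ 9 ∷ 0 ∷ []) ∷
      (8 ∷ 7 ∷ 1 ∷ 3 ∷ 5 ∷ 0 ∷ 4 ∷ 2 ∷ 6 ∷ 9 ∷ []) ∷
      (9 ∷ 2 ∷ 7 ∷ 0 ∷ 8 ∷ 1 ∷ 5 ∷ 3 ∷ 4 ∷ 6 ∷ []) ∷ [])

  layout11 : Layout
  layout11 = explicit (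
      (0 ∷ 8 ∷ 5 ∷ 4 ∷ 9 ∷ 2 ∷ 7 ∷ 1 ∷ 10 ∷ 6 ∷ 3 ∷ []) ∷
      (1 ∷ 8 ∷ 6 ∷ 0 ∷ 2 ∷ 10 ∷ 3 ∷ 5 ∷ 9 ∷ 7 ∷ 4 ∷ []) ∷
      (2 ∷ 4 ∷ 10 ∷ 5 ∷ 0 ∷ 3 ∷ 1 ∷ 7 ∷ 6 ∷ 8 ∷ 9 ∷ []) ∷
      (3 ∷ 7 ∷ 6 ∷ 2 ∷ 1 ∷ 10 ∷ 0 ∷ 4 ∷ 8 ∷ 9 ∷ 5 ∷ []) ∷
      (4 ∷ 8 ∷ 2 ∷ 10 ∷ 9 ∷ 3 ∷ 6 ∷ 0 ∷ 7 ∷ 5 ∷ 1 ∷ []) ∷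
      (5 ∷ 2 ∷ 3 ∷ 8 ∷ 1 ∷ 0 ∷ 7 ∷ 10 ∷ 4 ∷ 9 ∷ 6 ∷ []) ∷
      (6 ∷ 9 ∷ 0 ∷ 8 ∷ 10 ∷ 5 ∷ 3 ∷ 4 ∷ 1 ∷ 2 ∷ 7 ∷ []) ∷
      (7 ∷ 8 ∷ 5 ∷ 2 ∷ 0 ∷ 3 ∷ 4 ∷ 6 ∷ 1 ∷ 9 ∷ 10 ∷ []) ∷
      (8 ∷ 3 ∷ 9 ∷ 2 ∷ 7 ∷ 4 ∷ 1 ∷ 6 ∷ 5 ∷ 0 ∷ 10 ∷ []) ∷
      (9 ∷ 1 ∷ 0 ∷ 6 ∷ 7 ∷ 3 ∷ 10 ∷ 8 ∷ 2 ∷ 4 ∷ 5 ∷ []) ∷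
      (10 ∷ 6 ∷ 5 ∷ 1 ∷ 3 ∷ 2 ∷ 8 ∷ 7 ∷ 9 ∷ 0 ∷ 4 ∷ []) ∷ [])

  layout12 : Layout
  layout12 = explicit (
      (0 ∷ 5 ∷ 7 ∷ 4 ∷ 2 ∷ 8 ∷ 6 ∷ 1 ∷ 3 ∷ 10 ∷ 9 ∷ 11 ∷ []) ∷
      (1 ∷ 6 ∷ 9 ∷ 3 ∷ 7 ∷ 0 ∷ 11 ∷ 2 ∷ 10 ∷ 8 ∷ 5 ∷ 4 ∷ []) ∷
      (2 ∷ 10 ∷ 5 ∷ 9 ∷ 1 ∷ 7 ∷ 11 ∷ 3 ∷ 4 ∷ 8 ∷ 6 ∷ 0 ∷ []) ∷
      (3 ∷ 8 ∷ 4 ∷ 6 ∷ 9 ∷ 0 ∷ 2 ∷ 10 ∷ 11 ∷ 1 ∷ 7 ∷ 5 ∷ []) ∷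
      (4 ∷ 9 ∷ 7 ∷ 1 ∷ 0 ∷ 8 ∷ 2 ∷ 5 ∷ 6 ∷ 3 ∷ 11 ∷ 10 ∷ []) ∷
      (5 ∷ 3 ∷ 1 ∷ 2 ∷ 7 ∷ 10 ∷ 9 ∷ 8 ∷ 4 ∷ 11 ∷ 0 ∷ 6 ∷ []) ∷
      (6 ∷ 7 ∷ 3 ∷ 2 ∷ 11 ∷ 1 ∷ 10 ∷ 8 ∷ 9 ∷ 4 ∷ 0 ∷ 5 ∷ []) ∷
      (7 ∷ 6 ∷ 10 ∷ 4 ∷ 1 ∷ 2 ∷ 3 ∷ 9 ∷ 5 ∷ 11 ∷ 8 ∷ 0 ∷ []) ∷
      (8 ∷ 7 ∷ 11 ∷ 1 ∷ 4 ∷ 2 ∷ 9 ∷ 10 ∷ 0 ∷ 3 ∷ 6 ∷ 5 ∷ []) ∷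
      (9 ∷ 7 ∷ 3 ∷ 8 ∷ 11 ∷ 4 ∷ 5 ∷ 10 ∷ 0 ∷ 6 ∷ 2 ∷ 1 ∷ []) ∷
      (10 ∷ 6 ∷ 11 ∷ 3 ∷ 5 ∷ 8 ∷ 1 ∷ 9 ∷ 2 ∷ 0 ∷ 4 ∷ 7 ∷ []) ∷
      (11 ∷ 9 ∷ 0 ∷ 3 ∷ 6 ∷ 7 ∷ 2 ∷ 5 ∷ 1 ∷ 8 ∷ 10 ∷ 4 ∷ []) ∷ [])

  layout13 : Layout
  layout13 = cyclic 13 (0 ∷ 9 ∷ 1 ∷ 12 ∷ 6 ∷ 11 ∷ 8 ∷ 4 ∷ 5 ∷ 7 ∷ 10 ∷ 3 ∷ 2 ∷ []) [] (explicit [])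

  layout14 : Layout
  layout14 = cyclic 11 (0 ∷ 8 ∷ 2 ∷ 6 ∷ 7 ∷ 10 ∷ 1 ∷ 11 ∷ 4 ∷ 5 ∷ 12 ∷ 9 ∷ 13 ∷ 3 ∷ []) ((8 , 2) ∷ (10 , 4) ∷ (7 , 5) ∷ []) layout3

  layout15 : Layout
  layout15 = cyclic 13 (0 ∷ 4 ∷ 12 ∷ 11 ∷ 9 ∷ 6 ∷ 13 ∷ 8 ∷ 5 ∷ 3 ∷ 2 ∷ 14 ∷ 10 ∷ 1 ∷ 7 ∷ []) ((10 , 6) ∷ (8 , 5) ∷ []) layout2

  layout16 : Layout
  layout16 = cyclic 13 (0 ∷ 13 ∷ 1 ∷ 2 ∷ 10 ∷ 4 ∷ 14 ∷ 7 ∷ 15 ∷ 12 ∷ 3 ∷ 5 ∷ 6 ∷ 9 ∷ 11 ∷ 8 ∷ []) ((9 , 6) ∷ (7 , 5) ∷ (0 , 4) ∷ []) layout3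

  layout17 : Layout
  layout17 = cyclic 13 (0 ∷ 2 ∷ 1 ∷ 4 ∷ 9 ∷ 5 ∷ 13 ∷ 7 ∷ 14 ∷ 3 ∷ 15 ∷ 8 ∷ 11 ∷ 16 ∷ 10 ∷ 12 ∷ 6 ∷ []) ((9 , 6) ∷ (2 , 4) ∷ (9 , 5) ∷ (1 , 1) ∷ []) layout4

  layout18 : Layout
  layout18 = cyclic 17 (0 ∷ 14 ∷ 1 ∷ 16 ∷ 7 ∷ 2 ∷ 9 ∷ 10 ∷ 17 ∷ 12 ∷ 13 ∷ 3 ∷ 15 ∷ 6 ∷ 4 ∷ 8 ∷ 5 ∷ 11 ∷ []) ((12 , 6) ∷ []) layout1

  layout19 : Layout
  layout19 = cyclic 17 (0 ∷ 3 ∷ 4 ∷ 10 ∷ 8 ∷ 15 ∷ 7 ∷ 12 ∷ 17 ∷ 14 ∷ 2 ∷ 11 ∷ 1 ∷ 16 ∷ 5 ∷ 18 ∷ 6 ∷ 9 ∷ 13 ∷ []) ((8 , 4) ∷ (15 , 1) ∷ []) layout2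

  layout24 : Layout
  layout24 = cyclic 19 (0 ∷ 7 ∷ 2 ∷ 9 ∷ 6 ∷ 15 ∷ 16 ∷ 8 ∷ 14 ∷ 18 ∷ 1 ∷ 5 ∷ 11 ∷ 19 ∷ 3 ∷ 20 ∷ 4 ∷ 21 ∷ 13 ∷ 10 ∷ 22 ∷ 17 ∷ 23 ∷ 12 ∷ []) ((6 , 8) ∷ (13 , 1) ∷ (8 , 9) ∷ (3 , 2) ∷ (2 , 5) ∷ []) layout5

  layout25 : Layout
  layout25 = cyclic 23 (0 ∷ 17 ∷ 9 ∷ 20 ∷ 16 ∷ 15 ∷ 5 ∷ 19 ∷ 14 ∷ 21 ∷ 1 ∷ 23 ∷ 3 ∷ 6 ∷ 13 ∷ 8 ∷ 22 ∷ 12 ∷ 11 ∷ 7 ∷ 24 ∷ 18 ∷ 10 ∷ 4 ∷ 2 ∷ []) ((0 , 2) ∷ (18 , 11) ∷ []) layout2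

  layout26 : Layout
  layout26 = cyclic 19 (0 ∷ 7 ∷ 17 ∷ 13 ∷ 10 ∷ 15 ∷ 16 ∷ 5 ∷ 11 ∷ 18 ∷ 1 ∷ 19 ∷ 8 ∷ 20 ∷ 14 ∷ 3 ∷ 21 ∷ 4 ∷ 22 ∷ 9 ∷ 23 ∷ 6 ∷ 24 ∷ 2 ∷ 25 ∷ 12 ∷ []) ((13 , 2) ∷ (12 , 6) ∷ (10 , 1) ∷ (2 , 5) ∷ (18 , 3) ∷ (7 , 4) ∷ (9 , 9) ∷ []) layout7

  layout27 : Layout
  layout27 = cyclic 19 (0 ∷ 5 ∷ 11 ∷ 18 ∷ 9 ∷ 8 ∷ 12 ∷ 10 ∷ 2 ∷ 19 ∷ 4 ∷ 20 ∷ 15 ∷ 13 ∷ 21 ∷ 17 ∷ 22 ∷ 16 ∷ 23 ∷ 7 ∷ 24 ∷ 14 ∷ 25 ∷ 1 ∷ 26 ∷ 6 ∷ 3 ∷ []) ((17 , 3) ∷ (9 , 8) ∷ (10 , 4) ∷ (14 , 1) ∷ (18 , 9) ∷ (1 , 7) ∷ (8 , 6) ∷ (18 , 5) ∷ []) layout8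

  layout34 : Layout
  layout34 = cyclic 29 (0 ∷ 26 ∷ 16 ∷ 27 ∷ 19 ∷ 21 ∷ 6 ∷ 18 ∷ 11 ∷ 7 ∷ 23 ∷ 14 ∷ 9 ∷ 3 ∷ 29 ∷ 28 ∷ 22 ∷ 30 ∷ 17 ∷ 8 ∷ 24 ∷ 20 ∷ 13 ∷ 25 ∷ 31 ∷ 10 ∷ 12 ∷ 32 ∷ 4 ∷ 15 ∷ 5 ∷ 33 ∷ 2 ∷ 1 ∷ []) ((11 , 1) ∷ (14 , 5) ∷ (25 , 14) ∷ (3 , 8) ∷ (21 , 3) ∷ []) layout5

  layout35 : Layout
  layout35 = cyclic 29 (0 ∷ 19 ∷ 13 ∷ 18 ∷ 21 ∷ 12 ∷ 25 ∷ 24 ∷ 20 ∷ 6 ∷ 8 ∷ 15 ∷ 23 ∷ 5 ∷ 17 ∷ 29 ∷ 28 ∷ 7 ∷ 14 ∷ 16 ∷ 2 ∷ 27 ∷ 26 ∷ 10 ∷ 30 ∷ 1 ∷ 31 ∷ 4 ∷ 32 ∷ 9 ∷ 33 ∷ 3 ∷ 34 ∷ 22 ∷ 11 ∷ []) ((13 , 12) ∷ (14 , 9) ∷ (25 , 3) ∷ (21 , 5) ∷ (16 , 6) ∷ (21 , 10) ∷ []) layout6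

  layout36 : Layout
  layout36 = cyclic 29 (0 ∷ 9 ∷ 7 ∷ 1 ∷ 12 ∷ 16 ∷ 28 ∷ 6 ∷ 27 ∷ 3 ∷ 18 ∷ 5 ∷ 24 ∷ 23 ∷ 26 ∷ 25 ∷ 29 ∷ 15 ∷ 2 ∷ 17 ∷ 30 ∷ 22 ∷ 14 ∷ 31 ∷ 21 ∷ 32 ∷ 4 ∷ 8 ∷ 33 ∷ 19 ∷ 34 ∷ 13 ∷ 11 ∷ 35 ∷ 20 ∷ 10 ∷ []) ((26 , 3) ∷ (28 , 5) ∷ (1 , 7) ∷ (7 , 12) ∷ (5 , 11) ∷ (18 , 6) ∷ (21 , 9) ∷ []) layout7

  layout37 : Layout
  layout37 = cyclic 29 (0 ∷ 18 ∷ 27 ∷ 4 ∷ 16 ∷ 13 ∷ 23 ∷ 25 ∷ 12 ∷ 20 ∷ 6 ∷ 7 ∷ 14 ∷ 10 ∷ 5 ∷ 29 ∷ 1 ∷ 30 ∷ 8 ∷ 31 ∷ 9 ∷ 24 ∷ 3 ∷ 32 ∷ 19 ∷ 33 ∷ 21 ∷ 34 ∷ 2 ∷ 28 ∷ 11 ∷ 35 ∷ 17 ∷ 36 ∷ 26 ∷ 15 ∷ 22 ∷ []) ((28 , 4) ∷ (15 , 5) ∷ (16 , 1) ∷ (8 , 13) ∷ (13 , 2) ∷ (25 , 10) ∷ (11 , 6) ∷ (27 , 9) ∷ []) layout8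

  layout38 : Layout
  layout38 = cyclic 29 (0 ∷ 17 ∷ 11 ∷ 31 ∷ 1 ∷ 5 ∷ 25 ∷ 33 ∷ 27 ∷ 20 ∷ 29 ∷ 28 ∷ 24 ∷ 36 ∷ 12 ∷ 4 ∷ 3 ∷ 34 ∷ 10 ∷ 37 ∷ 7 ∷ 14 ∷ 2 ∷ 35 ∷ 22 ∷ 30 ∷ 18 ∷ 16 ∷ 19 ∷ 9 ∷ 32 ∷ 8 ∷ 13 ∷ 26 ∷ 15 ∷ 23 ∷ 21 ∷ 6 ∷ []) ((2 , 11) ∷ (26 , 10) ∷ (4 , 1) ∷ (16 , 9) ∷ (18 , 13) ∷ (4 , 6) ∷ (21 , 5) ∷ (4 , 14) ∷ (13 , 3) ∷ []) layout9

  layout39 : Layout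
  layout39 = cyclic 37 (0 ∷ 34 ∷ 26 ∷ 11 ∷ 21 ∷ 23 ∷ 30 ∷ 13 ∷ 7 ∷ 20 ∷ 2 ∷ 28 ∷ 12 ∷ 35 ∷ 10 ∷ 15 ∷ 24 ∷ 25 ∷ 37 ∷ 4 ∷ 5 ∷ 14 ∷ 19 ∷ 38 ∷ 31 ∷ 17 ∷ 1 ∷ 27 ∷ 9 ∷ 22 ∷ 16 ∷ 36 ∷ 6 ∷ 8 ∷ 18 ∷ 3 ∷ 32 ∷ 29 ∷ 33 ∷ []) ((35 , 4) ∷ (18 , 12) ∷ []) layout2

  layout40 : Layout
  layout40 = cyclic 37 (0 ∷ 17 ∷ 2 ∷ 31 ∷ 32 ∷ 19 ∷ 33 ∷ 15 ∷ 3 ∷ 35 ∷ 26 ∷ 10 ∷ 36 ∷ 5 ∷ 1 ∷ 11 ∷ 14 ∷ 16 ∷ 37 ∷ 7 ∷ 9 ∷ 12 ∷ 22 ∷ 18 ∷ 24 ∷ 13 ∷ 38 ∷ 34 ∷ 25 ∷ 20 ∷ 8 ∷ 27 ∷ 4 ∷ 39 ∷ 28 ∷ 29 ∷ 21 ∷ 6 ∷ 23 ∷ 30 ∷ []) ((6 , 7) ∷ (0 , 16) ∷ (21 , 13) ∷ []) layout3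

  layout41 : Layout
  layout41 = cyclic 37 (0 ∷ 26 ∷ 17 ∷ 10 ∷ 29 ∷ 13 ∷ 19 ∷ 6 ∷ 31 ∷ 4 ∷ 12 ∷ 32 ∷ 27 ∷ 30 ∷ 8 ∷ 7 ∷ 3 ∷ 5 ∷ 37 ∷ 23 ∷ 25 ∷ 38 ∷ 21 ∷ 20 ∷ 35 ∷ 1 ∷ 39 ∷ 33 ∷ 16 ∷ 24 ∷ 34 ∷ 22 ∷ 9 ∷ 40 ∷ 15 ∷ 36 ∷ 18 ∷ 11 ∷ 2 ∷ 28 ∷ 14 ∷ []) ((9 , 14) ∷ (10 , 4) ∷ (21 , 5) ∷ (17 , 6) ∷ []) layout4

  layout42 : Layout
  layout42 = cyclic 37 (0 ∷ 7 ∷ 4 ∷ 35 ∷ 33 ∷ 19 ∷ 30 ∷ 8 ∷ 12 ∷ 29 ∷ 34 ∷ 16 ∷ 17 ∷ 5 ∷ 32 ∷ 24 ∷ 3 ∷ 27 ∷ 37 ∷ 28 ∷ 15 ∷ 31 ∷ 38 ∷ 23 ∷ 39 ∷ 13 ∷ 1 ∷ 2 ∷ 40 ∷ 21 ∷ 41 ∷ 26 ∷ 6 ∷ 10 ∷ 25 ∷ 36 ∷ 22 ∷ 20 ∷ 14 ∷ 11 ∷ 18 ∷ 9 ∷ []) ((27 , 9) ∷ (16 , 8) ∷ (17 , 10) ∷ (11 , 18) ∷ (7 , 5) ∷ []) layout5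

  layout43 : Layout
  layout43 = cyclic 37 (0 ∷ 18 ∷ 29 ∷ 35 ∷ 26 ∷ 10 ∷ 12 ∷ 8 ∷ 3 ∷ 13 ∷ 16 ∷ 24 ∷ 25 ∷ 5 ∷ 27 ∷ 15 ∷ 2 ∷ 32 ∷ 37 ∷ 14 ∷ 7 ∷ 38 ∷ 31 ∷ 19 ∷ 4 ∷ 21 ∷ 22 ∷ 39 ∷ 30 ∷ 33 ∷ 6 ∷ 40 ∷ 1 ∷ 34 ∷ 41 ∷ 36 ∷ 20 ∷ 11 ∷ 42 ∷ 17 ∷ 28 ∷ 9 ∷ 23 ∷ []) ((5 , 14) ∷ (33 , 13) ∷ (19 , 8) ∷ (33 , 5) ∷ (18 , 2) ∷ (21 , 6) ∷ []) layout6

  layout64 : Layout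
  layout64 = cyclic 61 (0 ∷ 56 ∷ 43 ∷ 24 ∷ 42 ∷ 11 ∷ 49 ∷ 38 ∷ 36 ∷ 9 ∷ 25 ∷ 29 ∷ 15 ∷ 18 ∷ 28 ∷ 4 ∷ 59 ∷ 19 ∷ 45 ∷ 30 ∷ 5 ∷ 14 ∷ 13 ∷ 35 ∷ 27 ∷ 34 ∷ 51 ∷ 22 ∷ 50 ∷ 1 ∷ 61 ∷ 20 ∷ 32 ∷ 60 ∷ 31 ∷ 48 ∷ 55 ∷ 47 ∷ 8 ∷ 62 ∷ 7 ∷ 16 ∷ 52 ∷ 37 ∷ 2 ∷ 23 ∷ 63 ∷ 17 ∷ 54 ∷ 3 ∷ 6 ∷ 53 ∷ 57 ∷ 12 ∷ 46 ∷ 44 ∷ 33 ∷ 10 ∷ 40 ∷ 58 ∷ 39 ∷ 26 ∷ 21 ∷ 41 ∷ []) ((13 , 20) ∷ (44 , 1) ∷ (42 , 6) ∷ []) layout3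

  layout65 : Layout
  layout65 = cyclic 61 (0 ∷ 30 ∷ 9 ∷ 18 ∷ 24 ∷ 2 ∷ 47 ∷ 32 ∷ 6 ∷ 54 ∷ 3 ∷ 10 ∷ 60 ∷ 56 ∷ 33 ∷ 36 ∷ 16 ∷ 43 ∷ 41 ∷ 40 ∷ 22 ∷ 46 ∷ 17 ∷ 12 ∷ 29 ∷ 48 ∷ 23 ∷ 11 ∷ 39 ∷ 53 ∷ 45 ∷ 59 ∷ 26 ∷ 61 ∷ 14 ∷ 50 ∷ 8 ∷ 25 ∷ 20 ∷ 62 ∷ 52 ∷ 15 ∷ 58 ∷ 57 ∷ 55 ∷ 21 ∷ 1 ∷ 63 ∷ 4 ∷ 42 ∷ 38 ∷ 27 ∷ 34 ∷ 44 ∷ 31 ∷ 5 ∷ 51 ∷ 64 ∷ 35 ∷ 13 ∷ 19 ∷ 28 ∷ 7 ∷ 37 ∷ 49 ∷ []) ((33 , 8) ∷ (51 , 29) ∷ (15 , 3) ∷ (59 , 16) ∷ []) layout4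

  layout66 : Layout
  layout66 = cyclic 61 (0 ∷ 54 ∷ 42 ∷ 41 ∷ 33 ∷ 4 ∷ 13 ∷ 32 ∷ 34 ∷ 17 ∷ 10 ∷ 30 ∷ 3 ∷ 16 ∷ 59 ∷ 9 ∷ 14 ∷ 11 ∷ 46 ∷ 23 ∷ 53 ∷ 37 ∷ 22 ∷ 36 ∷ 26 ∷ 5 ∷ 1 ∷ 40 ∷ 12 ∷ 6 ∷ 43 ∷ 18 ∷ 55 ∷ 49 ∷ 61 ∷ 21 ∷ 60 ∷ 56 ∷ 35 ∷ 25 ∷ 39 ∷ 24 ∷ 8 ∷ 38 ∷ 15 ∷ 50 ∷ 47 ∷ 52 ∷ 62 ∷ 2 ∷ 45 ∷ 58 ∷ 63 ∷ 31 ∷ 51 ∷ 64 ∷ 44 ∷ 27 ∷ 29 ∷ 48 ∷ 65 ∷ 57 ∷ 28 ∷ 20 ∷ 19 ∷ 7 ∷ []) ((43 , 28) ∷ (30 , 11) ∷ (22 , 27) ∷ (21 , 25) ∷ (29 , 9) ∷ []) layout5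

  layout67 : Layout
  layout67 = cyclic 61 (0 ∷ 10 ∷ 35 ∷ 20 ∷ 21 ∷ 27 ∷ 6 ∷ 43 ∷ 46 ∷ 50 ∷ 24 ∷ 32 ∷ 52 ∷ 40 ∷ 53 ∷ 9 ∷ 41 ∷ 34 ∷ 12 ∷ 3 ∷ 31 ∷ 13 ∷ 29 ∷ 56 ∷ 42 ∷ 19 ∷ 8 ∷ 39 ∷ 58 ∷ 2 ∷ 61 ∷ 55 ∷ 60 ∷ 62 ∷ 18 ∷ 49 ∷ 38 ∷ 15 ∷ 1 ∷ 28 ∷ 44 ∷ 26 ∷ 54 ∷ 63 ∷ 45 ∷ 23 ∷ 16 ∷ 48 ∷ 4 ∷ 17 ∷ 5 ∷ 25 ∷ 33 ∷ 7 ∷ 11 ∷ 14 ∷ 64 ∷ 51 ∷ 65 ∷ 30 ∷ 66 ∷ 36 ∷ 37 ∷ 22 ∷ 47 ∷ 57 ∷ 59 ∷ []) ((60 , 2) ∷ (41 , 19) ∷ (21 , 9) ∷ (51 , 24) ∷ (49 , 21) ∷ (4 , 6) ∷ []) layout6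

  bases : List (ℕ × Layout × List ℕ)
  bases =
    (1 , layout1 , []) ∷
    (2 , layout2 , []) ∷
    (3 , layout3 , []) ∷
    (4 , layout4 , []) ∷
    (5 , layout5 , (1 ∷ 2 ∷ 4 ∷ [])) ∷
    (6 , layout6 , []) ∷
    (7 , layout7 , (0 ∷ 1 ∷ 2 ∷ 5 ∷ 6 ∷ [])) ∷
    (8 , layout8 , []) ∷
    (9 , layout9 , []) ∷
    (10 , layout10 , []) ∷
    (11 , layout11 , (0 ∷ 1 ∷ 2 ∷ 6 ∷ 8 ∷ 9 ∷ 10 ∷ [])) ∷
    (12 , layout12 , []) ∷
    (13 , layout13 , (0 ∷ 1 ∷ 2 ∷ 3 ∷ 4 ∷ 5 ∷ 6 ∷ 7 ∷ 8 ∷ 9 ∷ 10 ∷ [])) ∷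
    (14 , layout14 , []) ∷
    (15 , layout15 , []) ∷
    (16 , layout16 , []) ∷
    (17 , layout17 , (1 ∷ 2 ∷ 3 ∷ 4 ∷ 5 ∷ 7 ∷ 8 ∷ [])) ∷
    (18 , layout18 , []) ∷
    (19 , layout19 , (0 ∷ 1 ∷ 2 ∷ 3 ∷ 4 ∷ 5 ∷ 6 ∷ 7 ∷ 8 ∷ 9 ∷ 10 ∷ 13 ∷ 14 ∷ 15 ∷ 16 ∷ [])) ∷
    (24 , layout24 , []) ∷
    (25 , layout25 , (0 ∷ 1 ∷ 2 ∷ 3 ∷ 4 ∷ 5 ∷ 6 ∷ 7 ∷ 8 ∷ 9 ∷ 10 ∷ 11 ∷ 12 ∷ 13 ∷ 14 ∷ [])) ∷
    (26 , layout26 , []) ∷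
    (27 , layout27 , []) ∷
    (34 , layout34 , []) ∷
    (35 , layout35 , (0 ∷ 1 ∷ 2 ∷ 5 ∷ 6 ∷ 7 ∷ 8 ∷ [])) ∷
    (36 , layout36 , []) ∷
    (37 , layout37 , (1 ∷ 3 ∷ 4 ∷ 6 ∷ 8 ∷ 10 ∷ 11 ∷ 13 ∷ 15 ∷ 16 ∷ 18 ∷ 19 ∷ 20 ∷ 21 ∷ 22 ∷ [])) ∷
    (38 , layout38 , []) ∷
    (39 , layout39 , []) ∷
    (40 , layout40 , []) ∷
    (41 , layout41 , (0 ∷ 1 ∷ 2 ∷ 4 ∷ 5 ∷ 6 ∷ 7 ∷ [])) ∷
    (42 , layout42 , []) ∷
    (43 , layout43 , (0 ∷ 1 ∷ 2 ∷ 3 ∷ 4 ∷ 5 ∷ 7 ∷ 8 ∷ 9 ∷ 10 ∷ 11 ∷ 12 ∷ 13 ∷ 14 ∷ 15 ∷ [])) ∷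
    (64 , layout64 , []) ∷
    (65 , layout65 , (0 ∷ 1 ∷ 2 ∷ 3 ∷ 4 ∷ 6 ∷ 7 ∷ [])) ∷
    (66 , layout66 , []) ∷
    (67 , layout67 , (0 ∷ 2 ∷ 3 ∷ 4 ∷ 5 ∷ 6 ∷ 7 ∷ 8 ∷ 10 ∷ 11 ∷ 12 ∷ 13 ∷ 14 ∷ 15 ∷ 16 ∷ [])) ∷
    []

  -- As parts of larger layouts only sizes coprime to 6 occur. They need as many
  -- spare indices as there are vertices left over, at most 15 and 7 respectively.
  quota : ℕ → ℕ → ℕ
  quota 1 n = 15 ⊓ (n ∸ 2)
  quota 5 n = 7 ⊓ (n ∸ 2)
  quota _ n = 0

  need : ℕ → ℕ
  need n = quota (n % 6) n

  valid : ℕ × Layout × List ℕ → Bool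
  valid (zero  , _ , _) = false
  valid (suc N , l , g) = Check.check N (line l) g ∧ (need (suc N) ≤ᵇ length g)

  abstract
    -- The only place where all small systems are evaluated; being abstract, it is not unfolded
    -- where it is used.
    allValid : allᵇ valid bases ≡ true
    allValid = refl

open import Defs
open Systems
open Cyclic
open Construction
open Composition
open Residue
open Verification
open Layouts
open import Data.Bool using (Bool; true; T)
open import Data.Nat using (_≡ᵇ_)
open import Data.Fin using (Fin; zero; suc; inject≤; _↑ˡ_; _↑ʳ_; splitAt)
open import Data.Integer.Tactic.RingSolver using () renaming (solve-∀ to solveℤ-∀)
open import Data.Nat using (ℕ; zero; suc; _+_; _*_; _∸_; _≤_; _<_; s≤s; z≤n; _⊓_)
open import Data.Nat.Properties
open import Data.Nat.DivMod using (_/_; _%_; m≡m%n+[m/n]*n; m%n<n; [m+kn]%n≡m%n)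
open import Data.Nat.Induction using (<-rec)
open import Data.Nat.Tactic.RingSolver using (solve-∀)

-- Transport of systems along bijections

transport : ∀ {V W : Set} (f : V → W) (g : W → V) → (∀ w → f (g w) ≡ w) → (∀ v → g (f v) ≡ v) → System V → System W
transport f g fg gf S = record
  { tail      = tail
  ; simple    = λ w → subst Unique (path≡ w) (Uniqueₚ.map⁺ f-injective (S.simple (g w)))
  ; covers    = λ {x} {y} ne → let i , j = S.covers (λ e → ne (g-injective e))
                                in f i , joins⁺ (subst (λ i → Joins (S.path i) (g x) (g y)) (sym (gf i)) j)
  ; separates = λ ne ne′ h h′ → back (S.separates (λ e → ne (g-injective e)) (λ e → ne′ (g-injective e)) (pull h) (pull h′))
  ; spare     = map f S.spare
  ; spare!    = Uniqueₚ.map⁺ f-injective S.spare!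
  ; lonely    = lonely
  }
  where
  module S = System S
  f-injective : ∀ {x y} → f x ≡ f y → x ≡ y
  f-injective {x} {y} e = trans (sym (gf x)) (trans (cong g e) (gf y))
  g-injective : ∀ {x y} → g x ≡ g y → x ≡ y
  g-injective {x} {y} e = trans (sym (fg x)) (trans (cong f e) (fg y))
  tail : _ → List _
  tail w = map f (S.tail (g w))
  path≡ : ∀ w → map f (S.path (g w)) ≡ w ∷ tail w
  path≡ w = cong (_∷ tail w) (fg w)
  step⁺ : ∀ {l x y} → Step (g x) (g y) l → Step x y (map f l)
  step⁺ {l} {x} {y} s = subst (λ x → Step x y (map f l)) (fg x) (subst (λ y → Step (f (g x)) y (map f l)) (fg y) (step-map⁺ f s))
  step⁻ : ∀ {l x y} → Step x y (map f l) → Step (g x) (g y) l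
  step⁻ {l} s with step-map⁻ f l s
  ... | a , b , t , refl , refl = subst (λ x → Step x (g (f b)) l) (sym (gf a)) (subst (λ y → Step a y l) (sym (gf b)) t)
  joins⁺ : ∀ {i x y} → Joins (S.path (g i)) (g x) (g y) → Joins (i ∷ tail i) x y
  joins⁺ {i} {x} {y} (inj₁ s) = subst (λ l → Joins l x y) (path≡ i) (inj₁ (step⁺ s))
  joins⁺ {i} {x} {y} (inj₂ s) = subst (λ l → Joins l x y) (path≡ i) (inj₂ (step⁺ s))
  joins⁻ : ∀ {i x y} → Joins (i ∷ tail i) x y → Joins (S.path (g i)) (g x) (g y)
  joins⁻ {i} {x} {y} j with subst (λ l → Joins l x y) (sym (path≡ i)) j
  ... | inj₁ s = inj₁ (step⁻ s)
  ... | inj₂ s = inj₂ (step⁻ s)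
  pull : ∀ {x y z w} → (∀ i → Joins (i ∷ tail i) x y → Joins (i ∷ tail i) z w) →
         ∀ i → Joins (S.path i) (g x) (g y) → Joins (S.path i) (g z) (g w)
  pull h i = subst (λ i → Joins (S.path i) _ _ → Joins (S.path i) _ _) (gf i) λ j → joins⁻ (h (f i) (joins⁺ j))
  back : ∀ {x y z w} → (g x ≡ g z × g y ≡ g w) ⊎ (g x ≡ g w × g y ≡ g z) → (x ≡ z × y ≡ w) ⊎ (x ≡ w × y ≡ z)
  back (inj₁ (p , q)) = inj₁ (g-injective p , g-injective q)
  back (inj₂ (p , q)) = inj₂ (g-injective p , g-injective q)
  lonely : ∀ {v x y} → v ∈ map f S.spare → x ≢ y → ¬ (∀ i → Joins (i ∷ tail i) x y → i ≡ v)
  lonely v∈ ne h with ∈-map⁻ f v∈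
  ... | k , k∈ , refl = S.lonely k∈ (λ e → ne (g-injective e))
    λ i j → f-injective (h (f i) (joins⁺ (subst (λ i → Joins (S.path i) _ _) (sym (gf i)) j)))

total : ℕ → ℕ → ℕ
total m u = m + (m + (m + (m + u)))

module _ {m u : ℕ} where

  number : Vertex (Fin m) (Fin u) → Fin (total m u)
  number (vA z) = z ↑ˡ _
  number (vB z) = m ↑ʳ (z ↑ˡ _)
  number (vC z) = m ↑ʳ (m ↑ʳ (z ↑ˡ _))
  number (vD z) = m ↑ʳ (m ↑ʳ (m ↑ʳ (z ↑ˡ _)))
  number (vU j) = m ↑ʳ (m ↑ʳ (m ↑ʳ (m ↑ʳ j)))

  split : {X : Set} {k : ℕ} → (Fin m → X) → (Fin k → X) → Fin (m + k) → X
  split f g i = [ f , g ]′ (splitAt m i)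

  vertex : Fin (total m u) → Vertex (Fin m) (Fin u)
  vertex = split vA (split vB (split vC (split vD vU)))

  split-ˡ : ∀ {X : Set} {k} (f : Fin m → X) (g : Fin k → X) z → split f g (z ↑ˡ k) ≡ f z
  split-ˡ {k = k} f g z = cong [ f , g ]′ (splitAt-↑ˡ m z k)

  split-ʳ : ∀ {X : Set} {k} (f : Fin m → X) (g : Fin k → X) j → split f g (m ↑ʳ j) ≡ g j
  split-ʳ {k = k} f g j = cong [ f , g ]′ (splitAt-↑ʳ m k j)

  vertex-number : ∀ v → vertex (number v) ≡ v
  vertex-number (vA z) = split-ˡ _ _ z
  vertex-number (vB z) = trans (split-ʳ _ _ _) (split-ˡ _ _ z)
  vertex-number (vC z) = trans (split-ʳ _ _ _) (trans (split-ʳ _ _ _) (split-ˡ _ _ z))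
  vertex-number (vD z) = trans (split-ʳ _ _ _) (trans (split-ʳ _ _ _) (trans (split-ʳ _ _ _) (split-ˡ _ _ z)))
  vertex-number (vU j) = trans (split-ʳ _ _ _) (trans (split-ʳ _ _ _) (trans (split-ʳ _ _ _) (split-ʳ _ _ j)))

  split-unique : ∀ {X Y : Set} {k} {f : Fin m → X} {g : Fin k → X} (h : X → Y) (c : Fin (m + k) → Y) →
                   (∀ z → h (f z) ≡ c (z ↑ˡ k)) → (∀ j → h (g j) ≡ c (m ↑ʳ j)) → ∀ i → h (split f g i) ≡ c i
  split-unique h c p q i with splitAt m i in e
  ... | inj₁ z = trans (p z) (cong c (splitAt⁻¹-↑ˡ e))
  ... | inj₂ j = trans (q j) (cong c (splitAt⁻¹-↑ʳ e))

  number-vertex : ∀ i → number (vertex i) ≡ i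
  number-vertex = split-unique number (λ i → i) (λ _ → refl)
    (split-unique number (m ↑ʳ_) (λ _ → refl)
    (split-unique number (λ i → m ↑ʳ (m ↑ʳ i)) (λ _ → refl)
    (split-unique number (λ i → m ↑ʳ (m ↑ʳ (m ↑ʳ i))) (λ _ → refl) λ _ → refl)))

-- Recursion on the number of vertices

record CoprimeToSix (m : ℕ) : Set where
  constructor inverses
  field
    half third q r : ℤ.ℤ
    half-eq  : ℤ.+ 2 ℤ.* half ≡ ℤ.+ 1 ℤ.+ q ℤ.* ℤ.+ m
    third-eq : ℤ.+ 3 ℤ.* third ≡ ℤ.+ 1 ℤ.+ r ℤ.* ℤ.+ m

-- Each further vertex consumes its own spare index of `S`, so the length of that list must be at
-- least `u`. Heights 0 and 1 are reserved, which accounts for the other bound on `u`.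
grow : ∀ {N u} → CoprimeToSix (suc N) → 2 + u ≤ suc N → (S : System (Fin (suc N))) → u ≤ length (System.spare S) →
       System (Fin u) → ∃[ T ] length (System.spare {Fin (total (suc N) u)} T) ≡ 3 * length (System.spare S)
grow {N} {u} (inverses h t q r 2h 3t) 2+u≤m S u≤ SU =
  transport number vertex (number-vertex {suc N} {u}) vertex-number composite , count
  where
  open Modular N using (residues; slopes; gaps; by)
  module S = System S
  cut : Fin u → Fin (suc N)
  cut j = lookup S.spare (inject≤ j u≤)
  cut-injective : ∀ {i j} → cut i ≡ cut j → i ≡ j
  cut-injective {i} {j} e = inject≤-injective u≤ u≤ i j (lookup-injective S.spare! e)
  cut∈ : ∀ j → cut j ∈ S.spare
  cut∈ j = ∈-lookup (inject≤ j u≤)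
  four : Slopes residues
  four = slopes h t (by q 2h) (by r 3t) (≤-trans (s≤s (s≤s z≤n)) 2+u≤m)
  open Composite residues four (gaps u 2+u≤m) S SU cut cut-injective cut∈
  count : length (map number (System.spare composite)) ≡ 3 * length S.spare
  count = trans (length-map number (System.spare composite))
    (trans (length-++ (map _ S.spare)) (cong₂ _+_ (length-map _ S.spare)
    (trans (length-++ (map _ S.spare)) (cong₂ _+_ (length-map _ S.spare)
    (trans (length-map _ S.spare) (sym (+-identityʳ _)))))))

coprime₁ : ∀ a → CoprimeToSix (1 + a * 6)
-- For m = 6x + 1: 2(3x + 1) = 1 + m and 3(-2x) = 1 - m.
coprime₁ a = record { half = ℤ.+ 1 ℤ.+ ℤ.+ 3 ℤ.* x ; third = ℤ.- (ℤ.+ 2 ℤ.* x) ; q = ℤ.+ 1 ; r = ℤ.- ℤ.+ 1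
  ; half-eq = trans (lem₁ x) (cong (λ m → ℤ.+ 1 ℤ.+ ℤ.+ 1 ℤ.* m) (sym eq))
  ; third-eq = trans (lem₂ x) (cong (λ m → ℤ.+ 1 ℤ.+ (ℤ.- ℤ.+ 1) ℤ.* m) (sym eq)) }
  where
  x = ℤ.+ a
  eq : ℤ.+ (1 + a * 6) ≡ ℤ.+ 1 ℤ.+ x ℤ.* ℤ.+ 6
  eq = cong (λ y → ℤ.+ 1 ℤ.+ y) (ℤₚ.pos-* a 6)
  lem₁ : ∀ x → ℤ.+ 2 ℤ.* (ℤ.+ 1 ℤ.+ ℤ.+ 3 ℤ.* x) ≡ ℤ.+ 1 ℤ.+ ℤ.+ 1 ℤ.* (ℤ.+ 1 ℤ.+ x ℤ.* ℤ.+ 6)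
  lem₁ = solveℤ-∀
  lem₂ : ∀ x → ℤ.+ 3 ℤ.* (ℤ.- (ℤ.+ 2 ℤ.* x)) ≡ ℤ.+ 1 ℤ.+ (ℤ.- ℤ.+ 1) ℤ.* (ℤ.+ 1 ℤ.+ x ℤ.* ℤ.+ 6)
  lem₂ = solveℤ-∀

coprime₅ : ∀ a → CoprimeToSix (5 + a * 6)
-- For m = 6x + 5: 2(3x + 3) = 3(2x + 2) = 1 + m.
coprime₅ a = record { half = ℤ.+ 3 ℤ.+ ℤ.+ 3 ℤ.* x ; third = ℤ.+ 2 ℤ.+ ℤ.+ 2 ℤ.* x ; q = ℤ.+ 1 ; r = ℤ.+ 1
  ; half-eq = trans (lem₁ x) (cong (λ m → ℤ.+ 1 ℤ.+ ℤ.+ 1 ℤ.* m) (sym eq))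
  ; third-eq = trans (lem₂ x) (cong (λ m → ℤ.+ 1 ℤ.+ ℤ.+ 1 ℤ.* m) (sym eq)) }
  where
  x = ℤ.+ a
  eq : ℤ.+ (5 + a * 6) ≡ ℤ.+ 5 ℤ.+ x ℤ.* ℤ.+ 6
  eq = cong (λ y → ℤ.+ 5 ℤ.+ y) (ℤₚ.pos-* a 6)
  lem₁ : ∀ x → ℤ.+ 2 ℤ.* (ℤ.+ 3 ℤ.+ ℤ.+ 3 ℤ.* x) ≡ ℤ.+ 1 ℤ.+ ℤ.+ 1 ℤ.* (ℤ.+ 5 ℤ.+ x ℤ.* ℤ.+ 6)
  lem₁ = solveℤ-∀
  lem₂ : ∀ x → ℤ.+ 3 ℤ.* (ℤ.+ 2 ℤ.+ ℤ.+ 2 ℤ.* x) ≡ ℤ.+ 1 ℤ.+ ℤ.+ 1 ℤ.* (ℤ.+ 5 ℤ.+ x ℤ.* ℤ.+ 6)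
  lem₂ = solveℤ-∀

-- The spare indices belong to the induction hypothesis: a system that serves as the part on the
-- residues must have one for each further vertex.
Attained : ℕ → Set
Attained n = ∃[ S ] need n ≤ length (System.spare {Fin n} S)

need≤15 : ∀ n → need n ≤ 15
need≤15 n with n % 6
... | 0 = z≤n
... | 1 = m⊓n≤m 15 (n ∸ 2)
... | 2 = z≤n
... | 3 = z≤n
... | 4 = z≤n
... | 5 = ≤-trans (m⊓n≤m 7 (n ∸ 2)) (m≤m+n 7 8)
... | suc (suc (suc (suc (suc (suc _))))) = z≤n

need₁ : ∀ a → need (1 + a * 6) ≡ 15 ⊓ (1 + a * 6 ∸ 2)
need₁ a = cong (λ r → quota r (1 + a * 6)) ([m+kn]%n≡m%n 1 a 6)

need₅ : ∀ a → need (5 + a * 6) ≡ 7 ⊓ (5 + a * 6 ∸ 2)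
need₅ a = cong (λ r → quota r (5 + a * 6)) ([m+kn]%n≡m%n 5 a 6)

base : ∀ {n} es → allᵇ valid es ≡ true → anyᵇ (λ e → proj₁ e ≡ᵇ n) es ≡ true → Attained n
base {n} ((k , l , g) ∷ es) ok found with ∧⁻ (valid (k , l , g)) ok | ∨⁻ {k ≡ᵇ n} found
... | _   , ok′ | inj₂ later = base es ok′ later
base {n} ((suc N , l , g) ∷ es) _ _ | ok , _ | inj₁ q with ≡ᵇ⁻ {suc N} {n} q | ∧⁻ (Check.check N (line l) g) ok
... | refl | good , enough = Check.Sound.system N (line l) g good
    , subst (need (suc N) ≤_) (sym (length-map _ g)) (≤ᵇ⇒≤ _ _ (Equivalence.from T-≡ enough))

listed : ℕ → Bool
listed n = anyᵇ (λ e → proj₁ e ≡ᵇ n) bases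

baseFrom : ∀ c k → below k (λ i → listed (c + i)) ≡ true → ∀ {i} → i < k → Attained (c + i)
baseFrom c k e i<k = base bases allValid (below⁻ k (λ i → listed (c + i)) e i<k)

empty : Attained 0
empty = record { tail = λ () ; simple = λ () ; covers = λ {} ; separates = λ {} ; spare = [] ; spare! = [] ; lonely = λ () } , z≤n

enlarge : ∀ N u {n} → total (suc N) u ≡ n → CoprimeToSix (suc N) → 2 + u ≤ suc N → u ≤ need (suc N) → need n ≤ 3 * need (suc N) →
          (∀ {k} → k < n → Attained k) → Attained n
enlarge N u refl six 2+u≤m u≤ enough rec with rec {suc N} (m<m+n (suc N) (s≤s z≤n)) | rec {u} u<
  where
  u< : u < total (suc N) u
  u< = ≤-trans (m<n+m u (s≤s z≤n)) (≤-trans (m≤n+m _ (suc N)) (≤-trans (m≤n+m _ (suc N)) (m≤n+m _ (suc N))))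
... | S , s | SU , _ with grow six 2+u≤m S (≤-trans u≤ s) SU
...   | T , eq = T , ≤-trans enough (≤-trans (*-monoʳ-≤ 3 s) (≤-reflexive (sym eq)))

enlarge₁ : ∀ a u {n} → total (7 + a * 6) u ≡ n → u ≤ 15 → u ≤ 5 + a * 6 → (∀ {k} → k < n → Attained k) → Attained n
enlarge₁ a u {n} eq u≤15 u≤ = enlarge (6 + a * 6) u {n} eq (coprime₁ (suc a)) (s≤s (s≤s u≤))
  (subst (u ≤_) (sym (need₁ (suc a))) (⊓-glb u≤15 u≤))
  -- With at least 7 residues at least 5 indices are spare, and tripling them gives 15, the most
  -- that is ever needed.
  (≤-trans (need≤15 n) (*-monoʳ-≤ 3 (subst (5 ≤_) (sym (need₁ (suc a))) (⊓-glb (m≤m+n 5 10) (m≤m+n 5 (a * 6))))))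

enlarge₅ : ∀ a u {n} → total (11 + a * 6) u ≡ n → u ≤ 7 → (∀ {k} → k < n → Attained k) → Attained n
enlarge₅ a u {n} eq u≤7 = enlarge (10 + a * 6) u {n} eq (coprime₅ (suc a)) (s≤s (s≤s (≤-trans u≤7 (m≤m+n 7 (2 + a * 6)))))
  (subst (u ≤_) (sym (need₅ (suc a))) (⊓-glb u≤7 (≤-trans u≤7 (m≤m+n 7 (2 + a * 6)))))
  (≤-trans (need≤15 n) (*-monoʳ-≤ 3 (subst (5 ≤_) (sym (need₅ (suc a))) (⊓-glb (m≤m+n 5 2) (m≤m+n 5 (4 + a * 6))))))

-- The remainder of n modulo 24 decides the size m of the parts. For m = 6a + 7 the sizes 4m + u
-- with u up to 15 have remainders 4 to 19; for m = 6a + 11 and u up to 7 they have remainders 20 to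
-- 23 and 0 to 3.
data Digit : ℕ → Set where
  low  : ∀ {i} → i < 4 → Digit i
  mid  : ∀ {i} → i < 16 → Digit (4 + i)
  high : ∀ {i} → i < 4 → Digit (20 + i)

beyond : ∀ c {i k} → c ≤ i → i < c + k → ∃[ j ] j < k × c + j ≡ i
beyond c {i} {k} c≤i i< = i ∸ c , +-cancelˡ-< c (i ∸ c) k (subst (_< c + k) (sym (m+[n∸m]≡n c≤i)) i<) , m+[n∸m]≡n c≤i

digit : ∀ {b} → b < 24 → Digit b
digit {b} b<24 = [ low , upper ]′ (<-≤-connex b 4)
  where
  top : ∀ {i} → i < 20 → 16 ≤ i → Digit (4 + i)
  top i<20 16≤i = let j , j<4 , e = beyond 16 {k = 4} 16≤i i<20 in subst (λ i → Digit (4 + i)) e (high j<4)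
  upper : 4 ≤ b → Digit b
  upper 4≤b = let i , i<20 , e = beyond 4 {k = 20} 4≤b b<24
              in subst Digit e ([ mid , top i<20 ]′ (<-≤-connex i 16))

attained-low : ∀ a {i} → i < 4 → (∀ {k} → k < i + a * 24 → Attained k) → Attained (i + a * 24)
attained-low 0 {zero} _ rec = empty
attained-low 0 {suc i} i<4 rec = subst Attained (sym (+-identityʳ (suc i))) (baseFrom 1 3 refl (≤-pred i<4))
-- Parts of size 5 would leave 4 to 7 vertices over, but have only three free heights; so 24 to 27
-- are taken from the list.
attained-low 1 {i} i<4 rec = subst Attained (+-comm 24 i) (baseFrom 24 4 refl i<4)
attained-low (suc (suc a)) {i} i<4 rec = enlarge₅ a (4 + i) (lem a i) (+-monoʳ-≤ 4 (≤-pred i<4)) rec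
  where
  lem : ∀ a i → (11 + a * 6) + ((11 + a * 6) + ((11 + a * 6) + ((11 + a * 6) + (4 + i)))) ≡ i + (48 + a * 24)
  lem = solve-∀

-- With four copies of ℤ/(6a + 7) more vertices would be left over than there are gaps.
attained-tight : ∀ a {i} → i < 16 → 6 + a * 6 ≤ i → Attained (28 + a * 24 + i)
attained-tight 0 i<16 6≤i = let j , j<10 , e = beyond 6 {k = 10} 6≤i i<16
                         in subst (λ i → Attained (28 + i)) e (baseFrom 34 10 refl j<10)
attained-tight 1 i<16 12≤i = let j , j<4 , e = beyond 12 {k = 4} 12≤i i<16
                          in subst (λ i → Attained (52 + i)) e (baseFrom 64 4 refl j<4)
attained-tight (suc (suc a)) {i} i<16 h = contradiction (≤-trans (m≤m+n 16 (2 + a * 6)) h) (<⇒≱ i<16)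

attained-mid : ∀ a {i} → i < 16 → (∀ {k} → k < 4 + i + a * 24 → Attained k) → Attained (4 + i + a * 24)
attained-mid 0 {i} i<16 rec = subst Attained (sym (+-identityʳ (4 + i))) (baseFrom 4 16 refl i<16)
attained-mid (suc a) {i} i<16 rec with i ≤? 5 + a * 6
... | yes i≤ = enlarge₁ a i (lem a i) (≤-pred i<16) i≤ rec
  where
  lem : ∀ a i → (7 + a * 6) + ((7 + a * 6) + ((7 + a * 6) + ((7 + a * 6) + i))) ≡ 4 + i + (24 + a * 24)
  lem = solve-∀
... | no i≰ = subst Attained (lem a i) (attained-tight a i<16 (≰⇒> i≰))
  where
  lem : ∀ a i → 28 + a * 24 + i ≡ 4 + i + (24 + a * 24)
  lem = solve-∀

attained-high : ∀ a {i} → i < 4 → (∀ {k} → k < 20 + i + a * 24 → Attained k) → Attained (20 + i + a * 24)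
-- The system on 5 vertices has three spare indices and three heights for further vertices. Of the
-- sizes 20 to 23 only 23 is coprime to 6; it needs seven spare indices, and nine are obtained.
attained-high 0 {i} i<4 rec = enlarge 4 i (sym (+-identityʳ (20 + i))) (coprime₅ 0) (s≤s (s≤s (≤-pred i<4))) (≤-pred i<4) (few i<4) rec
  where
  few : ∀ {i} → i < 4 → need (20 + i + 0) ≤ 9
  few {0} _ = z≤n
  few {1} _ = z≤n
  few {2} _ = z≤n
  few {3} _ = m≤m+n 7 2
  few {suc (suc (suc (suc _)))} (s≤s (s≤s (s≤s (s≤s ()))))
attained-high (suc a) {i} i<4 rec = enlarge₅ a i (lem a i) (≤-trans (≤-pred i<4) (m≤m+n 3 4)) rec
  where
  lem : ∀ a i → (11 + a * 6) + ((11 + a * 6) + ((11 + a * 6) + ((11 + a * 6) + i))) ≡ 20 + i + (24 + a * 24)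
  lem = solve-∀

attained-step : ∀ a {b} → Digit b → (∀ {k} → k < b + a * 24 → Attained k) → Attained (b + a * 24)
attained-step a (low i<4)  = attained-low a i<4
attained-step a (mid i<16) = attained-mid a i<16
attained-step a (high i<4) = attained-high a i<4

attained : ∀ n → Attained n
attained = <-rec Attained λ n rec → subst Attained (sym (m≡m%n+[m/n]*n n 24))
  (attained-step (n / 24) (digit (m%n<n n 24)) λ {k} k< → rec (subst (k <_) (sym (m≡m%n+[m/n]*n n 24)) k<))

-- From systems to weakly separating path systems

step-reverse : ∀ {V : Set} {u v : V} {p} → Step u v p → Step v u (reverse p)
step-reverse {u = u} {v} {p = _ ∷ _ ∷ p} here = subst (Step v u)
  (sym (trans (unfold-reverse u (v ∷ p)) (trans (cong (_++ u ∷ []) (unfold-reverse v p)) (++-assoc (reverse p) _ _))))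
  (step-++ʳ (reverse p) here)
step-reverse {p = w ∷ p} (there s) = subst (Step _ _) (sym (unfold-reverse w p)) (step-++ˡ _ (step-reverse s))

joins-reverse : ∀ {V : Set} {u v : V} {p} → Joins p u v → Joins (reverse p) u v
joins-reverse (inj₁ s) = inj₂ (step-reverse s)
joins-reverse (inj₂ s) = inj₁ (step-reverse s)

module _ {n : ℕ} where

  infix⇒step : ∀ {u v : Fin n} {p} → Infix _≡_ (u ∷ v ∷ []) p → Step u v p
  infix⇒step (here (refl ∷ refl ∷ _)) = here
  infix⇒step (there i)                = there (infix⇒step i)

  step⇒infix : ∀ {u v : Fin n} {p} → Step u v p → Infix _≡_ (u ∷ v ∷ []) p
  step⇒infix here      = here (refl ∷ refl ∷ [])
  step⇒infix (there s) = there (step⇒infix s)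

  traverses⇒joins : ∀ {u v : Fin n} {p} → Traverses p u v → Joins p u v
  traverses⇒joins (inj₁ i) = inj₁ (infix⇒step i)
  traverses⇒joins (inj₂ i) = inj₂ (infix⇒step i)

  joins⇒traverses : ∀ {u v : Fin n} {p} → Joins p u v → Traverses p u v
  joins⇒traverses (inj₁ s) = inj₁ (step⇒infix s)
  joins⇒traverses (inj₂ s) = inj₂ (step⇒infix s)

  joins-≈ : ∀ {p q : List (Fin n)} {u v} → p ≈ₚ q → Joins p u v → Joins q u v
  joins-≈ (inj₁ refl) j = j
  joins-≈ {q = q} (inj₂ refl) j = subst (λ l → Joins l _ _) (reverse-involutive q) (joins-reverse j)

  ≈ₚ-sym : ∀ {p q : List (Fin n)} → p ≈ₚ q → q ≈ₚ p
  ≈ₚ-sym (inj₁ refl) = inj₁ refl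
  ≈ₚ-sym {q = q} (inj₂ refl) = inj₂ (sym (reverse-involutive q))

  -- Nothing in a system prevents two of its paths from being equal or reverses of each other,
  -- whereas a path system is a set. Dropping repetitions keeps a copy of every path up to reversal,
  -- which preserves its edges.
  prune : ∀ {G : Graph n} ps → All (IsPath G) ps → ∃[ qs ] IsPathSystem G qs × length qs ≤ length ps ×
          (∀ {q} → q ∈ qs → q ∈ ps) × (∀ {p} → p ∈ ps → ∃[ q ] q ∈ qs × p ≈ₚ q)
  prune []       []       = [] , mkSystem [] [] , z≤n , (λ ()) , λ ()
  prune {G} (p ∷ ps) (P ∷ Ps) with prune ps Ps
  ... | qs , sys , l≤ , sub , rep with any? (λ q → _≈ₚ?_ G p q) qs
  ...   | yes old = qs , sys , m≤n⇒m≤1+n l≤ , (λ q∈ → there (sub q∈)) ,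
                    λ { (here refl) → find old ; (there p∈) → rep p∈ }
  ...   | no  new = p ∷ qs , mkSystem (P ∷ IsPathSystem.paths sys) (¬Any⇒All¬ qs new ∷ IsPathSystem.distinct sys) , s≤s l≤ ,
                    (λ { (here refl) → here refl ; (there q∈) → there (sub q∈) }) ,
                    λ { (here refl) → p , here refl , inj₁ refl
                      ; (there p∈) → let q , q∈ , e = rep p∈ in q , there q∈ , e }

  -- If neither of two edges were separated from the other, each path through one would pass through
  -- the other, and `separates` would make them equal.
  weaklySeparating : System (Fin n) → ∃[ k ] k ≤ n × HasWeaklySeparatingSystem (complete n) k
  weaklySeparating S = length qs , subst (length qs ≤_) count l≤ , qs , sys , refl , separating
    where
    open System S
    G = complete n
    isPath : ∀ v → IsPath G (path v)
    isPath v = mkPath (λ ()) (simple v) (AllPairs⇒Linked (simple v))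
    ps = map path (allFin n)
    pruned = prune {G} ps (Allₚ.map⁺ (All.universal isPath (allFin n)))
    qs = proj₁ pruned
    sys = proj₁ (proj₂ pruned)
    l≤ = proj₁ (proj₂ (proj₂ pruned))
    count : length ps ≡ n
    count = trans (length-map path (allFin n)) (length-tabulate (λ i → i))
    inclusion : ∀ (e f : Edge G) → ¬ Separates qs e f →
                ∀ i → Joins (path i) (Edge.end₁ e) (Edge.end₂ e) → Joins (path i) (Edge.end₁ f) (Edge.end₂ f)
    inclusion e f none i j with proj₂ (proj₂ (proj₂ (proj₂ pruned))) (∈-map⁺ path (∈-allFin i))
    ... | q , q∈ , p≈q with traverses? G q (Edge.end₁ f) (Edge.end₂ f)
    ...   | yes t = joins-≈ (≈ₚ-sym p≈q) (traverses⇒joins t)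
    ...   | no ¬t = contradiction (lose q∈ (joins⇒traverses (joins-≈ p≈q j) , ¬t)) none
    separating : WeaklySeparates G qs
    separating e f e≉f with separates? G qs e f | separates? G qs f e
    ... | yes s | _     = inj₁ s
    ... | no  _ | yes s = inj₂ s
    ... | no ¬s | no ¬t = contradiction (separates (Edge.adjacent e) (Edge.adjacent f) (inclusion e f ¬s) (inclusion f e ¬t)) e≉f

theorem1 : (n : ℕ) → wsp (complete n) ≤ n + 1
theorem1 n = let _ , k≤n , has = weaklySeparating (proj₁ (attained n))
             in ≤-trans (proj₂ (wsp-isLeast (complete n)) has) (≤-trans k≤n (m≤m+n n 1))
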